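{- Let $r\ge 3$ be odd, let $q$ be a prime power, let $\mathcal L$ be an $m$-cover of $\mathcal W(r,q)$ and let $\bar{\mathcal L}$ be the set of points of $\mathcal H(r,q^2)$ lying on the extended lines of $\mathcal L$. Then $\bar{\mathcal L}$ is an $(m(q^2-q)+q+1)$-tight set of $\mathcal H(r,q^2)$ if and only if $\mathcal L$ is an $(r-2)$-dual cover of symplectic type.
   Context: $\theta_{n,q}=q^n+\dots+q+1$ for $n\ge0$, $\theta_{ -1,q}=0$; $\theta_{n,q^2}$ is the same expression with $q^2$ in place of $q$. $\mathcal W(r,q)$ is the symplectic polar space of $\mathrm{PG}(r,q)$ given by a nondegenerate alternating form $b$ on $\mathbb F_q^{r+1}$, with polarity $\perp$. Its points are all points of $\mathrm{PG}(r,q)$ and its lines are the totally isotropic lines. An $m$-cover of $\mathcal W(r,q)$ ($m>0$) is a set $\mathcal L$ of lines of $\mathcal W(r,q)$ such that every point lies on exactly $m$ lines of $\mathcal L$. $\mathcal L$ is $(r-2)$-dual of symplectic type if for every line $\ell$ of $\mathrm{PG}(r,q)$ the number of lines of $\mathcal L$ contained in $\ell^\perp$ equals $\frac{m\theta_{r-4,q}}{q+1}+q^{r-3}$ if $\ell\in\mathcal L$, and $\frac{m\theta_{r-4,q}}{q+1}$ if $\ell\notin\mathcal L$. $\mathrm{PG}(r,q)$ is embedded in $\mathrm{PG}(r,q^2)$ by extension of scalars; the extended line of a line $\ell$ of $\mathrm{PG}(r,q)$ is the line of $\mathrm{PG}(r,q^2)$ containing the $q+1$ points of $\ell$. Let $\tau$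 be the semilinear involution of $\mathrm{PG}(r,q^2)$ raising coordinates to the $q$-th power (fixing $\mathrm{PG}(r,q)$ pointwise) and $B$ the $\mathbb F_{q^2}$-bilinear extension of $b$. $\mathcal H(r,q^2)$ is the non-degenerate Hermitian variety $\{\langle x\rangle : B(x,\tau(x))=0\}$, which is exactly the set of points on the extended lines of $\mathcal W(r,q)$; its unitary polarity is $\langle x\rangle^{\perp_h}=\{y: B(y,\tau(x))=0\}$. A subset $\mathcal X$ of points of $\mathcal H(r,q^2)$ is $i$-tight if for every point $P$ of $\mathcal H(r,q^2)$, $|P^{\perp_h}\cap\mathcal X|$ equals $i\,\theta_{\frac{r-3}{2},q^2}+q^{r-1}$ if $P\in\mathcal X$ and $i\,\theta_{\frac{r-3}{2},q^2}$ if $P\notin\mathcal X$. -}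

module Defs where

open import Algebra.Bundles using (CommutativeRing)
open import Algebra.Structures using (IsCommutativeRing)
open import Algebra.Morphism.Structures using (IsRingHomomorphism)
import Algebra.Properties.Semiring.Exp as Exp
import Algebra.Properties.Semiring.Sum as Sum
open import Data.Fin.Base using (Fin)
import Data.Fin.Properties as Fin
open import Data.Integer.Base as ℤ using (ℤ; +_; -[1+_])
open import Data.Nat.Base as ℕ using (ℕ; zero; suc; _∸_; _/_)
open import Data.Nat.Primality using (Prime)
open import Data.Product.Base using (Σ; ∃; ∃₂; _×_; _,_; proj₁; proj₂)
open import Data.Vec.Base using (Vec; []; _∷_; map; zipWith; replicate; lookup; _[_]≔_)
open import Data.Vec.Properties using (map-id; map-cong; map-∘; ∷-injectiveˡ; ∷-injectiveʳ)
open import Function.Base using (_∘_)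
open import Function.Bundles using (Inverse; _↔_; _⇔_)
import Function.Properties.Equivalence as ⇔
open import Function.Properties.Inverse using (↔⇒↣)
open import Level using (0ℓ)
open import Relation.Binary.Bundles using (Setoid)
import Relation.Binary.Construct.On as On
open import Relation.Binary.Definitions using (_Respects_; DecidableEquality)
open import Relation.Binary.PropositionalEquality
  using (_≡_; _≢_; refl; sym; trans; cong; cong₂; setoid; module ≡-Reasoning)
open import Relation.Nullary.Decidable using (decidable-stable; via-injection)
open import Relation.Unary using (Pred; _∈_; _∉_; _⊆_; _∩_)

IsPrimePower : ℕ → Set
IsPrimePower q = ∃₂ λ p k → Prime p × q ≡ p ℕ.^ suc k

-- θ n q = qⁿ + ⋯ + q + 1 for n ≥ 0 and θ -1 q = 0.
-- The values at n < -1 are irrelevant.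
θ : ℤ → ℕ → ℕ
θ (+ zero)  q = 1
θ (+ suc n) q = q ℕ.^ suc n ℕ.+ θ (+ n) q
θ -[1+ _ ]  q = 0

-- The subset P of S, considered up to the equality of S, has exactly n
-- elements.
HasSize : (S : Setoid 0ℓ 0ℓ) → Pred (Setoid.Carrier S) 0ℓ → ℕ → Set
HasSize S P n = Inverse (On.setoid S (proj₁ {B = P})) (setoid (Fin n))

record FiniteField (q : ℕ) : Set₁ where
  infixl 7 _*_
  infixl 6 _+_
  field
    Carrier           : Set
    _+_ _*_           : Carrier → Carrier → Carrier
    -_                : Carrier → Carrier
    0# 1#             : Carrier
    isCommutativeRing : IsCommutativeRing _≡_ _+_ _*_ -_ 0# 1#
    0≢1               : 0# ≢ 1#
    inverse           : ∀ x → x ≢ 0# → ∃ λ y → x * y ≡ 1#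
    finite            : Carrier ↔ Fin q

  commutativeRing : CommutativeRing 0ℓ 0ℓ
  commutativeRing = record { isCommutativeRing = isCommutativeRing }

  open CommutativeRing commutativeRing public
    using (rawRing; semiring; *-assoc; *-comm; *-identityˡ; zeroˡ; zeroʳ)
  _≟_ : DecidableEquality Carrier
  _≟_ = via-injection (↔⇒↣ finite) Fin._≟_

  open Exp semiring public using (_^_)
  open Sum semiring public using (sum)

-- PG(n,F), the projective space of the vector space Fⁿ⁺¹.
module Projective {q : ℕ} (F : FiniteField q) (n : ℕ) where
  open FiniteField F

  infixl 6 _+ᵛ_
  infixr 7 _·_

  V : Set
  V = Vec Carrier (suc n)

  0ᵛ : V
  0ᵛ = replicate (suc n) 0#

  _+ᵛ_ : V → V → V
  _+ᵛ_ = zipWith _+_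

  _·_ : Carrier → V → V
  c · x = map (c *_) x

  basis : Fin (suc n) → V
  basis i = 0ᵛ [ i ]≔ 1#

  ·-identity : ∀ x → 1# · x ≡ x
  ·-identity x = trans (map-cong *-identityˡ x) (map-id x)

  ·-assoc : ∀ c d x → c · d · x ≡ (c * d) · x
  ·-assoc c d x =
    trans (sym (map-∘ (c *_) (d *_) x)) (map-cong (λ y → sym (*-assoc c d y)) x)

  inverse-≢0 : ∀ {c d} → c * d ≡ 1# → d ≢ 0#
  inverse-≢0 {c} cd≡1 refl = 0≢1 (trans (sym (zeroʳ c)) cd≡1)

  Point : Set
  Point = Σ V (_≢ 0ᵛ)

  _≈ₚ_ : Point → Point → Set
  (x , _) ≈ₚ (y , _) = ∃ λ c → c ≢ 0# × c · x ≡ y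

  points : Setoid 0ℓ 0ℓ
  points = record
    { Carrier       = Point
    ; _≈_           = _≈ₚ_
    ; isEquivalence = record
      { refl  = λ {P} → 1# , 0≢1 ∘ sym , ·-identity (proj₁ P)
      ; sym   = λ {P} → ≈-sym (proj₁ P)
      ; trans = λ {P} → ≈-trans (proj₁ P)
      }
    }
    where
    ≈-sym : ∀ x {y} → (∃ λ c → c ≢ 0# × c · x ≡ y) → ∃ λ c → c ≢ 0# × c · y ≡ x
    ≈-sym x (c , c≢0 , refl) =
      let d , cd≡1 = inverse c c≢0
          dc≡1     = trans (*-comm d c) cd≡1
      in d , inverse-≢0 cd≡1
       , trans (·-assoc d c x) (trans (cong (_· x) dc≡1) (·-identity x))

    ≈-trans : ∀ x {y z} → (∃ λ c → c ≢ 0# × c · x ≡ y) →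
              (∃ λ c → c ≢ 0# × c · y ≡ z) → ∃ λ c → c ≢ 0# × c · x ≡ z
    ≈-trans x (c , c≢0 , refl) (d , d≢0 , refl) =
      d * c , dc≢0 , sym (·-assoc d c x)
      where
      dc≢0 : d * c ≢ 0#
      dc≢0 dc≡0 = let e , de≡1 = inverse d d≢0 in c≢0 (begin
        c            ≡⟨ *-identityˡ c ⟨
        1# * c       ≡⟨ cong (_* c) (trans (*-comm e d) de≡1) ⟨
        e * d * c    ≡⟨ *-assoc e d c ⟩
        e * (d * c)  ≡⟨ cong (e *_) dc≡0 ⟩
        e * 0#       ≡⟨ zeroʳ e ⟩
        0#           ∎)
        where open ≡-Reasoning

  record Line : Set where
    constructor ⟨_,_⟩[_]
    field
      u v         : V
      independent : ∀ α β → α · u +ᵛ β · v ≡ 0ᵛ → α ≡ 0# × β ≡ 0#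

  pointsOf : Line → Pred Point 0ℓ
  pointsOf ⟨ u , v ⟩[ _ ] (x , _) = ∃₂ λ α β → α · u +ᵛ β · v ≡ x

  -- Two lines are equal when they have the same points.
  lines : Setoid 0ℓ 0ℓ
  lines = record
    { Carrier       = Line
    ; _≈_           = λ ℓ ℓ′ → ∀ P → P ∈ pointsOf ℓ ⇔ P ∈ pointsOf ℓ′
    ; isEquivalence = record
      { refl  = λ P → ⇔.refl
      ; sym   = λ e P → ⇔.sym (e P)
      ; trans = λ e f P → ⇔.trans (e P) (f P)
      }
    }

-- A nondegenerate alternating bilinear form on F^(r+1).
record SymplecticForm {q : ℕ} (F : FiniteField q) (r : ℕ) : Set where
  open FiniteField F
  open Projective F r
  field
    form          : V → V → Carrier
    additiveˡ     : ∀ x y z → form (x +ᵛ y) z ≡ form x z + form y z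
    additiveʳ     : ∀ x y z → form x (y +ᵛ z) ≡ form x y + form x z
    homogeneousˡ  : ∀ c x y → form (c · x) y ≡ c * form x y
    homogeneousʳ  : ∀ c x y → form x (c · y) ≡ c * form x y
    alternating   : ∀ x → form x x ≡ 0#
    nondegenerate : ∀ x → (∀ y → form x y ≡ 0#) → x ≡ 0ᵛ

module Symplectic {q : ℕ} (F : FiniteField q) (r : ℕ) (b : SymplecticForm F r) where
  open FiniteField F using (0#)
  open Projective F r
  open SymplecticForm b

  infix 9 _^⊥

  _^⊥ : Line → Pred Point 0ℓ
  (ℓ ^⊥) (x , _) = ∀ Q → Q ∈ pointsOf ℓ → form x (proj₁ Q) ≡ 0#

  TotallyIsotropic : Pred Line 0ℓ
  TotallyIsotropic ℓ = pointsOf ℓ ⊆ ℓ ^⊥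

  record IsCover (m : ℕ) (ℒ : Pred Line 0ℓ) : Set where
    field
      positive  : 0 ℕ.< m
      respects  : ℒ Respects Setoid._≈_ lines
      isotropic : ℒ ⊆ TotallyIsotropic
      covers    : ∀ P → HasSize lines (λ ℓ → ℓ ∈ ℒ × P ∈ pointsOf ℓ) m

  -- (r-2)-dual of symplectic type, for odd r ≥ 3.  The division is exact: r-3
  -- is even, so q+1 divides θ_{r-4,q} = 1 + q + ⋯ + q^{r-4} (a sum of r-3 terms).
  IsDualOfSymplecticType : ℕ → Pred Line 0ℓ → Set
  IsDualOfSymplecticType m ℒ = ∀ ℓ →
    (ℓ ∈ ℒ → HasSize lines (inPerp ℓ) (k ℕ.+ q ℕ.^ (r ∸ 3))) ×
    (ℓ ∉ ℒ → HasSize lines (inPerp ℓ) k)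
    where
    k = (m ℕ.* θ (+ r ℤ.- + 4) q) / suc q

    inPerp : Line → Pred Line 0ℓ
    inPerp ℓ ℓ′ = ℓ′ ∈ ℒ × pointsOf ℓ′ ⊆ ℓ ^⊥

-- A field homomorphism, exhibiting K as an extension of F.
record Extension {q q′ : ℕ} (F : FiniteField q) (K : FiniteField q′) : Set where
  private
    module F = FiniteField F
    module K = FiniteField K
  field
    ι              : F.Carrier → K.Carrier
    isHomomorphism : IsRingHomomorphism F.rawRing K.rawRing ι

  open IsRingHomomorphism isHomomorphism using (1#-homo; *-homo)

  ι≡0⇒≡0 : ∀ {x} → ι x ≡ K.0# → x ≡ F.0#
  ι≡0⇒≡0 {x} ιx≡0 = decidable-stable (x F.≟ F.0#) λ x≢0 →
    let y , xy≡1 = F.inverse x x≢0 in K.0≢1 (begin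
      K.0#          ≡⟨ K.zeroˡ (ι y) ⟨
      K.0# K.* ι y  ≡⟨ cong (K._* ι y) ιx≡0 ⟨
      ι x K.* ι y   ≡⟨ *-homo x y ⟨
      ι (x F.* y)   ≡⟨ cong ι xy≡1 ⟩
      ι F.1#        ≡⟨ 1#-homo ⟩
      K.1#          ∎)
    where open ≡-Reasoning

  map-ι≡0⇒≡0 : ∀ {n} (x : Vec F.Carrier n) →
               map ι x ≡ replicate n K.0# → x ≡ replicate n F.0#
  map-ι≡0⇒≡0 []      _  = refl
  map-ι≡0⇒≡0 (a ∷ x) eq =
    cong₂ _∷_ (ι≡0⇒≡0 (∷-injectiveˡ eq)) (map-ι≡0⇒≡0 x (∷-injectiveʳ eq))

module Hermitian {q : ℕ} (F : FiniteField q) (K : FiniteField (q ℕ.^ 2))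
                 (E : Extension F K) (r : ℕ) (b : SymplecticForm F r) where
  private
    module PGF = Projective F r
    module PGK = Projective K r
  open FiniteField K
  open Extension E
  open SymplecticForm b

  embed : PGF.Point → PGK.Point
  embed (x , x≢0) = map ι x , x≢0 ∘ map-ι≡0⇒≡0 x

  ExtendedLine : PGF.Line → Pred PGK.Line 0ℓ
  ExtendedLine ℓ M = ∀ P → P ∈ PGF.pointsOf ℓ → embed P ∈ PGK.pointsOf M

  τ : PGK.V → PGK.V
  τ = map (_^ q)

  -- The unique K-bilinear form with B (map ι x) (map ι y) = ι (form x y),
  -- written in coordinates via the Gram matrix of form.
  B : PGK.V → PGK.V → Carrier
  B x y = sum λ i → sum λ j →
    lookup x i * ι (form (PGF.basis i) (PGF.basis j)) * lookup y j

  ℋ : Pred PGK.Point 0ℓ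
  ℋ (x , _) = B x (τ x) ≡ 0#

  infix 9 _^⊥ʰ

  _^⊥ʰ : PGK.Point → Pred PGK.Point 0ℓ
  ((x , _) ^⊥ʰ) (y , _) = B y (τ x) ≡ 0#

  -- Odd r ≥ 3 is intended, so that (r-3)/2 is an integer.
  record IsTight (i : ℕ) (𝒳 : Pred PGK.Point 0ℓ) : Set where
    field
      respects : 𝒳 Respects Setoid._≈_ PGK.points
      ⊆ℋ       : 𝒳 ⊆ ℋ
      inside   : ∀ P → P ∈ ℋ → P ∈ 𝒳 → HasSize PGK.points (P ^⊥ʰ ∩ 𝒳)
                   (i ℕ.* θ (+ ((r ∸ 3) / 2)) (q ℕ.^ 2) ℕ.+ q ℕ.^ (r ∸ 1))
      outside  : ∀ P → P ∈ ℋ → P ∉ 𝒳 → HasSize PGK.points (P ^⊥ʰ ∩ 𝒳)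
                   (i ℕ.* θ (+ ((r ∸ 3) / 2)) (q ℕ.^ 2))

  extendedPoints : Pred PGF.Line 0ℓ → Pred PGK.Point 0ℓ
  extendedPoints ℒ Q =
    Q ∈ ℋ × ∃₂ λ ℓ M → ℓ ∈ ℒ × M ∈ ExtendedLine ℓ × Q ∈ PGK.pointsOf M

{-# OPTIONS --safe #-}

-- Fix ω in 𝔽_{q²} outside 𝔽_q and write the vectors of 𝔽_{q²}^{r+1} as x = u + ω v.
-- If u and v are dependent, then x represents a point of PG(r,q); otherwise ⟨u,v⟩ is
-- the only line of PG(r,q) whose extension contains ⟨x⟩.  Counting in two ways the
-- vectors of x^⊥ on the extended lines of ℒ expresses |x^⊥ ∩ ℒ̄| through the number of
-- lines of ℒ in ⟨u,v⟩^⊥.  If ⟨u,v⟩ is a point, this number is determined by m; if it is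
-- a line, the tight condition on |x^⊥ ∩ ℒ̄| becomes the dual condition on ⟨u,v⟩.
--
-- The dual condition also concerns lines ⟨u,v⟩ that are not totally isotropic, that is,
-- x outside ℋ, where tightness says nothing.  There |x^⊥ ∩ ℒ̄| is found by a variance
-- argument: the first two moments of x ↦ |x^⊥ ∩ ℒ̄| over PG(r,q²) depend only on |ℒ̄|,
-- and together with its values on ℒ̄ they leave no deviation from the expected constant.
--
-- All counts are counts of vectors and are taken in ℤ.

module Submission where

open import Defs
open import Algebra.Bundles using (CommutativeRing)
open import Algebra.Morphism.Structures using (IsRingHomomorphism)
import Algebra.Properties.CommutativeMonoid.Sum as MonoidSum
import Algebra.Properties.CommutativeSemiring.Binomial as Binomial
import Algebra.Properties.CommutativeSemiring.Exp as CommutativeExp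
import Algebra.Properties.Ring as RingProperties
import Algebra.Properties.Semiring.Exp as Exp
import Algebra.Properties.Semiring.Mult as Mult
import Algebra.Properties.Semiring.Sum as SemiringSum
import Algebra.Solver.Ring.NaturalCoefficients.Default as SemiringSolver
open import Data.Fin.Base using (Fin; zero; suc; inject₁; fromℕ)
import Data.Fin.Permutation as Permutation
import Data.Fin.Properties as Fin
open import Data.Integer.Base as ℤ using (ℤ; +_; 0ℤ; 1ℤ; +≤+)
import Data.Integer.Properties as ℤ
import Data.Integer.Tactic.RingSolver as ℤSolver
open import Data.List.Base as List using (List; []; _∷_; _++_; deduplicate; length; lookup)
open import Data.List.Membership.Propositional as List using ()
open import Data.List.Membership.Propositional.Properties using (∈-lookup)
import Data.List.Membership.Setoid as SetoidMembership
import Data.List.Membership.Setoid.Properties as SetoidMembershipₚ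
import Data.List.Relation.Unary.All as All
open import Data.List.Relation.Unary.AllPairs using (AllPairs; _∷_)
open import Data.List.Relation.Unary.Any as Any using (here; there)
import Data.List.Relation.Unary.Any.Properties as Anyₚ
import Data.List.Relation.Unary.Unique.DecSetoid.Properties as Unique
open import Data.Nat.Base as ℕ using (ℕ; zero; suc; z≤n)
open import Data.Nat.Combinatorics using (_C_; nCk≡n!/k![n-k]!; nCn≡1; k![n∸k]!∣n!)
open import Data.Nat.Divisibility using (_∣_; _∤_; divides; ∣⇒≤; m∣m*n)
open import Data.Nat.DivMod using (m/n*n≡m; m*n/n≡m; m≡m%n+[m/n]*n; m%n<n)
open import Data.Nat.Primality using (Prime; euclidsLemma; prime⇒nonTrivial)
import Data.Nat.Properties as ℕ
import Data.Nat.Tactic.RingSolver as ℕSolver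
open import Data.Product.Base using (Σ; ∃; ∃₂; _×_; _,_; proj₁; proj₂)
open import Data.Product.Properties using (≡-dec)
open import Data.Sum.Base using (_⊎_; inj₁; inj₂; [_,_]′)
open import Data.Vec.Base as Vec using (Vec; []; _∷_)
import Data.Vec.Properties as Vec
open import Function.Base using (_∘_; id)
open import Function.Bundles using (Inverse; Injection; Equivalence; _↔_; _⇔_; mk⇔)
open import Function.Properties.Inverse using (↔⇒↣)
open import Level using (0ℓ)
open import Relation.Binary.Bundles using (Setoid; DecSetoid)
import Relation.Binary.Construct.On as On
open import Relation.Binary.Definitions using (DecidableEquality; _Respects_)
open import Relation.Binary.PropositionalEquality renaming (setoid to ≡-setoid)
open import Relation.Nullary using (Dec; yes; no; ¬_; ¬?; _×-dec_; _→-dec_; contradiction)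
open import Relation.Nullary.Decidable using (via-injection; map′)
open import Relation.Unary using (Pred; _∩_; _⊆_)

-- The parameter i = m(q² - q) + q + 1 is forced by the size of ℒ̄. An m-cover has m(q^(r+1) -
-- 1)/(q² - 1) lines; each extended line has q² - q points off PG(r,q), and no two share such a
-- point; the (q + 1)(q^(r+1) - 1)/(q² - 1) points of PG(r,q) are all covered. Hence |ℒ̄| =
-- i(q^(r+1) - 1)/(q² - 1). The moments depend on |ℒ̄| alone because any two distinct points of
-- PG(r,q²) have equally many common perpendicular points. Summing over vectors instead of points
-- adds one exceptional argument, the zero vector, to which all of ℒ̄ is perpendicular. The sum of
-- the squared deviations turns out to equal the square at the zero vector, so the squares at all
-- other vectors sum to zero. Since ℒ is an arbitrary predicate on lines, its decidability and
-- finiteness have to be extracted from the cover condition before anything can be counted.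

private variable
  A A′ P R : Set

-- Finite sums

-- The Iverson bracket. It takes a decision instead of a proposition, so that any decision procedure
-- at hand may be summed; `⟦⟧-cong` makes the choice of the procedure irrelevant.
⟦_⟧ : Dec P → ℤ
⟦ yes _ ⟧ = 1ℤ
⟦ no  _ ⟧ = 0ℤ

⟦⟧-true : (d : Dec P) → P → ⟦ d ⟧ ≡ 1ℤ
⟦⟧-true (yes _)  _ = refl
⟦⟧-true (no ¬p) p = contradiction p ¬p

⟦⟧-false : (d : Dec P) → ¬ P → ⟦ d ⟧ ≡ 0ℤ
⟦⟧-false (yes p) ¬p = contradiction p ¬p
⟦⟧-false (no _)  _  = refl

⟦⟧-cong : (d : Dec P) (e : Dec R) → (P → R) → (R → P) → ⟦ d ⟧ ≡ ⟦ e ⟧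
⟦⟧-cong (yes p) e f _ = sym (⟦⟧-true e (f p))
⟦⟧-cong (no ¬p) e _ g = sym (⟦⟧-false e (¬p ∘ g))

⟦⟧-× : (d : Dec P) (e : Dec R) → ⟦ d ×-dec e ⟧ ≡ ⟦ d ⟧ ℤ.* ⟦ e ⟧
⟦⟧-× (yes _) (yes _) = refl
⟦⟧-× (yes _) (no _)  = refl
⟦⟧-× (no _)  e       = refl

⟦⟧-¬ : (d : Dec P) → ⟦ ¬? d ⟧ ≡ 1ℤ ℤ.- ⟦ d ⟧
⟦⟧-¬ (yes _) = refl
⟦⟧-¬ (no _)  = refl

-- Under a bracket as weight, the other factor matters only where the weight is 1, so P may be
-- assumed there.
⟦⟧-*-cong : (d : Dec P) {x y : ℤ} → (P → x ≡ y) → ⟦ d ⟧ ℤ.* x ≡ ⟦ d ⟧ ℤ.* y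
⟦⟧-*-cong (yes p) eq = cong (1ℤ ℤ.*_) (eq p)
⟦⟧-*-cong (no _)  _  = refl

⟦⟧-*-≥0 : (d : Dec P) {x : ℤ} → 0ℤ ℤ.≤ x → 0ℤ ℤ.≤ ⟦ d ⟧ ℤ.* x
⟦⟧-*-≥0 (yes _) {x} 0≤x = subst (0ℤ ℤ.≤_) (sym (ℤ.*-identityˡ x)) 0≤x
⟦⟧-*-≥0 (no _)      _   = ℤ.≤-refl

∑ᴸ : List A → (A → ℤ) → ℤ
∑ᴸ []       f = 0ℤ
∑ᴸ (x ∷ xs) f = f x ℤ.+ ∑ᴸ xs f

∑ᴸ-cong : ∀ (xs : List A) {f g : A → ℤ} → (∀ x → f x ≡ g x) → ∑ᴸ xs f ≡ ∑ᴸ xs g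
∑ᴸ-cong []       eq = refl
∑ᴸ-cong (x ∷ xs) eq = cong₂ ℤ._+_ (eq x) (∑ᴸ-cong xs eq)

∑ᴸ-+ : ∀ (xs : List A) (f g : A → ℤ) →
       ∑ᴸ xs (λ x → f x ℤ.+ g x) ≡ ∑ᴸ xs f ℤ.+ ∑ᴸ xs g
∑ᴸ-+ []       f g = refl
∑ᴸ-+ (x ∷ xs) f g rewrite ∑ᴸ-+ xs f g =
  interchange (f x) (g x) (∑ᴸ xs f) (∑ᴸ xs g)
  where
  interchange : ∀ a b c d → (a ℤ.+ b) ℤ.+ (c ℤ.+ d) ≡ (a ℤ.+ c) ℤ.+ (b ℤ.+ d)
  interchange = ℤSolver.solve-∀

∑ᴸ-*ˡ : ∀ (xs : List A) c (f : A → ℤ) → ∑ᴸ xs (λ x → c ℤ.* f x) ≡ c ℤ.* ∑ᴸ xs f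
∑ᴸ-*ˡ []       c f = sym (ℤ.*-zeroʳ c)
∑ᴸ-*ˡ (x ∷ xs) c f rewrite ∑ᴸ-*ˡ xs c f = sym (ℤ.*-distribˡ-+ c (f x) (∑ᴸ xs f))

∑ᴸ-zero : ∀ (xs : List A) → ∑ᴸ xs (λ _ → 0ℤ) ≡ 0ℤ
∑ᴸ-zero []       = refl
∑ᴸ-zero (x ∷ xs) = trans (ℤ.+-identityˡ _) (∑ᴸ-zero xs)

∑ᴸ-swap : ∀ (xs : List A) (ys : List A′) (f : A → A′ → ℤ) →
          ∑ᴸ xs (λ x → ∑ᴸ ys (f x)) ≡ ∑ᴸ ys (λ y → ∑ᴸ xs (λ x → f x y))
∑ᴸ-swap []       ys f = sym (∑ᴸ-zero ys)
∑ᴸ-swap (x ∷ xs) ys f =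
  trans (cong (λ z → ∑ᴸ ys (f x) ℤ.+ z) (∑ᴸ-swap xs ys f)) (sym (∑ᴸ-+ ys (f x) _))

∑ᴸ-++ : ∀ (xs ys : List A) (f : A → ℤ) → ∑ᴸ (xs ++ ys) f ≡ ∑ᴸ xs f ℤ.+ ∑ᴸ ys f
∑ᴸ-++ []       ys f = sym (ℤ.+-identityˡ _)
∑ᴸ-++ (x ∷ xs) ys f =
  trans (cong (λ z → f x ℤ.+ z) (∑ᴸ-++ xs ys f)) (sym (ℤ.+-assoc (f x) _ _))

∑ᴸ-map : ∀ (g : A → A′) xs (f : A′ → ℤ) → ∑ᴸ (List.map g xs) f ≡ ∑ᴸ xs (f ∘ g)
∑ᴸ-map g []       f = refl
∑ᴸ-map g (x ∷ xs) f = cong (λ z → f (g x) ℤ.+ z) (∑ᴸ-map g xs f)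

∑ᴸ-cartesianProduct : ∀ (xs : List A) (ys : List A′) f →
  ∑ᴸ (List.cartesianProduct xs ys) f ≡ ∑ᴸ xs (λ x → ∑ᴸ ys (λ y → f (x , y)))
∑ᴸ-cartesianProduct []       ys f = refl
∑ᴸ-cartesianProduct (x ∷ xs) ys f =
  trans (∑ᴸ-++ (List.map (x ,_) ys) _ f)
        (cong₂ ℤ._+_ (∑ᴸ-map (x ,_) ys f) (∑ᴸ-cartesianProduct xs ys f))

∑ᴸ-nonneg : ∀ (xs : List A) {f : A → ℤ} → (∀ x → 0ℤ ℤ.≤ f x) → 0ℤ ℤ.≤ ∑ᴸ xs f
∑ᴸ-nonneg []       _   = +≤+ z≤n
∑ᴸ-nonneg (x ∷ xs) 0≤f = ℤ.+-mono-≤ (0≤f x) (∑ᴸ-nonneg xs 0≤f)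

∑ᴸ-≡0 : ∀ (xs : List A) {f : A → ℤ} → (∀ x → 0ℤ ℤ.≤ f x) → ∑ᴸ xs f ≡ 0ℤ →
        ∀ {x} → x List.∈ xs → f x ≡ 0ℤ
∑ᴸ-≡0 (y ∷ xs) {f} 0≤f eq (here refl) = ℤ.≤-antisym
  (ℤ.≤-trans (ℤ.≤-reflexive (sym (ℤ.+-identityʳ (f y))))
    (ℤ.≤-trans (ℤ.+-monoʳ-≤ (f y) (∑ᴸ-nonneg xs 0≤f)) (ℤ.≤-reflexive eq)))
  (0≤f y)
∑ᴸ-≡0 (y ∷ xs) {f} 0≤f eq (there x∈) = ∑ᴸ-≡0 xs 0≤f (ℤ.≤-antisym
  (ℤ.≤-trans (ℤ.≤-reflexive (sym (ℤ.+-identityˡ _)))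
    (ℤ.≤-trans (ℤ.+-monoˡ-≤ (∑ᴸ xs f) (0≤f y)) (ℤ.≤-reflexive eq)))
  (∑ᴸ-nonneg xs 0≤f)) x∈

-- Occurrence exactly once is stated as a sum of brackets because this is the form in which sums use
-- it: it is the delta identity behind `∑-δ`, `∑-unique` and all double counts. A complete list also
-- decides both quantifiers.
record Enumeration (A : Set) : Set where
  infix 4 _≟_
  field
    elements : List A
    _≟_      : DecidableEquality A
    once     : ∀ a → ∑ᴸ elements (λ x → ⟦ x ≟ a ⟧) ≡ 1ℤ

  complete : ∀ a → a List.∈ elements
  complete a with Any.any? (λ x → a ≟ x) elements
  ... | yes a∈ = a∈
  ... | no  a∉ = contradiction (trans (sym (once a)) (none elements a∉)) λ ()
    where
    none : ∀ xs → ¬ (a List.∈ xs) → ∑ᴸ xs (λ x → ⟦ x ≟ a ⟧) ≡ 0ℤ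
    none []       _  = refl
    none (x ∷ xs) a∉ = cong₂ ℤ._+_ (⟦⟧-false (x ≟ a) (a∉ ∘ here ∘ sym)) (none xs (a∉ ∘ there))

  any? : {P : A → Set} → (∀ a → Dec (P a)) → Dec (∃ P)
  any? P? = map′ Any.satisfied (λ (a , p) → lose′ (complete a) p) (Any.any? P? elements)
    where
    lose′ : ∀ {P : A → Set} {a xs} → a List.∈ xs → P a → Any.Any P xs
    lose′ (here refl) p = here p
    lose′ (there a∈)  p = there (lose′ a∈ p)

  all? : {P : A → Set} → (∀ a → Dec (P a)) → Dec (∀ a → P a)
  all? P? = map′ (λ ps a → All.lookup ps (complete a)) (λ ps → All.universal ps elements)
                 (All.all? P? elements)


open Enumeration using (elements; once; complete)

∑ : Enumeration A → (A → ℤ) → ℤ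
∑ E = ∑ᴸ (elements E)

module _ (E : Enumeration A) where
  open Enumeration E using (_≟_)

  ∑-cong : {f g : A → ℤ} → (∀ x → f x ≡ g x) → ∑ E f ≡ ∑ E g
  ∑-cong = ∑ᴸ-cong (elements E)

  ∑-+ : ∀ f g → ∑ E (λ x → f x ℤ.+ g x) ≡ ∑ E f ℤ.+ ∑ E g
  ∑-+ = ∑ᴸ-+ (elements E)

  ∑-minus : ∀ f g → ∑ E (λ x → f x ℤ.- g x) ≡ ∑ E f ℤ.- ∑ E g
  ∑-minus f g = begin
    ∑ E (λ x → f x ℤ.- g x)                 ≡⟨ ∑-cong (λ x → cong (λ z → f x ℤ.+ z) (ℤ.-1*i≡-i (g x))) ⟨
    ∑ E (λ x → f x ℤ.+ ℤ.-1ℤ ℤ.* g x)       ≡⟨ ∑-+ f (λ x → ℤ.-1ℤ ℤ.* g x) ⟩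
    ∑ E f ℤ.+ ∑ E (λ x → ℤ.-1ℤ ℤ.* g x)     ≡⟨ cong (λ z → ∑ E f ℤ.+ z) (∑ᴸ-*ˡ (elements E) ℤ.-1ℤ g) ⟩
    ∑ E f ℤ.+ ℤ.-1ℤ ℤ.* ∑ E g               ≡⟨ cong (λ z → ∑ E f ℤ.+ z) (ℤ.-1*i≡-i (∑ E g)) ⟩
    ∑ E f ℤ.- ∑ E g                         ∎
    where open ≡-Reasoning

  ∑-*ˡ : ∀ c f → ∑ E (λ x → c ℤ.* f x) ≡ c ℤ.* ∑ E f
  ∑-*ˡ = ∑ᴸ-*ˡ (elements E)

  ∑-*ʳ : ∀ c f → ∑ E (λ x → f x ℤ.* c) ≡ ∑ E f ℤ.* c
  ∑-*ʳ c f = trans (∑-cong λ x → ℤ.*-comm (f x) c) (trans (∑-*ˡ c f) (ℤ.*-comm c _))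

  ∑-zero : ∑ E (λ _ → 0ℤ) ≡ 0ℤ
  ∑-zero = ∑ᴸ-zero (elements E)

  ∑-≡0 : ∀ {f} → (∀ x → 0ℤ ℤ.≤ f x) → ∑ E f ≡ 0ℤ → ∀ x → f x ≡ 0ℤ
  ∑-≡0 0≤f eq x = ∑ᴸ-≡0 (elements E) 0≤f eq (complete E x)

  ∑-none : {P : A → Set} (P? : ∀ x → Dec (P x)) → (∀ x → ¬ P x) → ∑ E (λ x → ⟦ P? x ⟧) ≡ 0ℤ
  ∑-none P? ¬P = trans (∑-cong λ x → ⟦⟧-false (P? x) (¬P x)) ∑-zero

  ∑-δ : ∀ a f → ∑ E (λ x → ⟦ x ≟ a ⟧ ℤ.* f x) ≡ f a
  ∑-δ a f = begin
    ∑ E (λ x → ⟦ x ≟ a ⟧ ℤ.* f x)  ≡⟨ ∑-cong (λ x → ⟦⟧-*-cong (x ≟ a) (cong f)) ⟩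
    ∑ E (λ x → ⟦ x ≟ a ⟧ ℤ.* f a)  ≡⟨ ∑-*ʳ (f a) _ ⟩
    ∑ E (λ x → ⟦ x ≟ a ⟧) ℤ.* f a  ≡⟨ cong (ℤ._* f a) (once E a) ⟩
    1ℤ ℤ.* f a                     ≡⟨ ℤ.*-identityˡ (f a) ⟩
    f a                            ∎
    where open ≡-Reasoning

  ∑-unique : {P : A → Set} (P? : ∀ x → Dec (P x)) → ∀ a → P a → (∀ x → P x → x ≡ a) →
             ∑ E (λ x → ⟦ P? x ⟧) ≡ 1ℤ
  ∑-unique {P} P? a p unique =
    trans (∑-cong λ x → ⟦⟧-cong (P? x) (x ≟ a) (unique x) λ x≡a → subst P (sym x≡a) p)
          (once E a)

module _ (E : Enumeration A) (E′ : Enumeration A′) where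
  private
    module E  = Enumeration E
    module E′ = Enumeration E′

  ∑-swap : ∀ f → ∑ E (λ x → ∑ E′ (f x)) ≡ ∑ E′ (λ y → ∑ E (λ x → f x y))
  ∑-swap = ∑ᴸ-swap (elements E) (elements E′)

  -- Group the terms by their image under π: the coefficient of g b is the size of the fibre over b.
  -- If π is injective, it is the indicator of the image.
  ∑-fibre : ∀ (π : A → A′) g →
            ∑ E (g ∘ π) ≡ ∑ E′ (λ b → ∑ E (λ a → ⟦ b E′.≟ π a ⟧) ℤ.* g b)
  ∑-fibre π g = begin
    ∑ E (λ a → g (π a))
      ≡⟨ ∑-cong E (λ a → sym (∑-δ E′ (π a) g)) ⟩
    ∑ E (λ a → ∑ E′ (λ b → ⟦ b E′.≟ π a ⟧ ℤ.* g b))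
      ≡⟨ ∑-swap _ ⟩
    ∑ E′ (λ b → ∑ E (λ a → ⟦ b E′.≟ π a ⟧ ℤ.* g b))
      ≡⟨ ∑-cong E′ (λ b → ∑-*ʳ E (g b) _) ⟩
    ∑ E′ (λ b → ∑ E (λ a → ⟦ b E′.≟ π a ⟧) ℤ.* g b)  ∎
    where open ≡-Reasoning

  ∑-reindex : ∀ (π : A → A′) (ρ : A′ → A) → (∀ b → π (ρ b) ≡ b) → (∀ a → ρ (π a) ≡ a) →
              ∀ g → ∑ E (g ∘ π) ≡ ∑ E′ g
  ∑-reindex π ρ πρ ρπ g = trans (∑-fibre π g) (∑-cong E′ λ b →
    trans (cong (ℤ._* g b) (∑-unique E (λ a → b E′.≟ π a) (ρ b) (sym (πρ b))
                              λ a b≡πa → trans (sym (ρπ a)) (cong ρ (sym b≡πa))))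
          (ℤ.*-identityˡ (g b)))

Enum-Fin : ∀ n → Enumeration (Fin n)
Enum-Fin n = record { elements = allFin n ; _≟_ = Fin._≟_ ; once = once′ }
  where
  allFin : ∀ n → List (Fin n)
  allFin zero    = []
  allFin (suc n) = zero ∷ List.map suc (allFin n)
  once′ : ∀ {n} (i : Fin n) → ∑ᴸ (allFin n) (λ j → ⟦ j Fin.≟ i ⟧) ≡ 1ℤ
  once′ {suc n} zero = cong (λ z → 1ℤ ℤ.+ z)
    (trans (∑ᴸ-map suc (allFin n) _) (trans (∑ᴸ-cong (allFin n) λ j →
      ⟦⟧-false (suc j Fin.≟ zero) λ ()) (∑ᴸ-zero (allFin n))))
  once′ {suc n} (suc i) = trans (ℤ.+-identityˡ _) (trans (∑ᴸ-map suc (allFin n) _)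
    (trans (∑ᴸ-cong (allFin n) λ j → ⟦⟧-cong (suc j Fin.≟ suc i) (j Fin.≟ i) Fin.suc-injective (cong suc))
           (once′ i)))

∑-Fin : ∀ n c → ∑ (Enum-Fin n) (λ _ → c) ≡ + n ℤ.* c
∑-Fin zero    c = refl
∑-Fin (suc n) c = begin
  c ℤ.+ ∑ᴸ (List.map suc (elements (Enum-Fin n))) (λ _ → c)
    ≡⟨ cong (λ z → c ℤ.+ z) (trans (∑ᴸ-map suc (elements (Enum-Fin n)) _) (∑-Fin n c)) ⟩
  c ℤ.+ + n ℤ.* c
    ≡⟨ ℤ.suc-* (+ n) c ⟨
  + suc n ℤ.* c  ∎
  where open ≡-Reasoning

Enum-↔ : ∀ {n} → A ↔ Fin n → Enumeration A
Enum-↔ {n = n} A↔Fin = record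
  { elements = List.map from (elements (Enum-Fin n))
  ; _≟_      = dec
  ; once     = λ a → trans (∑ᴸ-map from (elements (Enum-Fin n)) _)
      (∑-unique (Enum-Fin n) (λ i → dec (from i) a) (to a) (strictlyInverseʳ a)
        λ i eq → trans (sym (strictlyInverseˡ i)) (cong to eq))
  }
  where
  open Inverse A↔Fin
  dec = via-injection (↔⇒↣ A↔Fin) Fin._≟_

∑-↔ : ∀ {n} (A↔Fin : A ↔ Fin n) c → ∑ (Enum-↔ A↔Fin) (λ _ → c) ≡ + n ℤ.* c
∑-↔ {n = n} A↔Fin c = trans (∑ᴸ-map (Inverse.from A↔Fin) (elements (Enum-Fin n)) _) (∑-Fin n c)

Enum-× : Enumeration A → Enumeration A′ → Enumeration (A × A′)
Enum-× E E′ = record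
  { elements = List.cartesianProduct (elements E) (elements E′)
  ; _≟_      = ≡-dec E._≟_ E′._≟_
  ; once     = λ (a , b) → begin
      ∑ᴸ (List.cartesianProduct (elements E) (elements E′)) (λ x → ⟦ ≡-dec E._≟_ E′._≟_ x (a , b) ⟧)
        ≡⟨ ∑ᴸ-cartesianProduct (elements E) (elements E′) _ ⟩
      ∑ E (λ x → ∑ E′ (λ y → ⟦ ≡-dec E._≟_ E′._≟_ (x , y) (a , b) ⟧))
        ≡⟨ ∑-cong E (λ x → ∑-cong E′ λ y → trans
             (⟦⟧-cong (≡-dec E._≟_ E′._≟_ (x , y) (a , b)) ((x E.≟ a) ×-dec (y E′.≟ b))
               (λ { refl → refl , refl }) λ { (refl , refl) → refl })
             (⟦⟧-× (x E.≟ a) (y E′.≟ b))) ⟩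
      ∑ E (λ x → ∑ E′ (λ y → ⟦ x E.≟ a ⟧ ℤ.* ⟦ y E′.≟ b ⟧))
        ≡⟨ ∑-cong E (λ x → trans (∑-*ˡ E′ ⟦ x E.≟ a ⟧ (λ y → ⟦ y E′.≟ b ⟧)) (cong (λ z → ⟦ x E.≟ a ⟧ ℤ.* z) (once E′ b))) ⟩
      ∑ E (λ x → ⟦ x E.≟ a ⟧ ℤ.* 1ℤ)
        ≡⟨ ∑-δ E a (λ _ → 1ℤ) ⟩
      1ℤ ∎
  }
  where
  open ≡-Reasoning
  module E  = Enumeration E
  module E′ = Enumeration E′

∑-× : (E : Enumeration A) (E′ : Enumeration A′) → ∀ f →
      ∑ (Enum-× E E′) f ≡ ∑ E (λ x → ∑ E′ (λ y → f (x , y)))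
∑-× E E′ = ∑ᴸ-cartesianProduct (elements E) (elements E′)

module _ (E : Enumeration A) where
  Enum-Vec : ∀ n → Enumeration (Vec A n)
  Enum-Vec zero = record
    { elements = [] ∷ [] ; _≟_ = Vec.≡-dec (Enumeration._≟_ E) ; once = λ { [] → refl } }
  Enum-Vec (suc n) = record
    { elements = List.map cons (elements E×)
    ; _≟_      = dec
    ; once     = λ { (a ∷ v) → trans (∑ᴸ-map cons (elements E×) _)
        (∑-unique E× (λ p → dec (cons p) (a ∷ v)) (a , v) refl λ { _ refl → refl }) }
    }
    where
    E× = Enum-× E (Enum-Vec n)
    dec = Vec.≡-dec (Enumeration._≟_ E)
    cons : A × Vec A n → Vec A (suc n)
    cons (a , v) = a ∷ v

  ∑-Vec : ∀ {k} → (∀ c → ∑ E (λ _ → c) ≡ + k ℤ.* c) → ∀ n c → ∑ (Enum-Vec n) (λ _ → c) ≡ + (k ℕ.^ n) ℤ.* c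
  ∑-Vec {k} size zero    c = trans (ℤ.+-identityʳ c) (sym (ℤ.*-identityˡ c))
  ∑-Vec {k} size (suc n) c = begin
    ∑ (Enum-Vec (suc n)) (λ _ → c)
      ≡⟨ ∑ᴸ-map _ (elements (Enum-× E (Enum-Vec n))) _ ⟩
    ∑ (Enum-× E (Enum-Vec n)) (λ _ → c)
      ≡⟨ ∑-× E (Enum-Vec n) _ ⟩
    ∑ E (λ _ → ∑ (Enum-Vec n) (λ _ → c))
      ≡⟨ size _ ⟩
    + k ℤ.* ∑ (Enum-Vec n) (λ _ → c)
      ≡⟨ cong (λ z → + k ℤ.* z) (∑-Vec size n c) ⟩
    + k ℤ.* (+ (k ℕ.^ n) ℤ.* c)
      ≡⟨ ℤ.*-assoc (+ k) (+ (k ℕ.^ n)) c ⟨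
    + k ℤ.* + (k ℕ.^ n) ℤ.* c
      ≡⟨ cong (ℤ._* c) (ℤ.pos-* k (k ℕ.^ n)) ⟨
    + (k ℕ.^ suc n) ℤ.* c  ∎
    where open ≡-Reasoning

-- Sizes of finite setoids

module _ (S : DecSetoid 0ℓ 0ℓ) where
  open DecSetoid S using (_≈_; _≉_; _≟_; setoid)
    renaming (Carrier to C; refl to ≈-refl; sym to ≈-sym; trans to ≈-trans)
  open SetoidMembership setoid using () renaming (_∈_ to _∈ₛ_)

  private
    lookup-injective : ∀ {xs} → AllPairs _≉_ xs → ∀ i j → lookup xs i ≈ lookup xs j → i ≡ j
    lookup-injective (_  ∷ _) zero    zero    _  = refl
    lookup-injective (px ∷ _) zero    (suc j) eq = contradiction eq (All.lookup px (∈-lookup j))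
    lookup-injective (px ∷ _) (suc i) zero    eq = contradiction (≈-sym eq) (All.lookup px (∈-lookup i))
    lookup-injective (_  ∷ u) (suc i) (suc j) eq = cong suc (lookup-injective u i j eq)

  -- Deduplication keeps one member of every class, and its position in the remaining list is the
  -- bijection.
  finite-from-list : ∀ xs → (∀ c → c ∈ₛ xs) → ∃ λ n → Inverse setoid (≡-setoid (Fin n))
  finite-from-list xs all = length ys , record
    { to        = λ c → Any.index (in-ys c)
    ; from      = lookup ys
    ; to-cong   = λ {c} {d} c≈d → lookup-injective ys! _ _
        (≈-trans (≈-sym (Anyₚ.lookup-index (in-ys c))) (≈-trans c≈d (Anyₚ.lookup-index (in-ys d))))
    ; from-cong = λ { refl → ≈-refl }
    ; inverse   = (λ {i} {c} c≈ → lookup-injective ys! _ _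
                     (≈-trans (≈-sym (Anyₚ.lookup-index (in-ys c))) c≈))
                , λ { {c} refl → ≈-sym (Anyₚ.lookup-index (in-ys c)) }
    }
    where
    ys  = deduplicate _≟_ xs
    ys! = Unique.deduplicate-! S xs
    in-ys : ∀ c → c ∈ₛ ys
    in-ys c = SetoidMembershipₚ.∈-deduplicate⁺ setoid _≟_ (λ z≈y x≈y → ≈-trans x≈y (≈-sym z≈y)) (all c)

-- A setoid whose elements are represented by those a : A with Rep a;
-- a ∼ c says that a represents c.
module Represented
  (S : Setoid 0ℓ 0ℓ) {A : Set} (E : Enumeration A)
  (Rep : A → Set) (Rep? : ∀ a → Dec (Rep a)) (mk : ∀ a → Rep a → Setoid.Carrier S)
  (_∼_ : A → Setoid.Carrier S → Set) (_∼?_ : ∀ a c → Dec (a ∼ c))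
  (∼⇒Rep : ∀ a c → a ∼ c → Rep a)
  (∼⇒≈ : ∀ a c → a ∼ c → ∀ p → Setoid._≈_ S (mk a p) c)
  (≈⇒∼ : ∀ a c p → Setoid._≈_ S (mk a p) c → a ∼ c)
  where
  open Setoid S using (_≈_)
    renaming (Carrier to C; sym to ≈-sym; trans to ≈-trans)

  finite : (∀ c → ∃ λ a → a ∼ c) → ∃ λ n → Inverse S (≡-setoid (Fin n))
  finite rep = finite-from-list S-dec (mks (elements E)) λ c →
    let a , a∼c = rep c in ∈-mks a∼c (complete E a)
    where
    dec : ∀ c d → Dec (c ≈ d)
    dec c d = let a , a∼c = rep c; p = ∼⇒Rep _ _ a∼c in
      map′ (λ a∼d → ≈-trans (≈-sym (∼⇒≈ _ _ a∼c p)) (∼⇒≈ _ _ a∼d p))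
           (λ c≈d → ≈⇒∼ _ _ p (≈-trans (∼⇒≈ _ _ a∼c p) c≈d)) (a ∼? d)
    S-dec : DecSetoid 0ℓ 0ℓ
    S-dec = record { isDecEquivalence = record
      { isEquivalence = Setoid.isEquivalence S ; _≟_ = dec } }
    open SetoidMembership S using () renaming (_∈_ to _∈ₛ_)
    mk? : ∀ {a} → Dec (Rep a) → List C → List C
    mk? (yes p) cs = mk _ p ∷ cs
    mk? (no  _) cs = cs
    mks : List _ → List C
    mks []       = []
    mks (a ∷ as) = mk? (Rep? a) (mks as)
    ∈-mk?-here : ∀ {a c cs} (d : Dec (Rep a)) → a ∼ c → c ∈ₛ mk? d cs
    ∈-mk?-here (yes p) a∼c = here (≈-sym (∼⇒≈ _ _ a∼c p))
    ∈-mk?-here (no ¬p) a∼c = contradiction (∼⇒Rep _ _ a∼c) ¬p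
    ∈-mk?-there : ∀ {a c cs} (d : Dec (Rep a)) → c ∈ₛ cs → c ∈ₛ mk? d cs
    ∈-mk?-there (yes _) c∈ = there c∈
    ∈-mk?-there (no  _) c∈ = c∈
    ∈-mks : ∀ {a c as} → a ∼ c → a List.∈ as → c ∈ₛ mks as
    ∈-mks {a} a∼c (here refl) = ∈-mk?-here (Rep? a) a∼c
    ∈-mks {as = b ∷ _} a∼c (there a∈) = ∈-mk?-there (Rep? b) (∈-mks a∼c a∈)

  module _ {k : ℤ} (class-size : ∀ c → ∑ E (λ a → ⟦ a ∼? c ⟧) ≡ k) where

    -- Count the pairs of an element and one of its representatives: every element has k
    -- representatives, and every a with `Rep a` represents one element up to equality.
    size⇒∑ : ∀ {n} → Inverse S (≡-setoid (Fin n)) → ∑ E (λ a → ⟦ Rep? a ⟧) ≡ + n ℤ.* k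
    size⇒∑ {n} S↔Fin = begin
      ∑ E (λ a → ⟦ Rep? a ⟧)
        ≡⟨ ∑-cong E (λ a → sym (in-one-class a (Rep? a))) ⟩
      ∑ E (λ a → ∑ (Enum-Fin n) (λ i → ⟦ a ∼? from i ⟧))
        ≡⟨ ∑-swap E (Enum-Fin n) _ ⟩
      ∑ (Enum-Fin n) (λ i → ∑ E (λ a → ⟦ a ∼? from i ⟧))
        ≡⟨ ∑-cong (Enum-Fin n) (λ i → class-size (from i)) ⟩
      ∑ (Enum-Fin n) (λ _ → k)
        ≡⟨ ∑-Fin n k ⟩
      + n ℤ.* k  ∎
      where
      open ≡-Reasoning
      open Inverse S↔Fin
      in-one-class : ∀ a (d : Dec (Rep a)) → ∑ (Enum-Fin n) (λ i → ⟦ a ∼? from i ⟧) ≡ ⟦ d ⟧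
      in-one-class a (yes p) = ∑-unique (Enum-Fin n) (λ i → a ∼? from i) (to (mk a p))
        (≈⇒∼ _ _ p (≈-sym (strictlyInverseʳ (mk a p))))
        λ i a∼ → trans (sym (strictlyInverseˡ i)) (to-cong (≈-sym (∼⇒≈ _ _ a∼ p)))
      in-one-class a (no ¬p) = ∑-none (Enum-Fin n) (λ i → a ∼? from i) λ i a∼ → ¬p (∼⇒Rep _ _ a∼)

    -- As k ≠ 0, every element has a representative, so the setoid has some finite size n′. Then n′
    -- k = n k, and k cancels.
    ∑⇒size : .{{_ : ℤ.NonZero k}} → ∀ {n} → ∑ E (λ a → ⟦ Rep? a ⟧) ≡ + n ℤ.* k →
             Inverse S (≡-setoid (Fin n))
    ∑⇒size {{k≢0}} {n} ∑≡nk = subst (λ n → Inverse S (≡-setoid (Fin n))) n′≡n S↔Fin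
      where
      rep : ∀ c → ∃ λ a → a ∼ c
      rep c with Enumeration.any? E (λ a → a ∼? c)
      ... | yes a∼c = a∼c
      ... | no ¬rep = contradiction
        (trans (sym (class-size c)) (∑-none E (λ a → a ∼? c) λ a a∼c → ¬rep (a , a∼c)))
        (λ k≡0 → ℕ.≢-nonZero⁻¹ ℤ.∣ k ∣ (cong ℤ.∣_∣ k≡0))
      n′ = proj₁ (finite rep)
      S↔Fin = proj₂ (finite rep)
      n′≡n : n′ ≡ n
      n′≡n = ℤ.+-injective (ℤ.*-cancelʳ-≡ (+ n′) (+ n) k (trans (sym (size⇒∑ S↔Fin)) ∑≡nk))

-- Finite fields

prime∤! : ∀ {p} → Prime p → ∀ {k} → k ℕ.< p → p ∤ k ℕ.!
prime∤! p-prime {zero}  _   p∣1 =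
  ℕ.<⇒≱ (ℕ.nonTrivial⇒n>1 _ {{prime⇒nonTrivial p-prime}}) (∣⇒≤ p∣1)
prime∤! p-prime {suc k} k<p p∣ with euclidsLemma (suc k) (k ℕ.!) p-prime p∣
... | inj₁ p∣1+k = ℕ.<⇒≱ k<p (∣⇒≤ p∣1+k)
... | inj₂ p∣k!  = prime∤! p-prime (ℕ.<-trans (ℕ.n<1+n k) k<p) p∣k!

-- p divides p! = C(p,k) k! (p - k)!, but neither factorial on the right, as both k and p - k are
-- less than p.
prime∣C : ∀ {p} → Prime p → ∀ {k} → 0 ℕ.< k → k ℕ.< p → p ∣ p C k
prime∣C {p@(suc p-1)} p-prime {k@(suc k-1)} 0<k k<p
  with euclidsLemma (p C k) (k ℕ.! ℕ.* (p ℕ.∸ k) ℕ.!) p-prime p∣product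
  where
  instance _ = ℕ._!*_!≢0 k (p ℕ.∸ k)
  p∣product : p ∣ (p C k) ℕ.* (k ℕ.! ℕ.* (p ℕ.∸ k) ℕ.!)
  p∣product = subst (p ∣_) (sym (trans
    (cong (ℕ._* (k ℕ.! ℕ.* (p ℕ.∸ k) ℕ.!)) (nCk≡n!/k![n-k]! (ℕ.<⇒≤ k<p)))
    (m/n*n≡m (k![n∸k]!∣n! (ℕ.<⇒≤ k<p))))) (m∣m*n (p-1 ℕ.!))
... | inj₁ p∣C = p∣C
... | inj₂ p∣k![p-k]! with euclidsLemma (k ℕ.!) _ p-prime p∣k![p-k]!
...   | inj₁ p∣k!     = contradiction p∣k! (prime∤! p-prime k<p)
...   | inj₂ p∣[p-k]! = contradiction p∣[p-k]! (prime∤! p-prime (ℕ.s≤s (ℕ.m∸n≤m p-1 k-1)))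

module Field {q : ℕ} (F : FiniteField q) where
  open FiniteField F
  open CommutativeRing commutativeRing public
    using ( commutativeSemiring; *-commutativeMonoid; +-commutativeMonoid; ring
          ; +-identityˡ; +-identityʳ; -‿inverseˡ; -‿inverseʳ; *-identityʳ; +-comm; +-assoc; distribˡ; distribʳ)
  open RingProperties ring public using (+-cancelˡ; -‿distribˡ-*; -1*x≈-x)
  module Solver = SemiringSolver commutativeSemiring
  open Mult semiring using (×1-homo-*; ×-assoc-*) renaming (_×_ to _×′_)
  open CommutativeExp commutativeSemiring using (^-distrib-*)
  open Exp semiring using (^-assocʳ)

  E : Enumeration Carrier
  E = Enum-↔ finite

  1<q : 1 ℕ.< q
  1<q = distinct (λ eq → 0≢1 (Injection.injective (↔⇒↣ finite) eq))
    where
    distinct : ∀ {n} {i j : Fin n} → i ≢ j → 1 ℕ.< n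
    distinct {1} {zero} {zero} i≢j = contradiction refl i≢j
    distinct {suc (suc _)}     _   = ℕ.s≤s (ℕ.s≤s z≤n)

  x*y≡0⇒y≡0 : ∀ {x y} → x ≢ 0# → x * y ≡ 0# → y ≡ 0#
  x*y≡0⇒y≡0 {x} {y} x≢0 xy≡0 = let z , xz≡1 = inverse x x≢0 in begin
    y            ≡⟨ *-identityˡ y ⟨
    1# * y       ≡⟨ cong (_* y) (trans (*-comm z x) xz≡1) ⟨
    z * x * y    ≡⟨ *-assoc z x y ⟩
    z * (x * y)  ≡⟨ cong (z *_) xy≡0 ⟩
    z * 0#       ≡⟨ zeroʳ z ⟩
    0#           ∎
    where open ≡-Reasoning

  *-≢0 : ∀ {x y} → x ≢ 0# → y ≢ 0# → x * y ≢ 0#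
  *-≢0 x≢0 y≢0 xy≡0 = y≢0 (x*y≡0⇒y≡0 x≢0 xy≡0)

  *-cancelˡ : ∀ {x y z} → x ≢ 0# → x * y ≡ x * z → y ≡ z
  *-cancelˡ {x} {y} {z} x≢0 eq = let w , xw≡1 = inverse x x≢0
                                     undo = λ y → trans (sym (*-assoc w x y))
                                       (trans (cong (_* y) (trans (*-comm w x) xw≡1)) (*-identityˡ y)) in
    trans (sym (undo y)) (trans (cong (w *_) eq) (undo z))

  infix 10 _⁻¹
  -- A total inverse with the value 0 at 0; only its values at nonzero elements enter.
  _⁻¹ : Carrier → Carrier
  x ⁻¹ with x ≟ 0#
  ... | yes _   = 0#
  ... | no  x≢0 = proj₁ (inverse x x≢0)

  *-inverseʳ : ∀ {x} → x ≢ 0# → x * x ⁻¹ ≡ 1#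
  *-inverseʳ {x} x≢0 with x ≟ 0#
  ... | yes x≡0 = contradiction x≡0 x≢0
  ... | no  x≢0 = proj₂ (inverse x x≢0)

  ⁻¹-≢0 : ∀ {x} → x ≢ 0# → x ⁻¹ ≢ 0#
  ⁻¹-≢0 {x} x≢0 x⁻¹≡0 = 0≢1 (trans (sym (zeroʳ x)) (trans (cong (x *_) (sym x⁻¹≡0)) (*-inverseʳ x≢0)))

  -- Bijections of the field are transported to `Fin q`, where sums and products over all elements
  -- are indexed and are invariant under permutation.
  permutation : (f g : Carrier → Carrier) → (∀ x → f (g x) ≡ x) → (∀ x → g (f x) ≡ x) →
                Permutation.Permutation q q
  permutation f g fg gf = Permutation.permutation (to ∘ f ∘ from) (to ∘ g ∘ from)
    (λ i → trans (cong (to ∘ f) (strictlyInverseʳ _)) (trans (cong to (fg _)) (strictlyInverseˡ i)))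
    (λ i → trans (cong (to ∘ g) (strictlyInverseʳ _)) (trans (cong to (gf _)) (strictlyInverseˡ i)))
    where open Inverse finite

  private module Sum = MonoidSum +-commutativeMonoid

  -- The translation by 1 permutes the field. It fixes the sum of all elements, but it also adds 1
  -- to each of the q terms.
  q×1≡0 : q ×′ 1# ≡ 0#
  q×1≡0 = +-cancelˡ (Sum.sum from) _ _ (begin
    Sum.sum from + q ×′ 1#                    ≡⟨ cong (λ z → Sum.sum from + z) (Sum.sum-replicate q) ⟨
    Sum.sum from + Sum.sum {q} (λ _ → 1#)       ≡⟨ Sum.∑-distrib-+ from (λ _ → 1#) ⟨
    Sum.sum (λ i → from i + 1#)               ≡⟨ Sum.sum-cong-≗ {q} (λ i → Inverse.strictlyInverseʳ finite (from i + 1#)) ⟨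
    Sum.sum (λ i → from (shift Permutation.⟨$⟩ʳ i)) ≡⟨ Sum.sum-permute from shift ⟨
    Sum.sum from                              ≡⟨ +-identityʳ _ ⟨
    Sum.sum from + 0#                         ∎)
    where
    open ≡-Reasoning
    open Inverse finite using (from)
    shift : Permutation.Permutation q q
    shift = permutation (_+ 1#) (_+ - 1#)
      (λ x → trans (+-assoc x (- 1#) 1#) (trans (cong (λ z → x + z) (-‿inverseˡ 1#)) (+-identityʳ x)))
      (λ x → trans (+-assoc x 1# (- 1#)) (trans (cong (λ z → x + z) (-‿inverseʳ 1#)) (+-identityʳ x)))

  private
    module Π = MonoidSum *-commutativeMonoid

    Π-single : ∀ {n} (t : Fin n → Carrier) i → (∀ j → j ≢ i → t j ≡ 1#) → Π.sum t ≡ t i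
    Π-single {suc n} t zero    h = trans
      (cong (t zero *_) (trans (Π.sum-cong-≗ λ j → h (suc j) λ ()) (Π.sum-replicate-zero n)))
      (*-identityʳ _)
    Π-single {suc n} t (suc i) h = trans
      (cong₂ _*_ (h zero λ ()) (Π-single (t ∘ suc) i λ j j≢i → h (suc j) (j≢i ∘ Fin.suc-injective)))
      (*-identityˡ _)

    Π-≢0 : ∀ {n} (t : Fin n → Carrier) → (∀ i → t i ≢ 0#) → Π.sum t ≢ 0#
    Π-≢0 {zero}  t h = 0≢1 ∘ sym
    Π-≢0 {suc n} t h = *-≢0 (h zero) (Π-≢0 (t ∘ suc) (h ∘ suc))

    Π-const : ∀ n a → Π.sum {n} (λ _ → a) ≡ a ^ n
    Π-const zero    a = refl
    Π-const (suc n) a = cong (a *_) (Π-const n a)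

    if : ∀ {P : Set} → Dec P → Carrier → Carrier → Carrier
    if (yes _) a b = a
    if (no  _) a b = b

  -- Multiplication by a ≠ 0 permutes the nonzero elements, hence fixes their product.
  x^q≡x : ∀ a → a ^ q ≡ a
  x^q≡x a with a ≟ 0#
  ... | yes refl = 0^ (ℕ.<-trans ℕ.z<s 1<q)
    where
    0^ : ∀ {n} → 0 ℕ.< n → 0# ^ n ≡ 0#
    0^ {suc n} _ = zeroˡ _
  ... | no a≢0 = begin
    a ^ q                                               ≡⟨ Π-const q a ⟨
    Π.sum {q} (λ _ → a)                                 ≡⟨ Π.sum-cong-≗ {q} (λ i → split (from i)) ⟩
    Π.sum (λ i → atN (from i) * at0 (from i))           ≡⟨ Π.∑-distrib-+ (atN ∘ from) (at0 ∘ from) ⟩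
    Π.sum (atN ∘ from) * Π.sum (at0 ∘ from)             ≡⟨ cong₂ _*_ Π-N Π-0 ⟩
    1# * a                                              ≡⟨ *-identityˡ a ⟩
    a                                                   ∎
    where
    open ≡-Reasoning
    open Inverse finite using (to; from; strictlyInverseˡ; strictlyInverseʳ)
    -- `a ^ q` has one factor for each field element x: `atN` keeps the factors with x ≠ 0 and `at0`
    -- the one with x = 0. `nz` replaces 0 by 1, so that its product over the field is the product
    -- of the nonzero elements.
    atN at0 nz : Carrier → Carrier
    atN x = if (x ≟ 0#) 1# a
    at0 x = if (x ≟ 0#) a 1#
    nz  x = if (x ≟ 0#) 1# x
    split : ∀ x → a ≡ atN x * at0 x
    split x with x ≟ 0#
    ... | yes _ = sym (*-identityˡ a)
    ... | no  _ = sym (*-identityʳ a)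
    Π-0 : Π.sum (at0 ∘ from) ≡ a
    Π-0 = trans (Π-single (at0 ∘ from) (to 0#) off) on
      where
      on : at0 (from (to 0#)) ≡ a
      on with from (to 0#) ≟ 0#
      ... | yes _ = refl
      ... | no ¬p = contradiction (strictlyInverseʳ 0#) ¬p
      off : ∀ j → j ≢ to 0# → at0 (from j) ≡ 1#
      off j j≢ with from j ≟ 0#
      ... | yes eq = contradiction (trans (sym (strictlyInverseˡ j)) (cong to eq)) j≢
      ... | no  _  = refl
    nz≢0 : ∀ x → nz x ≢ 0#
    nz≢0 x with x ≟ 0#
    ... | yes _   = 0≢1 ∘ sym
    ... | no  x≢0 = x≢0
    nz-* : ∀ x → nz (a * x) ≡ nz x * atN x
    nz-* x with x ≟ 0# | (a * x) ≟ 0#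
    ... | yes _    | yes _    = sym (*-identityˡ 1#)
    ... | yes refl | no ax≢0  = contradiction (zeroʳ a) ax≢0
    ... | no x≢0   | yes ax≡0 = contradiction ax≡0 (*-≢0 a≢0 x≢0)
    ... | no _     | no _     = *-comm a x
    scale : Permutation.Permutation q q
    scale = let b , ab≡1 = inverse a a≢0 in permutation (a *_) (b *_)
      (λ x → trans (sym (*-assoc a b x)) (trans (cong (_* x) ab≡1) (*-identityˡ x)))
      (λ x → trans (sym (*-assoc b a x)) (trans (cong (_* x) (trans (*-comm b a) ab≡1)) (*-identityˡ x)))
    Π-N : Π.sum (atN ∘ from) ≡ 1#
    Π-N = *-cancelˡ (Π-≢0 (nz ∘ from) (nz≢0 ∘ from)) (begin
      Π.sum (nz ∘ from) * Π.sum (atN ∘ from)          ≡⟨ Π.∑-distrib-+ (nz ∘ from) (atN ∘ from) ⟨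
      Π.sum (λ i → nz (from i) * atN (from i))        ≡⟨ Π.sum-cong-≗ {q} (λ i → nz-* (from i)) ⟨
      Π.sum (λ i → nz (a * from i))                   ≡⟨ Π.sum-cong-≗ {q} (λ i → cong nz (strictlyInverseʳ (a * from i))) ⟨
      Π.sum (λ i → nz (from (scale Permutation.⟨$⟩ʳ i))) ≡⟨ Π.sum-permute (nz ∘ from) scale ⟨
      Π.sum (nz ∘ from)                               ≡⟨ *-identityʳ _ ⟨
      Π.sum (nz ∘ from) * 1#                          ∎)

  -- A field has no zero divisors, so factors p · 1 can be cancelled from p^k · 1 = 0 until one of
  -- them vanishes; without any factor left it would say 1 = 0.
  characteristic : ∀ p → Prime p → ∀ k → (p ℕ.^ k) ×′ 1# ≡ 0# → p ×′ 1# ≡ 0#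
  characteristic p p-prime zero    eq = contradiction (trans (sym eq) (+-identityʳ 1#)) 0≢1
  characteristic p p-prime (suc k) eq with (p ×′ 1#) ≟ 0#
  ... | yes p≡0 = p≡0
  ... | no  p≢0 = characteristic p p-prime k
    (x*y≡0⇒y≡0 p≢0 (trans (sym (×1-homo-* p (p ℕ.^ k))) eq))

  module _ {p} (p-prime : Prime p) (p≡0 : p ×′ 1# ≡ 0#) where
    private
      multiple≡0 : ∀ {n} → p ∣ n → ∀ x → n ×′ x ≡ 0#
      multiple≡0 {n} (divides m refl) x = begin
        (m ℕ.* p) ×′ x               ≡⟨ cong ((m ℕ.* p) ×′_) (*-identityˡ x) ⟨
        (m ℕ.* p) ×′ (1# * x)        ≡⟨ ×-assoc-* (m ℕ.* p) 1# x ⟨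
        (m ℕ.* p) ×′ 1# * x          ≡⟨ cong (_* x) (×1-homo-* m p) ⟩
        m ×′ 1# * (p ×′ 1#) * x      ≡⟨ cong (λ z → m ×′ 1# * z * x) p≡0 ⟩
        m ×′ 1# * 0# * x             ≡⟨ cong (_* x) (zeroʳ _) ⟩
        0# * x                       ≡⟨ zeroˡ x ⟩
        0#                           ∎
        where open ≡-Reasoning

    -- All inner binomial coefficients are multiples of p and vanish in the field.
    ^p-+ : ∀ x y → (x + y) ^ p ≡ x ^ p + y ^ p
    ^p-+ x y = go p refl
      where
      open ≡-Reasoning
      open Binomial commutativeSemiring using (binomialTerm; theorem)
      open Sum using (sum-init-last; sum-cong-≗; sum-replicate-zero)
      go : ∀ n → n ≡ p → (x + y) ^ n ≡ x ^ n + y ^ n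
      go zero    refl with () ← ℕ.nonTrivial⇒n>1 _ {{prime⇒nonTrivial p-prime}}
      go n@(suc n-1) refl = begin
        (x + y) ^ n
          ≡⟨ theorem n x y ⟩
        term zero + sum (term ∘ suc)
          ≡⟨ cong (λ z → term zero + z) (sum-init-last (term ∘ suc)) ⟩
        term zero + (sum (λ i → term (suc (inject₁ i))) + term (suc (fromℕ n-1)))
          ≡⟨ cong (λ z → term zero + (z + term (suc (fromℕ n-1))))
               (trans (sum-cong-≗ inner) (sum-replicate-zero n-1)) ⟩
        term zero + (0# + term (suc (fromℕ n-1)))
          ≡⟨ cong₂ (λ a b → a + (0# + b)) first last ⟩
        y ^ n + (0# + x ^ n)
          ≡⟨ cong (λ z → y ^ n + z) (+-identityˡ _) ⟩
        y ^ n + x ^ n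
          ≡⟨ +-comm _ _ ⟩
        x ^ n + y ^ n  ∎
        where
        term = binomialTerm x y n
        inner : ∀ i → term (suc (inject₁ i)) ≡ 0#
        inner i = multiple≡0 (prime∣C p-prime (ℕ.s≤s z≤n)
          (ℕ.s≤s (subst (ℕ._< n-1) (sym (Fin.toℕ-inject₁ i)) (Fin.toℕ<n i)))) _
        first : term zero ≡ y ^ n
        first = trans (+-identityʳ _) (*-identityˡ _)
        last : term (suc (fromℕ n-1)) ≡ x ^ n
        last rewrite Fin.toℕ-fromℕ n-1 | nCn≡1 n | ℕ.n∸n≡0 n-1 = trans (+-identityʳ _) (*-identityʳ _)

    ^p^-+ : ∀ k x y → (x + y) ^ (p ℕ.^ k) ≡ x ^ (p ℕ.^ k) + y ^ (p ℕ.^ k)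
    ^p^-+ zero    x y = trans (*-identityʳ _) (sym (cong₂ _+_ (*-identityʳ x) (*-identityʳ y)))
    ^p^-+ (suc k) x y = begin
      (x + y) ^ (p ℕ.* p ℕ.^ k)                   ≡⟨ ^-assocʳ (x + y) p (p ℕ.^ k) ⟨
      ((x + y) ^ p) ^ (p ℕ.^ k)                   ≡⟨ cong (_^ (p ℕ.^ k)) (^p-+ x y) ⟩
      (x ^ p + y ^ p) ^ (p ℕ.^ k)                 ≡⟨ ^p^-+ k (x ^ p) (y ^ p) ⟩
      (x ^ p) ^ (p ℕ.^ k) + (y ^ p) ^ (p ℕ.^ k)   ≡⟨ cong₂ _+_ (^-assocʳ x p _) (^-assocʳ y p _) ⟩
      x ^ (p ℕ.* p ℕ.^ k) + y ^ (p ℕ.* p ℕ.^ k)   ∎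
      where open ≡-Reasoning

-- Linear algebra over a finite field

module LinearAlgebra {q : ℕ} (F : FiniteField q) (n : ℕ) where
  open FiniteField F
  open Field F
  open Projective F n

  module _ {m : ℕ} where
    infixl 6 _⊕_
    infixr 7 _⊙_
    _⊕_ : Vec Carrier m → Vec Carrier m → Vec Carrier m
    _⊕_ = Vec.zipWith _+_
    _⊙_ : Carrier → Vec Carrier m → Vec Carrier m
    c ⊙ x = Vec.map (c *_) x

  private
    open Solver using (solve; _:+_; _:*_; _:=_; con)

    collect′ : ∀ {m} α β a b c d (u v : Vec Carrier m) →
               α ⊙ (a ⊙ u ⊕ b ⊙ v) ⊕ β ⊙ (c ⊙ u ⊕ d ⊙ v) ≡ (α * a + β * c) ⊙ u ⊕ (α * b + β * d) ⊙ v
    collect′ α β a b c d []      []      = refl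
    collect′ α β a b c d (x ∷ u) (y ∷ v) = cong₂ _∷_
      (solve 8 (λ α β a b c d x y →
        α :* (a :* x :+ b :* y) :+ β :* (c :* x :+ d :* y) :=
        (α :* a :+ β :* c) :* x :+ (α :* b :+ β :* d) :* y) refl α β a b c d x y)
      (collect′ α β a b c d u v)

    ⊕-identityʳ : ∀ {m} (x : Vec Carrier m) → x ⊕ Vec.replicate m 0# ≡ x
    ⊕-identityʳ []      = refl
    ⊕-identityʳ (a ∷ x) = cong₂ _∷_ (+-identityʳ a) (⊕-identityʳ x)

    ⊕-comm : ∀ {m} (x y : Vec Carrier m) → x ⊕ y ≡ y ⊕ x
    ⊕-comm []      []      = refl
    ⊕-comm (a ∷ x) (b ∷ y) = cong₂ _∷_ (+-comm a b) (⊕-comm x y)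

    ⊕-assoc : ∀ {m} (x y z : Vec Carrier m) → (x ⊕ y) ⊕ z ≡ x ⊕ (y ⊕ z)
    ⊕-assoc []      []      []      = refl
    ⊕-assoc (a ∷ x) (b ∷ y) (c ∷ z) = cong₂ _∷_ (+-assoc a b c) (⊕-assoc x y z)

    ⊙-zeroˡ : ∀ {m} (x : Vec Carrier m) → 0# ⊙ x ≡ Vec.replicate m 0#
    ⊙-zeroˡ []      = refl
    ⊙-zeroˡ (a ∷ x) = cong₂ _∷_ (zeroˡ a) (⊙-zeroˡ x)

    ⊙-zeroʳ : ∀ c m → c ⊙ Vec.replicate m 0# ≡ Vec.replicate m 0#
    ⊙-zeroʳ c zero    = refl
    ⊙-zeroʳ c (suc m) = cong₂ _∷_ (zeroʳ c) (⊙-zeroʳ c m)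

    ⊙-distribʳ : ∀ {m} c d (x : Vec Carrier m) → (c + d) ⊙ x ≡ c ⊙ x ⊕ d ⊙ x
    ⊙-distribʳ c d []      = refl
    ⊙-distribʳ c d (a ∷ x) = cong₂ _∷_ (distribʳ a c d) (⊙-distribʳ c d x)

  collect : ∀ α β a b c d (u v : V) →
            α · (a · u +ᵛ b · v) +ᵛ β · (c · u +ᵛ d · v) ≡ (α * a + β * c) · u +ᵛ (α * b + β * d) · v
  collect = collect′

  +ᵛ-identityʳ : ∀ x → x +ᵛ 0ᵛ ≡ x
  +ᵛ-identityʳ = ⊕-identityʳ

  +ᵛ-comm : ∀ x y → x +ᵛ y ≡ y +ᵛ x
  +ᵛ-comm = ⊕-comm

  +ᵛ-assoc : ∀ x y z → (x +ᵛ y) +ᵛ z ≡ x +ᵛ (y +ᵛ z)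
  +ᵛ-assoc = ⊕-assoc

  +ᵛ-identityˡ : ∀ x → 0ᵛ +ᵛ x ≡ x
  +ᵛ-identityˡ x = trans (+ᵛ-comm 0ᵛ x) (+ᵛ-identityʳ x)

  ·-zeroˡ : ∀ x → 0# · x ≡ 0ᵛ
  ·-zeroˡ = ⊙-zeroˡ

  ·-zeroʳ : ∀ c → c · 0ᵛ ≡ 0ᵛ
  ·-zeroʳ c = ⊙-zeroʳ c (suc n)

  ·-distribʳ : ∀ c d x → (c + d) · x ≡ c · x +ᵛ d · x
  ·-distribʳ = ⊙-distribʳ

  x-x≡0 : ∀ x → x +ᵛ (- 1#) · x ≡ 0ᵛ
  x-x≡0 x = begin
    x +ᵛ (- 1#) · x        ≡⟨ cong (_+ᵛ (- 1#) · x) (·-identity x) ⟨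
    1# · x +ᵛ (- 1#) · x   ≡⟨ ·-distribʳ 1# (- 1#) x ⟨
    (1# + - 1#) · x        ≡⟨ cong (_· x) (-‿inverseʳ 1#) ⟩
    0# · x                 ≡⟨ ·-zeroˡ x ⟩
    0ᵛ                     ∎
    where open ≡-Reasoning

  x+y-y≡x : ∀ x y → (x +ᵛ y) +ᵛ (- 1#) · y ≡ x
  x+y-y≡x x y = trans (+ᵛ-assoc x y _) (trans (cong (x +ᵛ_) (x-x≡0 y)) (+ᵛ-identityʳ x))

  x-y+y≡x : ∀ x y → (x +ᵛ (- 1#) · y) +ᵛ y ≡ x
  x-y+y≡x x y = trans (+ᵛ-assoc x _ y)
    (trans (cong (x +ᵛ_) (trans (+ᵛ-comm _ y) (x-x≡0 y))) (+ᵛ-identityʳ x))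

  ⁻¹-·-cancel : ∀ {c} → c ≢ 0# → ∀ x → c ⁻¹ · c · x ≡ x
  ⁻¹-·-cancel {c} c≢0 x = trans (·-assoc (c ⁻¹) c x)
    (trans (cong (_· x) (trans (*-comm (c ⁻¹) c) (*-inverseʳ c≢0))) (·-identity x))

  ·-⁻¹-cancel : ∀ {c} → c ≢ 0# → ∀ x → c · c ⁻¹ · x ≡ x
  ·-⁻¹-cancel {c} c≢0 x = trans (·-assoc c (c ⁻¹) x)
    (trans (cong (_· x) (*-inverseʳ c≢0)) (·-identity x))

  c·x≡0⇒x≡0 : ∀ {c x} → c ≢ 0# → c · x ≡ 0ᵛ → x ≡ 0ᵛ
  c·x≡0⇒x≡0 {c} {x} c≢0 eq =
    trans (sym (⁻¹-·-cancel c≢0 x)) (trans (cong (c ⁻¹ ·_) eq) (·-zeroʳ _))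

  ·-≢0 : ∀ {c x} → c ≢ 0# → x ≢ 0ᵛ → c · x ≢ 0ᵛ
  ·-≢0 c≢0 x≢0 = x≢0 ∘ c·x≡0⇒x≡0 c≢0

  x-y≡0⇒x≡y : ∀ {x y} → x + - 1# * y ≡ 0# → x ≡ y
  x-y≡0⇒x≡y {x} {y} eq = begin
    x                    ≡⟨ +-identityʳ x ⟨
    x + 0#               ≡⟨ cong (λ z → x + z) (trans (cong (_+ y) (-1*x≈-x y)) (-‿inverseˡ y)) ⟨
    x + (- 1# * y + y)   ≡⟨ +-assoc x _ y ⟨
    x + - 1# * y + y     ≡⟨ cong (_+ y) eq ⟩
    0# + y               ≡⟨ +-identityˡ y ⟩
    y                    ∎
    where open ≡-Reasoning

  c·x≡0⇒c≡0 : ∀ {c x} → x ≢ 0ᵛ → c · x ≡ 0ᵛ → c ≡ 0#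
  c·x≡0⇒c≡0 {c} x≢0 eq with c ≟ 0#
  ... | yes c≡0 = c≡0
  ... | no  c≢0 = contradiction (c·x≡0⇒x≡0 c≢0 eq) x≢0

  ·-cancelʳ : ∀ {c d x} → x ≢ 0ᵛ → c · x ≡ d · x → c ≡ d
  ·-cancelʳ {c} {d} {x} x≢0 eq = x-y≡0⇒x≡y (c·x≡0⇒c≡0 x≢0 (begin
    (c + - 1# * d) · x           ≡⟨ ·-distribʳ c _ x ⟩
    c · x +ᵛ (- 1# * d) · x      ≡⟨ cong₂ _+ᵛ_ eq (sym (·-assoc (- 1#) d x)) ⟩
    d · x +ᵛ (- 1#) · d · x      ≡⟨ x-x≡0 (d · x) ⟩
    0ᵛ                           ∎))
    where open ≡-Reasoning

  Eᵛ : Enumeration V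
  Eᵛ = Enum-Vec E (suc n)

  infix 4 _≟ᵛ_
  _≟ᵛ_ : DecidableEquality V
  _≟ᵛ_ = Enumeration._≟_ Eᵛ

  ∑E-const : ∀ c → ∑ E (λ _ → c) ≡ + q ℤ.* c
  ∑E-const = ∑-↔ finite

  ∑Eᵛ-const : ∀ c → ∑ Eᵛ (λ _ → c) ≡ + (q ℕ.^ suc n) ℤ.* c
  ∑Eᵛ-const = ∑-Vec E {q} ∑E-const (suc n)

  ∑-nonzero : ∑ E (λ c → ⟦ ¬? (c ≟ 0#) ⟧) ≡ + q ℤ.- 1ℤ
  ∑-nonzero = begin
    ∑ E (λ c → ⟦ ¬? (c ≟ 0#) ⟧)
      ≡⟨ ∑-cong E (λ c → ⟦⟧-¬ (c ≟ 0#)) ⟩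
    ∑ E (λ c → 1ℤ ℤ.- ⟦ c ≟ 0# ⟧)
      ≡⟨ ∑-minus E (λ _ → 1ℤ) (λ c → ⟦ c ≟ 0# ⟧) ⟩
    ∑ E (λ _ → 1ℤ) ℤ.- ∑ E (λ c → ⟦ c ≟ 0# ⟧)
      ≡⟨ cong₂ ℤ._-_ (trans (∑E-const 1ℤ) (ℤ.*-identityʳ (+ q))) (once E 0#) ⟩
    + q ℤ.- 1ℤ  ∎
    where open ≡-Reasoning

  Independent : V → V → Set
  Independent u v = ∀ α β → α · u +ᵛ β · v ≡ 0ᵛ → α ≡ 0# × β ≡ 0#

  independent? : ∀ u v → Dec (Independent u v)
  independent? u v = Enumeration.all? E λ α → Enumeration.all? E λ β →
    (α · u +ᵛ β · v ≟ᵛ 0ᵛ) →-dec ((α ≟ 0#) ×-dec (β ≟ 0#))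

  Span : V → V → V → Set
  Span u v w = ∃₂ λ α β → α · u +ᵛ β · v ≡ w

  span? : ∀ u v w → Dec (Span u v w)
  span? u v w = Enumeration.any? E λ α → Enumeration.any? E λ β → α · u +ᵛ β · v ≟ᵛ w

  Span-closed : ∀ {u v w w′} α β → Span u v w → Span u v w′ → Span u v (α · w +ᵛ β · w′)
  Span-closed {u} {v} α β (a , b , refl) (c , d , refl) = _ , _ , sym (collect α β a b c d u v)

  u∈Span : ∀ u v → Span u v u
  u∈Span u v = 1# , 0# , trans (cong₂ _+ᵛ_ (·-identity u) (·-zeroˡ v)) (+ᵛ-identityʳ u)

  v∈Span : ∀ u v → Span u v v
  v∈Span u v = 0# , 1# , trans (cong₂ _+ᵛ_ (·-zeroˡ u) (·-identity v)) (+ᵛ-identityˡ v)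

  0∈Span : ∀ u v → Span u v 0ᵛ
  0∈Span u v = 0# , 0# , trans (cong₂ _+ᵛ_ (·-zeroˡ u) (·-zeroˡ v)) (+ᵛ-identityʳ 0ᵛ)

  Span-· : ∀ {u v w} c → Span u v w → Span u v (c · w)
  Span-· {w = w} c w∈ = subst (Span _ _)
    (trans (cong (c · w +ᵛ_) (·-zeroˡ w)) (+ᵛ-identityʳ (c · w))) (Span-closed c 0# w∈ w∈)

  Span-⊆ : ∀ {u v u′ v′} → Span u v u′ → Span u v v′ → ∀ {w} → Span u′ v′ w → Span u v w
  Span-⊆ u′∈ v′∈ (α , β , refl) = Span-closed α β u′∈ v′∈

  coefficients-unique : ∀ {u v} → Independent u v → ∀ {α β α′ β′} →
    α · u +ᵛ β · v ≡ α′ · u +ᵛ β′ · v → α ≡ α′ × β ≡ β′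
  coefficients-unique {u} {v} ind {α} {β} {α′} {β′} eq =
    let α-α′≡0 , β-β′≡0 = ind (1# * α + - 1# * α′) (1# * β + - 1# * β′) (begin
          (1# * α + - 1# * α′) · u +ᵛ (1# * β + - 1# * β′) · v  ≡⟨ collect 1# (- 1#) α β α′ β′ u v ⟨
          1# · (α · u +ᵛ β · v) +ᵛ (- 1#) · (α′ · u +ᵛ β′ · v)  ≡⟨ cong₂ _+ᵛ_ (·-identity _) (cong (- 1# ·_) (sym eq)) ⟩
          (α · u +ᵛ β · v) +ᵛ (- 1#) · (α · u +ᵛ β · v)         ≡⟨ x-x≡0 _ ⟩
          0ᵛ                                                    ∎)
    in x-y≡0⇒x≡y (trans (cong (_+ - 1# * α′) (sym (*-identityˡ α))) α-α′≡0)
     , x-y≡0⇒x≡y (trans (cong (_+ - 1# * β′) (sym (*-identityˡ β))) β-β′≡0)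
    where open ≡-Reasoning

  -- Independence makes the coefficients unique, so (α, β) ↦ α u + β v is a bijection onto the span.
  ∑-span : ∀ {u v} → Independent u v → ∀ φ →
           ∑ E (λ α → ∑ E (λ β → φ (α · u +ᵛ β · v))) ≡ ∑ Eᵛ (λ w → ⟦ span? u v w ⟧ ℤ.* φ w)
  ∑-span {u} {v} ind φ = begin
    ∑ E (λ α → ∑ E (λ β → φ (α · u +ᵛ β · v)))
      ≡⟨ ∑-× E E (φ ∘ π) ⟨
    ∑ (Enum-× E E) (φ ∘ π)
      ≡⟨ ∑-fibre (Enum-× E E) Eᵛ π φ ⟩
    ∑ Eᵛ (λ w → ∑ (Enum-× E E) (λ αβ → ⟦ w ≟ᵛ π αβ ⟧) ℤ.* φ w)
      ≡⟨ ∑-cong Eᵛ (λ w → cong (ℤ._* φ w) (preimages w (span? u v w))) ⟩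
    ∑ Eᵛ (λ w → ⟦ span? u v w ⟧ ℤ.* φ w)  ∎
    where
    open ≡-Reasoning
    π : Carrier × Carrier → V
    π (α , β) = α · u +ᵛ β · v
    preimages : ∀ w (d : Dec (Span u v w)) → ∑ (Enum-× E E) (λ αβ → ⟦ w ≟ᵛ π αβ ⟧) ≡ ⟦ d ⟧
    preimages w (yes (α , β , eq)) = ∑-unique (Enum-× E E) (λ αβ → w ≟ᵛ π αβ) (α , β) (sym eq)
      λ (α′ , β′) w≡ → let α≡ , β≡ = coefficients-unique ind (trans (sym w≡) (sym eq)) in cong₂ _,_ α≡ β≡
    preimages w (no ∉) = ∑-none (Enum-× E E) (λ αβ → w ≟ᵛ π αβ) λ (α , β) w≡ → ∉ (α , β , sym w≡)

  ∑-span-1 : ∀ {u v} → Independent u v → ∑ Eᵛ (λ w → ⟦ span? u v w ⟧) ≡ + q ℤ.* + q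
  ∑-span-1 {u} {v} ind = begin
    ∑ Eᵛ (λ w → ⟦ span? u v w ⟧)         ≡⟨ ∑-cong Eᵛ (λ w → ℤ.*-identityʳ ⟦ span? u v w ⟧) ⟨
    ∑ Eᵛ (λ w → ⟦ span? u v w ⟧ ℤ.* 1ℤ)  ≡⟨ ∑-span ind (λ _ → 1ℤ) ⟨
    ∑ E (λ α → ∑ E (λ β → 1ℤ))           ≡⟨ ∑E-const _ ⟩
    + q ℤ.* ∑ E (λ β → 1ℤ)               ≡⟨ cong (+ q ℤ.*_) (trans (∑E-const 1ℤ) (ℤ.*-identityʳ (+ q))) ⟩
    + q ℤ.* + q                          ∎
    where open ≡-Reasoning

  -- Both spans have q² elements.
  Span-⊇ : ∀ {u v u′ v′} → Independent u v → Independent u′ v′ → Span u v u′ → Span u v v′ →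
           ∀ {w} → Span u v w → Span u′ v′ w
  Span-⊇ {u} {v} {u′} {v′} ind ind′ u′∈ v′∈ {w} w∈ with span? u′ v′ w in eq
  ... | yes w∈′ = w∈′
  ... | no  w∉′ = contradiction
    (trans (sym (cong₂ ℤ._-_ (⟦⟧-true (span? u v w) w∈) (⟦⟧-false (span? u′ v′ w) w∉′)))
           (∑-≡0 Eᵛ {λ w → ⟦ span? u v w ⟧ ℤ.- ⟦ span? u′ v′ w ⟧} nonneg sum≡0 w)) λ ()
    where
    nonneg : ∀ w → 0ℤ ℤ.≤ ⟦ span? u v w ⟧ ℤ.- ⟦ span? u′ v′ w ⟧
    nonneg w with span? u v w | span? u′ v′ w
    ... | yes _ | yes _ = +≤+ z≤n
    ... | yes _ | no _  = +≤+ z≤n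
    ... | no ∉  | yes ∈ = contradiction (Span-⊆ u′∈ v′∈ ∈) ∉
    ... | no _  | no _  = +≤+ z≤n
    sum≡0 : ∑ Eᵛ (λ w → ⟦ span? u v w ⟧ ℤ.- ⟦ span? u′ v′ w ⟧) ≡ 0ℤ
    sum≡0 = begin
      ∑ Eᵛ (λ w → ⟦ span? u v w ⟧ ℤ.- ⟦ span? u′ v′ w ⟧)
        ≡⟨ ∑-minus Eᵛ (λ w → ⟦ span? u v w ⟧) (λ w → ⟦ span? u′ v′ w ⟧) ⟩
      ∑ Eᵛ (λ w → ⟦ span? u v w ⟧) ℤ.- ∑ Eᵛ (λ w → ⟦ span? u′ v′ w ⟧)
        ≡⟨ cong₂ ℤ._-_ (∑-span-1 ind) (∑-span-1 ind′) ⟩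
      + q ℤ.* + q ℤ.- + q ℤ.* + q
        ≡⟨ ℤ.+-inverseʳ (+ q ℤ.* + q) ⟩
      0ℤ ∎
      where open ≡-Reasoning

  independent-≢0ˡ : ∀ {u v} → Independent u v → u ≢ 0ᵛ
  independent-≢0ˡ {v = v} ind refl = 0≢1 (sym (proj₁ (ind 1# 0#
    (trans (cong₂ _+ᵛ_ (·-identity 0ᵛ) (·-zeroˡ v)) (+ᵛ-identityʳ 0ᵛ)))))

  independent-≢· : ∀ {u v} → Independent u v → ∀ c → v ≢ c · u
  independent-≢· {u} {v} ind c refl = 0≢1 (sym (proj₂ (coefficients-unique ind {0#} {1#} {c} {0#} (begin
    0# · u +ᵛ 1# · v  ≡⟨ cong₂ _+ᵛ_ (·-zeroˡ u) (·-identity v) ⟩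
    0ᵛ +ᵛ v           ≡⟨ +ᵛ-comm 0ᵛ v ⟩
    v +ᵛ 0ᵛ           ≡⟨ cong (v +ᵛ_) (·-zeroˡ v) ⟨
    c · u +ᵛ 0# · v   ∎))))
    where open ≡-Reasoning

  independent : ∀ {u v} → u ≢ 0ᵛ → (∀ c → v ≢ c · u) → Independent u v
  independent {u} {v} u≢0 v≢cu α β eq with β ≟ 0#
  ... | yes refl = c·x≡0⇒c≡0 u≢0 (trans (sym (trans (cong (α · u +ᵛ_) (·-zeroˡ v)) (+ᵛ-identityʳ _))) eq) , refl
  ... | no  β≢0  = contradiction (begin
      v                                  ≡⟨ ⁻¹-·-cancel β≢0 v ⟨
      β ⁻¹ · β · v                       ≡⟨ cong (β ⁻¹ ·_) βv ⟩
      β ⁻¹ · (- 1#) · α · u              ≡⟨ trans (cong (β ⁻¹ ·_) (·-assoc (- 1#) α u)) (·-assoc (β ⁻¹) _ u) ⟩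
      (β ⁻¹ * (- 1# * α)) · u            ∎) (v≢cu _)
    where
    open ≡-Reasoning
    βv : β · v ≡ (- 1#) · α · u
    βv = begin
      β · v                                      ≡⟨ x+y-y≡x (β · v) (α · u) ⟨
      (β · v +ᵛ α · u) +ᵛ (- 1#) · α · u         ≡⟨ cong (_+ᵛ (- 1#) · α · u) (trans (+ᵛ-comm _ _) eq) ⟩
      0ᵛ +ᵛ (- 1#) · α · u                       ≡⟨ +ᵛ-identityˡ _ ⟩
      (- 1#) · α · u                             ∎

  record Linear (φ : V → Carrier) : Set where
    field
      additive    : ∀ x y → φ (x +ᵛ y) ≡ φ x + φ y
      homogeneous : ∀ c x → φ (c · x) ≡ c * φ x

    φ[0]≡0 : φ 0ᵛ ≡ 0#
    φ[0]≡0 = trans (cong φ (sym (·-zeroˡ 0ᵛ))) (trans (homogeneous 0# 0ᵛ) (zeroˡ _))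

    combination : ∀ α β x y → φ (α · x +ᵛ β · y) ≡ α * φ x + β * φ y
    combination α β x y = trans (additive _ _) (cong₂ _+_ (homogeneous α x) (homogeneous β y))

  -- All fibres of π are translates of the fibre over t₀.
  ∑-fibre-translates : ∀ {T : Set} (ET : Enumeration T) →
    (π : V → T) (s : T → V) (t₀ : T) →
    (∀ x t → π (x +ᵛ s t) ≡ t → π x ≡ t₀) → (∀ x t → π x ≡ t₀ → π (x +ᵛ s t) ≡ t) →
    ∑ ET (λ _ → ∑ Eᵛ (λ x → ⟦ Enumeration._≟_ ET (π x) t₀ ⟧)) ≡ + (q ℕ.^ suc n)
  ∑-fibre-translates ET π s t₀ to from = begin
    ∑ ET (λ t → ∑ Eᵛ (λ x → ⟦ π x ≟ᵀ t₀ ⟧))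
      ≡⟨ ∑-cong ET (λ t → ∑-cong Eᵛ λ x → ⟦⟧-cong (π x ≟ᵀ t₀) (π (x +ᵛ s t) ≟ᵀ t) (from x t) (to x t)) ⟩
    ∑ ET (λ t → ∑ Eᵛ (λ x → ⟦ π (x +ᵛ s t) ≟ᵀ t ⟧))
      ≡⟨ ∑-cong ET (λ t → ∑-reindex Eᵛ Eᵛ (_+ᵛ s t) (_+ᵛ (- 1#) · s t)
           (λ x → x-y+y≡x x (s t)) (λ x → x+y-y≡x x (s t)) (λ x → ⟦ π x ≟ᵀ t ⟧)) ⟩
    ∑ ET (λ t → ∑ Eᵛ (λ x → ⟦ π x ≟ᵀ t ⟧))
      ≡⟨ ∑-swap ET Eᵛ _ ⟩
    ∑ Eᵛ (λ x → ∑ ET (λ t → ⟦ π x ≟ᵀ t ⟧))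
      ≡⟨ ∑-cong Eᵛ (λ x → ∑-unique ET (λ t → π x ≟ᵀ t) (π x) refl λ t → sym) ⟩
    ∑ Eᵛ (λ x → 1ℤ)
      ≡⟨ trans (∑Eᵛ-const 1ℤ) (ℤ.*-identityʳ _) ⟩
    + (q ℕ.^ suc n)  ∎
    where
    open ≡-Reasoning
    open Enumeration ET using () renaming (_≟_ to _≟ᵀ_)

-- Numbers of solutions of linear equations

module LinearCounts {q : ℕ} (F : FiniteField q) (n : ℕ) where
  open FiniteField F
  open Field F
  open Projective F n
  open LinearAlgebra F n

  +-cancelʳ-0 : ∀ {x y} → x + y ≡ y → x ≡ 0#
  +-cancelʳ-0 {x} {y} eq = +-cancelˡ y x 0# (trans (+-comm y x) (trans eq (sym (+-identityʳ y))))

  -- If φ e = 1, then t ↦ t e is a section of φ, so each of the q fibres is a translate of the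
  -- kernel.
  ∑-kernel : ∀ {φ} → Linear φ → (∃ λ w → φ w ≢ 0#) →
             + q ℤ.* ∑ Eᵛ (λ x → ⟦ φ x ≟ 0# ⟧) ≡ + (q ℕ.^ suc n)
  ∑-kernel {φ} lin (w , φw≢0) = trans (sym (∑E-const _)) (∑-fibre-translates E φ (_· e) 0#
    (λ x t eq → +-cancelʳ-0 (trans (sym (shift x t)) eq))
    (λ x t eq → trans (shift x t) (trans (cong (_+ t) eq) (+-identityˡ t))))
    where
    open Linear lin
    e = φ w ⁻¹ · w
    shift : ∀ x t → φ (x +ᵛ t · e) ≡ φ x + t
    shift x t = trans (additive x _) (cong (λ z → φ x + z) (trans (homogeneous t e)
      (trans (cong (t *_) (trans (homogeneous _ w) (trans (*-comm _ _) (*-inverseʳ φw≢0)))) (*-identityʳ t))))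

  module _ {φ ψ} (φ-lin : Linear φ) (ψ-lin : Linear ψ)
           (φ≢0 : ∃ λ w → φ w ≢ 0#) (ψ≢cφ : ∀ c → ∃ λ w → ψ w ≢ c * φ w) where
    private
      module φ = Linear φ-lin
      module ψ = Linear ψ-lin
      -- The vectors e₁, e₂ are dual to φ, ψ. As φ e = 1, the vector w₁, at which ψ differs from
      -- ψ(e) φ, gives w₂ = w₁ - φ(w₁) e with φ w₂ = 0 and ψ w₂ ≠ 0. Scaling w₂ gives e₂, and
      -- subtracting ψ(e) e₂ from e gives e₁.
      w = proj₁ φ≢0
      e = φ w ⁻¹ · w
      c = ψ e
      w₁ = proj₁ (ψ≢cφ c)
      w₂ = 1# · w₁ +ᵛ (- 1# * φ w₁) · e
      e₂ = ψ w₂ ⁻¹ · w₂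
      e₁ = 1# · e +ᵛ (- 1# * c) · e₂

      x-x : ∀ x → x + - 1# * x ≡ 0#
      x-x x = trans (cong (λ z → x + z) (-1*x≈-x x)) (-‿inverseʳ x)

      φe : φ e ≡ 1#
      φe = trans (φ.homogeneous _ w) (trans (*-comm _ _) (*-inverseʳ (proj₂ φ≢0)))

      φw₂ : φ w₂ ≡ 0#
      φw₂ = trans (φ.combination 1# _ w₁ e) (trans (cong₂ _+_ (*-identityˡ _)
        (trans (cong (- 1# * φ w₁ *_) φe) (*-identityʳ _))) (x-x _))

      ψw₂≢0 : ψ w₂ ≢ 0#
      ψw₂≢0 eq = proj₂ (ψ≢cφ c) (trans (x-y≡0⇒x≡y (trans (sym (trans (ψ.combination 1# _ w₁ e)
        (cong₂ _+_ (*-identityˡ _) (*-assoc (- 1#) (φ w₁) c)))) eq)) (*-comm (φ w₁) c))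

      φe₂ : φ e₂ ≡ 0#
      φe₂ = trans (φ.homogeneous _ w₂) (trans (cong (ψ w₂ ⁻¹ *_) φw₂) (zeroʳ _))

      ψe₂ : ψ e₂ ≡ 1#
      ψe₂ = trans (ψ.homogeneous _ w₂) (trans (*-comm _ _) (*-inverseʳ ψw₂≢0))

      φe₁ : φ e₁ ≡ 1#
      φe₁ = trans (φ.combination 1# _ e e₂) (trans (cong₂ _+_ (trans (*-identityˡ _) φe)
        (trans (cong (- 1# * c *_) φe₂) (zeroʳ _))) (+-identityʳ _))

      ψe₁ : ψ e₁ ≡ 0#
      ψe₁ = trans (ψ.combination 1# _ e e₂) (trans (cong₂ _+_ (*-identityˡ _)
        (trans (cong (- 1# * c *_) ψe₂) (*-identityʳ _))) (x-x _))

    ∑-kernel₂ : + q ℤ.* (+ q ℤ.* ∑ Eᵛ (λ x → ⟦ φ x ≟ 0# ⟧ ℤ.* ⟦ ψ x ≟ 0# ⟧)) ≡ + (q ℕ.^ suc n)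
    ∑-kernel₂ = begin
      + q ℤ.* (+ q ℤ.* ∑ Eᵛ (λ x → ⟦ φ x ≟ 0# ⟧ ℤ.* ⟦ ψ x ≟ 0# ⟧))
        ≡⟨ cong (λ z → + q ℤ.* (+ q ℤ.* z)) (∑-cong Eᵛ λ x → trans (sym (⟦⟧-× (φ x ≟ 0#) (ψ x ≟ 0#)))
             (⟦⟧-cong ((φ x ≟ 0#) ×-dec (ψ x ≟ 0#)) (π x ≟² (0# , 0#))
               (λ (a , b) → cong₂ _,_ a b) λ eq → cong proj₁ eq , cong proj₂ eq)) ⟩
      + q ℤ.* (+ q ℤ.* ∑ Eᵛ (λ x → ⟦ π x ≟² (0# , 0#) ⟧))
        ≡⟨ trans (∑-× E E _) (trans (∑E-const _) (cong (+ q ℤ.*_) (∑E-const _))) ⟨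
      ∑ E² (λ _ → ∑ Eᵛ (λ x → ⟦ π x ≟² (0# , 0#) ⟧))
        ≡⟨ ∑-fibre-translates E² π s (0# , 0#)
             (λ x (a , b) eq → cong₂ _,_
               (+-cancelʳ-0 (trans (sym (φ-shift x a b)) (cong proj₁ eq)))
               (+-cancelʳ-0 (trans (sym (ψ-shift x a b)) (cong proj₂ eq))))
             (λ x (a , b) eq → cong₂ _,_
               (trans (φ-shift x a b) (trans (cong (_+ a) (cong proj₁ eq)) (+-identityˡ a)))
               (trans (ψ-shift x a b) (trans (cong (_+ b) (cong proj₂ eq)) (+-identityˡ b)))) ⟩
      + (q ℕ.^ suc n) ∎
      where
      open ≡-Reasoning
      E² = Enum-× E E
      open Enumeration E² using () renaming (_≟_ to _≟²_)
      π : V → Carrier × Carrier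
      π x = φ x , ψ x
      s : Carrier × Carrier → V
      s (a , b) = a · e₁ +ᵛ b · e₂
      φ-shift : ∀ x a b → φ (x +ᵛ s (a , b)) ≡ φ x + a
      φ-shift x a b = trans (φ.additive x _) (cong (λ z → φ x + z) (trans (φ.combination a b e₁ e₂)
        (trans (cong₂ _+_ (trans (cong (a *_) φe₁) (*-identityʳ a)) (trans (cong (b *_) φe₂) (zeroʳ b)))
               (+-identityʳ a))))
      ψ-shift : ∀ x a b → ψ (x +ᵛ s (a , b)) ≡ ψ x + b
      ψ-shift x a b = trans (ψ.additive x _) (cong (λ z → ψ x + z) (trans (ψ.combination a b e₁ e₂)
        (trans (cong₂ _+_ (trans (cong (a *_) ψe₁) (zeroʳ a)) (trans (cong (b *_) ψe₂) (*-identityʳ b)))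
               (+-identityˡ b))))

  private
    root : ∀ {a} → a ≢ 0# → ∀ b → ∃ λ x → x * a + b ≡ 0# × (∀ y → y * a + b ≡ 0# → y ≡ x)
    root {a} a≢0 b = x , xa+b , λ y ya+b → *-cancelˡ a≢0
      (trans (*-comm a y) (trans (+-cancelˡ b _ _ (trans (+-comm b _) (trans ya+b
        (trans (sym xa+b) (+-comm _ b))))) (*-comm x a)))
      where
      x = - b * a ⁻¹
      xa+b : x * a + b ≡ 0#
      xa+b = trans (cong (_+ b) (trans (*-assoc (- b) _ a) (trans (cong (- b *_)
        (trans (*-comm _ a) (*-inverseʳ a≢0))) (*-identityʳ (- b))))) (-‿inverseˡ b)

  -- A functional on a plane has q zeros, or q² if it is zero. With a and b its values at the
  -- generators of a line, this counts the coefficient pairs whose vectors on the line lie in the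
  -- hyperplane.
  ∑-equation : ∀ a b (d : Dec (a ≡ 0# × b ≡ 0#)) →
    ∑ E (λ α → ∑ E (λ β → ⟦ (α * a + β * b) ≟ 0# ⟧)) ≡ + q ℤ.+ (+ q ℤ.* + q ℤ.- + q) ℤ.* ⟦ d ⟧
  ∑-equation a b (yes (refl , refl)) = begin
    ∑ E (λ α → ∑ E (λ β → ⟦ (α * 0# + β * 0#) ≟ 0# ⟧))
      ≡⟨ ∑-cong E (λ α → ∑-cong E λ β → ⟦⟧-true ((α * 0# + β * 0#) ≟ 0#)
           (trans (cong₂ _+_ (zeroʳ α) (zeroʳ β)) (+-identityʳ 0#))) ⟩
    ∑ E (λ α → ∑ E (λ β → 1ℤ))
      ≡⟨ trans (∑E-const _) (cong (+ q ℤ.*_) (trans (∑E-const 1ℤ) (ℤ.*-identityʳ (+ q)))) ⟩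
    + q ℤ.* + q
      ≡⟨ arith (+ q) ⟩
    + q ℤ.+ (+ q ℤ.* + q ℤ.- + q) ℤ.* 1ℤ ∎
    where
    open ≡-Reasoning
    arith : ∀ x → x ℤ.* x ≡ x ℤ.+ (x ℤ.* x ℤ.- x) ℤ.* 1ℤ
    arith = ℤSolver.solve-∀
  ∑-equation a b (no ¬0) = trans count (sym (trans (cong (λ z → + q ℤ.+ z) (ℤ.*-zeroʳ (+ q ℤ.* + q ℤ.- + q)))
                                                  (ℤ.+-identityʳ (+ q))))
    where
    ∑1 : ∑ E (λ _ → 1ℤ) ≡ + q
    ∑1 = trans (∑E-const 1ℤ) (ℤ.*-identityʳ (+ q))
    count : ∑ E (λ α → ∑ E (λ β → ⟦ (α * a + β * b) ≟ 0# ⟧)) ≡ + q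
    count with a ≟ 0#
    ... | no a≢0 = trans (∑-swap E E _) (trans (∑-cong E λ β →
      let x , eq , unique = root a≢0 (β * b) in
      ∑-unique E (λ α → (α * a + β * b) ≟ 0#) x eq unique) ∑1)
    ... | yes refl = trans (∑-cong E λ α →
      let x , eq , unique = root (λ b≡0 → ¬0 (refl , b≡0)) (α * 0#) in
      ∑-unique E (λ β → (α * 0# + β * b) ≟ 0#) x (trans (+-comm _ _) eq)
        λ β eq′ → unique β (trans (+-comm _ _) eq′)) ∑1

  -- The relation `_≈ₚ_` on bare vectors. Freed from the proofs of nonzeroness, it can be decided
  -- and summed over all of V.
  _∼ᵥ_ : V → V → Set
  x ∼ᵥ y = ∃ λ c → c ≢ 0# × c · x ≡ y

  _∼ᵥ?_ : ∀ x y → Dec (x ∼ᵥ y)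
  x ∼ᵥ? y = Enumeration.any? E λ c → ¬? (c ≟ 0#) ×-dec (c · x ≟ᵛ y)

  ∑-class : ∀ {y} → y ≢ 0ᵛ → ∑ Eᵛ (λ x → ⟦ x ∼ᵥ? y ⟧) ≡ + q ℤ.- 1ℤ
  ∑-class {y} y≢0 = begin
    ∑ Eᵛ (λ x → ⟦ x ∼ᵥ? y ⟧)
      ≡⟨ ∑-cong Eᵛ (λ x → scalars x (x ∼ᵥ? y)) ⟨
    ∑ Eᵛ (λ x → ∑ E (λ c → ⟦ ¬? (c ≟ 0#) ×-dec (c · x ≟ᵛ y) ⟧))
      ≡⟨ ∑-swap Eᵛ E _ ⟩
    ∑ E (λ c → ∑ Eᵛ (λ x → ⟦ ¬? (c ≟ 0#) ×-dec (c · x ≟ᵛ y) ⟧))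
      ≡⟨ ∑-cong E (λ c → preimage c (¬? (c ≟ 0#))) ⟩
    ∑ E (λ c → ⟦ ¬? (c ≟ 0#) ⟧)
      ≡⟨ ∑-nonzero ⟩
    + q ℤ.- 1ℤ  ∎
    where
    open ≡-Reasoning
    scalars : ∀ x (d : Dec (x ∼ᵥ y)) → ∑ E (λ c → ⟦ ¬? (c ≟ 0#) ×-dec (c · x ≟ᵛ y) ⟧) ≡ ⟦ d ⟧
    scalars x (yes (c , c≢0 , refl)) = ∑-unique E (λ c′ → ¬? (c′ ≟ 0#) ×-dec (c′ · x ≟ᵛ y)) c (c≢0 , refl)
      λ c′ (_ , eq) → ·-cancelʳ (λ { refl → y≢0 (·-zeroʳ c) }) eq
    scalars x (no ¬∼) = ∑-none E (λ c′ → ¬? (c′ ≟ 0#) ×-dec (c′ · x ≟ᵛ y)) λ c p → ¬∼ (c , p)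
    preimage : ∀ c (d : Dec (c ≢ 0#)) → ∑ Eᵛ (λ x → ⟦ d ×-dec (c · x ≟ᵛ y) ⟧) ≡ ⟦ d ⟧
    preimage c (yes c≢0) = ∑-unique Eᵛ (λ x → yes c≢0 ×-dec (c · x ≟ᵛ y)) (c ⁻¹ · y) (c≢0 , ·-⁻¹-cancel c≢0 y)
      λ x (_ , eq) → trans (sym (⁻¹-·-cancel c≢0 x)) (cong (c ⁻¹ ·_) eq)
    preimage c (no ¬c≢0) = ∑-none Eᵛ (λ x → no ¬c≢0 ×-dec (c · x ≟ᵛ y)) λ x → ¬c≢0 ∘ proj₁

-- The quadratic extension

module _ {q : ℕ} (F : FiniteField q) where
  open FiniteField F
  open Field F
  private module Sum = SemiringSum semiring

  -- Split off the first coordinate and restrict φ to vectors that begin with 0; for this the length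
  -- must vary. Applied in both arguments, it expands the symplectic form by its Gram matrix and so
  -- relates it to `B`.
  linear-expansion : ∀ {m} (φ : Vec Carrier m → Carrier) →
    (∀ x y → φ (Vec.zipWith _+_ x y) ≡ φ x + φ y) → (∀ c x → φ (Vec.map (c *_) x) ≡ c * φ x) →
    ∀ x → φ x ≡ sum (λ i → Vec.lookup x i * φ (Vec.replicate m 0# Vec.[ i ]≔ 1#))
  linear-expansion φ add hom []      = trans (hom 0# []) (zeroˡ _)
  linear-expansion {suc m} φ add hom (a ∷ x) = begin
    φ (a ∷ x)
      ≡⟨ cong φ (cong₂ _∷_ (trans (cong (_+ 0#) (*-identityʳ a)) (+-identityʳ a)) (0+ x)) ⟨
    φ (Vec.zipWith _+_ (Vec.map (a *_) (1# ∷ 0ᵐ)) (0# ∷ x))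
      ≡⟨ trans (add _ _) (cong (_+ φ (0# ∷ x)) (hom a _)) ⟩
    a * φ (1# ∷ 0ᵐ) + φ (0# ∷ x)
      ≡⟨ cong (λ z → a * φ (1# ∷ 0ᵐ) + z) (linear-expansion (λ x → φ (0# ∷ x))
           (λ x y → trans (cong (λ z → φ (z ∷ Vec.zipWith _+_ x y)) (sym (+-identityʳ 0#))) (add _ _))
           (λ c x → trans (cong (λ z → φ (z ∷ Vec.map (c *_) x)) (sym (zeroʳ c))) (hom c _)) x) ⟩
    a * φ (1# ∷ 0ᵐ) + sum (λ i → Vec.lookup x i * φ (0# ∷ (0ᵐ Vec.[ i ]≔ 1#)))  ∎
    where
    open ≡-Reasoning
    0ᵐ = Vec.replicate m 0#
    0+ : ∀ {k} (x : Vec Carrier k) → Vec.zipWith _+_ (Vec.map (a *_) (Vec.replicate k 0#)) x ≡ x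
    0+ []      = refl
    0+ (b ∷ x) = cong₂ _∷_ (trans (cong (_+ b) (zeroʳ a)) (+-identityˡ b)) (0+ x)

  *-distribʳ-sum : ∀ {m} c (t : Fin m → Carrier) → sum (λ i → t i * c) ≡ sum t * c
  *-distribʳ-sum c t = sym (Sum.*-distribʳ-sum c t)

module QuadraticExtension {q : ℕ} (q-pp : IsPrimePower q)
  (F : FiniteField q) (K : FiniteField (q ℕ.^ 2)) (ext : Extension F K) where
  module 𝔽 where
    open FiniteField F public
    open Field F public
  open FiniteField K
  open Field K
  open Extension ext
  open IsRingHomomorphism isHomomorphism public
    using () renaming (+-homo to ι-+; *-homo to ι-*; 0#-homo to ι-0; 1#-homo to ι-1)
  open Solver using (solve; _:+_; _:*_; _:=_; con)
  open Exp semiring using (^-assocʳ)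
  open CommutativeExp commutativeSemiring using (^-distrib-*)

  conj : Carrier → Carrier
  conj x = x ^ q

  -- K has q² = p^(2(k+1)) elements, hence characteristic p, and x ↦ x^q is a power of the Frobenius
  -- map.
  conj-+ : ∀ x y → conj (x + y) ≡ conj x + conj y
  conj-+ x y = let p , k , p-prime , q≡ = q-pp in
    subst (λ q → (x + y) ^ q ≡ x ^ q + y ^ q) (sym q≡)
      (^p^-+ p-prime (characteristic p p-prime (suc k ℕ.* 2)
        (trans (cong (λ n → Mult._×_ semiring n 1#) (sym (trans (cong (ℕ._^ 2) q≡) (ℕ.^-*-assoc p (suc k) 2)))) q×1≡0))
        (suc k) x y)

  conj-* : ∀ x y → conj (x * y) ≡ conj x * conj y
  conj-* x y = ^-distrib-* x y q

  conj-conj : ∀ x → conj (conj x) ≡ x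
  conj-conj x = trans (^-assocʳ x q q)
    (trans (cong (x ^_) (cong (q ℕ.*_) (sym (ℕ.*-identityʳ q)))) (x^q≡x x))

  conj-ι : ∀ a → conj (ι a) ≡ ι a
  conj-ι a = trans (sym (ι-^ q)) (cong ι (𝔽.x^q≡x a))
    where
    ι-^ : ∀ n → ι (a 𝔽.^ n) ≡ ι a ^ n
    ι-^ zero    = ι-1
    ι-^ (suc n) = trans (ι-* a _) (cong (ι a *_) (ι-^ n))

  conj-0 : conj 0# ≡ 0#
  conj-0 = trans (cong conj (sym ι-0)) (trans (conj-ι 𝔽.0#) ι-0)

  ι-+-* : ∀ a c b → ι (a 𝔽.+ c 𝔽.* b) ≡ ι a + ι c * ι b
  ι-+-* a c b = trans (ι-+ a _) (cong (λ z → ι a + z) (ι-* c b))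

  ι-1+1 : ι (𝔽.- 𝔽.1#) + 1# ≡ 0#
  ι-1+1 = trans (cong (λ z → ι (𝔽.- 𝔽.1#) + z) (sym ι-1))
    (trans (sym (ι-+ _ _)) (trans (cong ι (𝔽.-‿inverseˡ 𝔽.1#)) ι-0))

  ι-injective : ∀ {a b} → ι a ≡ ι b → a ≡ b
  ι-injective {a} {b} eq = LinearAlgebra.x-y≡0⇒x≡y F 0 (ι≡0⇒≡0 (begin
    ι (a 𝔽.+ 𝔽.- 𝔽.1# 𝔽.* b)      ≡⟨ ι-+-* a _ b ⟩
    ι a + ι (𝔽.- 𝔽.1#) * ι b      ≡⟨ cong (λ z → z + ι (𝔽.- 𝔽.1#) * ι b) eq ⟩
    ι b + ι (𝔽.- 𝔽.1#) * ι b      ≡⟨ solve 2 (λ m x → x :+ m :* x := (m :+ con 1) :* x) refl (ι (𝔽.- 𝔽.1#)) (ι b) ⟩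
    (ι (𝔽.- 𝔽.1#) + 1#) * ι b     ≡⟨ cong (_* ι b) ι-1+1 ⟩
    0# * ι b                      ≡⟨ zeroˡ _ ⟩
    0#                            ∎))
    where open ≡-Reasoning

  private
    ∑F-1 : ∑ 𝔽.E (λ _ → 1ℤ) ≡ + q
    ∑F-1 = trans (∑-↔ 𝔽.finite 1ℤ) (ℤ.*-identityʳ (+ q))

    ∑K-1 : ∑ E (λ _ → 1ℤ) ≡ + q ℤ.* + q
    ∑K-1 = trans (∑-↔ finite 1ℤ) (trans (ℤ.*-identityʳ _)
      (trans (cong (λ z → + (q ℕ.* z)) (ℕ.*-identityʳ q)) (ℤ.pos-* q q)))

    ι-not-onto : ¬ (∀ κ → ∃ λ a → ι a ≡ κ)
    ι-not-onto onto = ℕ.<⇒≢ (ℕ.m<m*n q q {{ℕ.>-nonZero (ℕ.<-trans ℕ.z<s 𝔽.1<q)}} 𝔽.1<q)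
      (ℤ.+-injective (begin
        + q                                                           ≡⟨ ∑F-1 ⟨
        ∑ 𝔽.E (λ _ → 1ℤ)                                              ≡⟨ ∑-fibre 𝔽.E E ι (λ _ → 1ℤ) ⟩
        ∑ E (λ κ → ∑ 𝔽.E (λ a → ⟦ κ ≟ ι a ⟧) ℤ.* 1ℤ)                  ≡⟨ ∑-cong E (λ κ → cong (ℤ._* 1ℤ) (once′ κ)) ⟩
        ∑ E (λ κ → 1ℤ)                                                ≡⟨ ∑K-1 ⟩
        + q ℤ.* + q                                                   ≡⟨ ℤ.pos-* q q ⟨
        + (q ℕ.* q)                                                   ∎))
      where
      open ≡-Reasoning
      once′ : ∀ κ → ∑ 𝔽.E (λ a → ⟦ κ ≟ ι a ⟧) ≡ 1ℤ
      once′ κ = let a , ιa≡κ = onto κ in ∑-unique 𝔽.E (λ a → κ ≟ ι a) a (sym ιa≡κ)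
        λ a′ κ≡ → ι-injective (trans (sym κ≡) (sym ιa≡κ))

  abstract
    primitive-element : ∃ λ ω → ∀ a → ι a ≢ ω
    primitive-element with Enumeration.any? E (λ κ → Enumeration.all? 𝔽.E (λ a → ¬? (ι a ≟ κ)))
    ... | yes ω∉F = ω∉F
    ... | no  all∈F = contradiction in-F ι-not-onto
      where
      in-F : ∀ κ → ∃ λ a → ι a ≡ κ
      in-F κ with Enumeration.any? 𝔽.E (λ a → ι a ≟ κ)
      ... | yes κ∈F = κ∈F
      ... | no  κ∉F = contradiction (κ , λ a eq → κ∉F (a , eq)) all∈F

  ω : Carrier
  ω = proj₁ primitive-element

  ω̄ : Carrier
  ω̄ = conj ω

  conj-ω̄ : conj ω̄ ≡ ω
  conj-ω̄ = conj-conj ω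

  -- If b were nonzero, then ω = -a/b would lie in F: 1 and ω are independent over F.
  ι+ωι≡0 : ∀ {a b} → ι a + ω * ι b ≡ 0# → a ≡ 𝔽.0# × b ≡ 𝔽.0#
  ι+ωι≡0 {a} {b} eq with b 𝔽.≟ 𝔽.0#
  ... | yes refl = ι≡0⇒≡0 (trans (sym (trans (cong (λ z → ι a + z) (trans (cong (ω *_) ι-0) (zeroʳ ω))) (+-identityʳ _))) eq) , refl
  ... | no  b≢0  = contradiction (begin
    ι (𝔽.- 𝔽.1# 𝔽.* (a 𝔽.* b 𝔽.⁻¹))
      ≡⟨ trans (ι-* _ _) (cong (m *_) (ι-* a (b 𝔽.⁻¹))) ⟩
    m * (ι a * c)
      ≡⟨ +-identityʳ _ ⟨
    m * (ι a * c) + 0#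
      ≡⟨ cong (λ z → m * (ι a * c) + z) (trans (cong (ω *_) (trans (cong (_* 1#) ι-1+1) (zeroˡ _))) (zeroʳ ω)) ⟨
    -- The added term is zero, since m = -1. Treating m as an unknown with m + 1 = 0 turns the next
    -- step into an identity of commutative semirings.
    m * (ι a * c) + ω * ((m + 1#) * 1#)
      ≡⟨ cong (λ z → m * (ι a * c) + ω * ((m + 1#) * z)) ιb*c ⟨
    m * (ι a * c) + ω * ((m + 1#) * (ι b * c))
      ≡⟨ solve 5 (λ a b c m w → m :* (a :* c) :+ w :* ((m :+ con 1) :* (b :* c)) :=
           m :* c :* (a :+ w :* b) :+ w :* (b :* c)) refl (ι a) (ι b) c m ω ⟩
    m * c * (ι a + ω * ι b) + ω * (ι b * c)
      ≡⟨ cong₂ (λ x y → m * c * x + ω * y) eq ιb*c ⟩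
    m * c * 0# + ω * 1#
      ≡⟨ trans (cong₂ _+_ (zeroʳ _) (*-identityʳ ω)) (+-identityˡ ω) ⟩
    ω  ∎) (proj₂ primitive-element _)
    where
    open ≡-Reasoning
    m = ι (𝔽.- 𝔽.1#)
    c = ι (b 𝔽.⁻¹)
    ιb*c : ι b * c ≡ 1#
    ιb*c = trans (sym (ι-* b _)) (trans (cong ι (𝔽.*-inverseʳ b≢0)) ι-1)

  -- Conjugation fixes F and exchanges ω and ω̄.
  ι+ω̄ι≡0 : ∀ {a b} → ι a + ω̄ * ι b ≡ 0# → a ≡ 𝔽.0# × b ≡ 𝔽.0#
  ι+ω̄ι≡0 {a} {b} eq = ι+ωι≡0 (begin
    ι a + ω * ι b              ≡⟨ cong₂ _+_ (conj-ι a) (cong₂ _*_ conj-ω̄ (conj-ι b)) ⟨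
    conj (ι a) + conj ω̄ * conj (ι b) ≡⟨ cong (λ z → conj (ι a) + z) (conj-* ω̄ (ι b)) ⟨
    conj (ι a) + conj (ω̄ * ι b) ≡⟨ conj-+ (ι a) _ ⟨
    conj (ι a + ω̄ * ι b)       ≡⟨ cong conj eq ⟩
    conj 0#                    ≡⟨ conj-0 ⟩
    0#                         ∎)
    where open ≡-Reasoning

  ι+ωι-injective : ∀ {a b a′ b′} → ι a + ω * ι b ≡ ι a′ + ω * ι b′ → a ≡ a′ × b ≡ b′
  ι+ωι-injective {a} {b} {a′} {b′} eq =
    let a-a′ , b-b′ = ι+ωι≡0 (begin
          ι (a 𝔽.+ 𝔽.- 𝔽.1# 𝔽.* a′) + ω * ι (b 𝔽.+ 𝔽.- 𝔽.1# 𝔽.* b′)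
            ≡⟨ cong₂ (λ x y → x + ω * y) (ι-+-* a _ a′) (ι-+-* b _ b′) ⟩
          (ι a + m * ι a′) + ω * (ι b + m * ι b′)
            ≡⟨ solve 6 (λ a b a′ b′ m w → (a :+ m :* a′) :+ w :* (b :+ m :* b′) :=
                 (a :+ w :* b) :+ m :* (a′ :+ w :* b′)) refl (ι a) (ι b) (ι a′) (ι b′) m ω ⟩
          (ι a + ω * ι b) + m * (ι a′ + ω * ι b′)
            ≡⟨ cong (_+ m * (ι a′ + ω * ι b′)) eq ⟩
          (ι a′ + ω * ι b′) + m * (ι a′ + ω * ι b′)
            ≡⟨ solve 2 (λ m x → x :+ m :* x := (m :+ con 1) :* x) refl m (ι a′ + ω * ι b′) ⟩
          (m + 1#) * (ι a′ + ω * ι b′)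
            ≡⟨ trans (cong (_* (ι a′ + ω * ι b′)) ι-1+1) (zeroˡ _) ⟩
          0#  ∎)
    in LinearAlgebra.x-y≡0⇒x≡y F 0 a-a′ , LinearAlgebra.x-y≡0⇒x≡y F 0 b-b′
    where
    open ≡-Reasoning
    m = ι (𝔽.- 𝔽.1#)

  private
    F² = Enum-× 𝔽.E 𝔽.E
    π : 𝔽.Carrier × 𝔽.Carrier → Carrier
    π (a , b) = ι a + ω * ι b

    preimages : Carrier → ℤ
    preimages κ = ∑ F² (λ ab → ⟦ κ ≟ π ab ⟧)

    preimages≤1 : ∀ κ → 0ℤ ℤ.≤ 1ℤ ℤ.- preimages κ
    preimages≤1 κ with Enumeration.any? F² (λ ab → κ ≟ π ab)
    ... | yes (ab , eq) = ℤ.≤-reflexive (sym (cong (λ z → 1ℤ ℤ.- z)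
      (∑-unique F² (λ ab → κ ≟ π ab) ab eq λ ab′ eq′ →
        let a≡ , b≡ = ι+ωι-injective (trans (sym eq′) eq) in cong₂ _,_ a≡ b≡)))
    ... | no ∄ = subst (λ z → 0ℤ ℤ.≤ 1ℤ ℤ.- z)
      (sym (∑-none F² (λ ab → κ ≟ π ab) λ ab eq → ∄ (ab , eq))) (+≤+ z≤n)

    ∑-missed : ∑ E (λ κ → 1ℤ ℤ.- preimages κ) ≡ 0ℤ
    ∑-missed = begin
      ∑ E (λ κ → 1ℤ ℤ.- preimages κ)
        ≡⟨ ∑-minus E (λ _ → 1ℤ) preimages ⟩
      ∑ E (λ _ → 1ℤ) ℤ.- ∑ E preimages
        ≡⟨ cong₂ ℤ._-_ ∑K-1 hits ⟩
      + q ℤ.* + q ℤ.- + q ℤ.* + q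
        ≡⟨ ℤ.+-inverseʳ (+ q ℤ.* + q) ⟩
      0ℤ ∎
      where
      open ≡-Reasoning
      hits : ∑ E preimages ≡ + q ℤ.* + q
      hits = begin
        ∑ E preimages                              ≡⟨ ∑-cong E (λ κ → ℤ.*-identityʳ (preimages κ)) ⟨
        ∑ E (λ κ → preimages κ ℤ.* 1ℤ)             ≡⟨ ∑-fibre F² E π (λ _ → 1ℤ) ⟨
        ∑ F² (λ _ → 1ℤ)                            ≡⟨ ∑-× 𝔽.E 𝔽.E (λ _ → 1ℤ) ⟩
        ∑ 𝔽.E (λ _ → ∑ 𝔽.E (λ _ → 1ℤ))             ≡⟨ ∑-↔ 𝔽.finite _ ⟩
        + q ℤ.* ∑ 𝔽.E (λ _ → 1ℤ)                   ≡⟨ cong (+ q ℤ.*_) ∑F-1 ⟩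
        + q ℤ.* + q                                ∎

  abstract
    -- (a, b) ↦ a + ω b is an injection from a set of q² elements into K, which also has q². The
    -- numbers 1 - `preimages` κ are nonnegative with sum zero, so no κ is missed.
    decompose : ∀ κ → ∃ λ ab → κ ≡ π ab
    decompose κ with Enumeration.any? F² (λ ab → κ ≟ π ab)
    ... | yes found = found
    ... | no ∄ = contradiction (trans (cong (λ z → 1ℤ ℤ.- z)
        (sym (∑-none F² (λ ab → κ ≟ π ab) λ ab eq → ∄ (ab , eq))))
        (∑-≡0 E preimages≤1 ∑-missed κ)) λ ()

  re im : Carrier → 𝔽.Carrier
  re κ = proj₁ (proj₁ (decompose κ))
  im κ = proj₂ (proj₁ (decompose κ))

  re+ωim : ∀ κ → ι (re κ) + ω * ι (im κ) ≡ κ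
  re+ωim κ = sym (proj₂ (decompose κ))

-- The Hermitian form

module SymplecticLemmas {q : ℕ} (F : FiniteField q) (r : ℕ) (b : SymplecticForm F r) where
  open FiniteField F
  open Field F
  open Projective F r
  open LinearAlgebra F r
  open SymplecticForm b

  antisymmetric : ∀ x y → form y x ≡ - 1# * form x y
  antisymmetric x y = +-cancelˡ (form x y) _ _ (begin
    form x y + form y x                            ≡⟨ cong₂ _+_ (+-identityˡ _) (+-identityʳ _) ⟨
    (0# + form x y) + (form y x + 0#)              ≡⟨ cong₂ (λ s t → (s + form x y) + (form y x + t)) (alternating x) (alternating y) ⟨
    (form x x + form x y) + (form y x + form y y)  ≡⟨ cong₂ _+_ (additiveʳ x x y) (additiveʳ y x y) ⟨
    form x (x +ᵛ y) + form y (x +ᵛ y)              ≡⟨ additiveˡ x y _ ⟨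
    form (x +ᵛ y) (x +ᵛ y)                         ≡⟨ alternating _ ⟩
    0#                                             ≡⟨ -‿inverseʳ _ ⟨
    form x y + - form x y                          ≡⟨ cong (λ z → form x y + z) (-1*x≈-x _) ⟨
    form x y + - 1# * form x y                     ∎)
    where open ≡-Reasoning

  form-symmetric-0 : ∀ {x y} → form x y ≡ 0# → form y x ≡ 0#
  form-symmetric-0 {x} {y} eq = trans (antisymmetric x y) (trans (cong (- 1# *_) eq) (zeroʳ _))

  linearˡ : ∀ y → Linear (λ x → form x y)
  linearˡ y = record { additive = λ x x′ → additiveˡ x x′ y ; homogeneous = λ c x → homogeneousˡ c x y }

  linearʳ : ∀ x → Linear (form x)
  linearʳ x = record { additive = additiveʳ x ; homogeneous = λ c → homogeneousʳ c x }

  -- Nondegeneracy in the form of a witness, which a search through the finite space provides.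
  not-in-radical : ∀ {x} → x ≢ 0ᵛ → ∃ λ y → form y x ≢ 0#
  not-in-radical {x} x≢0 with Enumeration.any? Eᵛ (λ y → ¬? (form y x ≟ 0#))
  ... | yes found = found
  ... | no  none  = contradiction (nondegenerate x zero-form) x≢0
    where
    zero-form : ∀ y → form x y ≡ 0#
    zero-form y with form y x ≟ 0#
    ... | yes eq = form-symmetric-0 eq
    ... | no  ≢0 = contradiction (y , ≢0) none

  perp-Span : ∀ {u v w} y → form y u ≡ 0# → form y v ≡ 0# → Span u v w → form y w ≡ 0#
  perp-Span {u} {v} y yu yv (α , β , refl) =
    trans (Linear.combination (linearʳ y) α β u v)
      (trans (cong₂ _+_ (trans (cong (α *_) yu) (zeroʳ α)) (trans (cong (β *_) yv) (zeroʳ β))) (+-identityʳ 0#))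

module HermitianLemmas {q : ℕ} (q-pp : IsPrimePower q)
  (F : FiniteField q) (K : FiniteField (q ℕ.^ 2)) (ext : Extension F K)
  (r : ℕ) (b : SymplecticForm F r) where
  module 𝕍 where
    open Projective F r public
    open LinearAlgebra F r public
  open QuadraticExtension q-pp F K ext
  open FiniteField K
  open Field K
  open Extension ext
  open Projective K r
  open LinearAlgebra K r
  open Hermitian F K ext r b
  open SymplecticForm b
  open SymplecticLemmas F r b
  open Solver using (solve; _:+_; _:*_; _:=_; con)
  private module Sum = SemiringSum semiring

  ιᵛ : 𝕍.V → V
  ιᵛ = Vec.map ι

  _+ω_ : 𝕍.V → 𝕍.V → V
  u +ω v = ιᵛ u +ᵛ ω · ιᵛ v

  reᵛ imᵛ : V → 𝕍.V
  reᵛ = Vec.map re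
  imᵛ = Vec.map im

  private
    pair : ∀ {m} → Vec 𝔽.Carrier m → Vec 𝔽.Carrier m → Vec Carrier m
    pair u v = Vec.zipWith _+_ (Vec.map ι u) (Vec.map (ω *_) (Vec.map ι v))

    pair-re-im : ∀ {m} (y : Vec Carrier m) → pair (Vec.map re y) (Vec.map im y) ≡ y
    pair-re-im []      = refl
    pair-re-im (κ ∷ y) = cong₂ _∷_ (re+ωim κ) (pair-re-im y)

    pair-injective : ∀ {m} (u v u′ v′ : Vec 𝔽.Carrier m) → pair u v ≡ pair u′ v′ → u ≡ u′ × v ≡ v′
    pair-injective []      []      []        []        _  = refl , refl
    pair-injective (a ∷ u) (b ∷ v) (a′ ∷ u′) (b′ ∷ v′) eq =
      let a≡ , b≡ = ι+ωι-injective (Vec.∷-injectiveˡ eq)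
          u≡ , v≡ = pair-injective u v u′ v′ (Vec.∷-injectiveʳ eq)
      in cong₂ _∷_ a≡ u≡ , cong₂ _∷_ b≡ v≡

    pair-0 : ∀ m → pair (Vec.replicate m 𝔽.0#) (Vec.replicate m 𝔽.0#) ≡ Vec.replicate m 0#
    pair-0 zero    = refl
    pair-0 (suc m) = cong₂ _∷_
      (trans (cong₂ _+_ ι-0 (trans (cong (ω *_) ι-0) (zeroʳ ω))) (+-identityʳ 0#)) (pair-0 m)

    pair-combination : ∀ {m} a a′ b b′ (u v : Vec 𝔽.Carrier m) →
      Vec.zipWith _+_ (Vec.map ((ι a + ω * ι a′) *_) (Vec.map ι u)) (Vec.map ((ι b + ω * ι b′) *_) (Vec.map ι v)) ≡
      pair (Vec.zipWith 𝔽._+_ (Vec.map (a 𝔽.*_) u) (Vec.map (b 𝔽.*_) v))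
           (Vec.zipWith 𝔽._+_ (Vec.map (a′ 𝔽.*_) u) (Vec.map (b′ 𝔽.*_) v))
    pair-combination a a′ b b′ []      []      = refl
    pair-combination a a′ b b′ (x ∷ u) (y ∷ v) = cong₂ _∷_ (begin
      (ι a + ω * ι a′) * ι x + (ι b + ω * ι b′) * ι y
        ≡⟨ solve 7 (λ a a′ b b′ w x y → (a :+ w :* a′) :* x :+ (b :+ w :* b′) :* y :=
             (a :* x :+ b :* y) :+ w :* (a′ :* x :+ b′ :* y)) refl (ι a) (ι a′) (ι b) (ι b′) ω (ι x) (ι y) ⟩
      (ι a * ι x + ι b * ι y) + ω * (ι a′ * ι x + ι b′ * ι y)
        ≡⟨ cong₂ (λ s t → s + ω * t) (hom a b) (hom a′ b′) ⟨
      ι (a 𝔽.* x 𝔽.+ b 𝔽.* y) + ω * ι (a′ 𝔽.* x 𝔽.+ b′ 𝔽.* y)  ∎)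
      (pair-combination a a′ b b′ u v)
      where
      open ≡-Reasoning
      hom : ∀ a b → ι (a 𝔽.* x 𝔽.+ b 𝔽.* y) ≡ ι a * ι x + ι b * ι y
      hom a b = trans (ι-+-* _ b y) (cong (_+ ι b * ι y) (ι-* a x))

    τ-pair : ∀ {m} (u v : Vec 𝔽.Carrier m) →
             Vec.map (_^ q) (pair u v) ≡ Vec.zipWith _+_ (Vec.map ι u) (Vec.map (ω̄ *_) (Vec.map ι v))
    τ-pair []      []      = refl
    τ-pair (a ∷ u) (b ∷ v) = cong₂ _∷_
      (trans (conj-+ _ _) (cong₂ _+_ (conj-ι a) (trans (conj-* ω _) (cong (ω̄ *_) (conj-ι b)))))
      (τ-pair u v)

    ι-combination : ∀ {m} a b (u v : Vec 𝔽.Carrier m) →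
      Vec.map ι (Vec.zipWith 𝔽._+_ (Vec.map (a 𝔽.*_) u) (Vec.map (b 𝔽.*_) v)) ≡
      Vec.zipWith _+_ (Vec.map (ι a *_) (Vec.map ι u)) (Vec.map (ι b *_) (Vec.map ι v))
    ι-combination a b []      []      = refl
    ι-combination a b (x ∷ u) (y ∷ v) = cong₂ _∷_
      (trans (ι-+-* _ b y) (cong (_+ ι b * ι y) (ι-* a x))) (ι-combination a b u v)

  +ω-surjective : ∀ y → reᵛ y +ω imᵛ y ≡ y
  +ω-surjective = pair-re-im

  +ω-injective : ∀ {u v u′ v′} → u +ω v ≡ u′ +ω v′ → u ≡ u′ × v ≡ v′
  +ω-injective = pair-injective _ _ _ _

  0+ω0 : 𝕍.0ᵛ +ω 𝕍.0ᵛ ≡ 0ᵛ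
  0+ω0 = pair-0 (suc r)

  combination-+ω : ∀ a a′ b b′ u v → (ι a + ω * ι a′) · ιᵛ u +ᵛ (ι b + ω * ι b′) · ιᵛ v ≡
                   (a 𝕍.· u 𝕍.+ᵛ b 𝕍.· v) +ω (a′ 𝕍.· u 𝕍.+ᵛ b′ 𝕍.· v)
  combination-+ω = pair-combination

  ∑-+ω : ∀ φ → ∑ 𝕍.Eᵛ (λ u → ∑ 𝕍.Eᵛ (λ v → φ (u +ω v))) ≡ ∑ Eᵛ φ
  ∑-+ω φ = trans (sym (∑-× 𝕍.Eᵛ 𝕍.Eᵛ _)) (∑-reindex (Enum-× 𝕍.Eᵛ 𝕍.Eᵛ) Eᵛ
    (λ (u , v) → u +ω v) (λ y → reᵛ y , imᵛ y) +ω-surjective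
    (λ (u , v) → let u≡ , v≡ = +ω-injective (+ω-surjective (u +ω v)) in cong₂ _,_ u≡ v≡) φ)

  -- Write each coefficient over the basis 1, ω of K. The parts of the combination are then
  -- F-combinations of u₀ and v₀, and by uniqueness of the parts they are u and v. With `Span-ι⇐`,
  -- an extended line contains u + ω v exactly if the line contains both u and v.
  Span-ι⇒ : ∀ {u₀ v₀ u v} → Span (ιᵛ u₀) (ιᵛ v₀) (u +ω v) → 𝕍.Span u₀ v₀ u × 𝕍.Span u₀ v₀ v
  Span-ι⇒ {u₀} {v₀} (α , β , eq) =
    let u≡ , v≡ = +ω-injective (trans (sym (combination-+ω (re α) (im α) (re β) (im β) u₀ v₀))
                    (trans (cong₂ (λ x y → x · ιᵛ u₀ +ᵛ y · ιᵛ v₀) (re+ωim α) (re+ωim β)) eq))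
    in (re α , re β , u≡) , (im α , im β , v≡)

  Span-ι : ∀ {u v w} → 𝕍.Span u v w → Span (ιᵛ u) (ιᵛ v) (ιᵛ w)
  Span-ι {u} {v} (a , b , refl) = ι a , ι b , sym (ι-combination a b u v)

  Span-ι⇐ : ∀ {u₀ v₀ u v} → 𝕍.Span u₀ v₀ u → 𝕍.Span u₀ v₀ v → Span (ιᵛ u₀) (ιᵛ v₀) (u +ω v)
  Span-ι⇐ {u = u} {v} u∈ v∈ = subst (λ z → Span _ _ (z +ᵛ ω · ιᵛ v)) (·-identity (ιᵛ u))
    (Span-closed 1# ω (Span-ι u∈) (Span-ι v∈))

  independent-ι : ∀ {u v} → 𝕍.Independent u v → Independent (ιᵛ u) (ιᵛ v)
  independent-ι {u} {v} ind α β eq =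
    let au+bv≡0 , a′u+b′v≡0 = +ω-injective (trans (sym (combination-+ω (re α) (im α) (re β) (im β) u v))
          (trans (cong₂ (λ x y → x · ιᵛ u +ᵛ y · ιᵛ v) (re+ωim α) (re+ωim β)) (trans eq (sym 0+ω0))))
        a≡0  , b≡0  = ind _ _ au+bv≡0
        a′≡0 , b′≡0 = ind _ _ a′u+b′v≡0
    in zero-parts α a≡0 a′≡0 , zero-parts β b≡0 b′≡0
    where
    zero-parts : ∀ κ → re κ ≡ 𝔽.0# → im κ ≡ 𝔽.0# → κ ≡ 0#
    zero-parts κ re≡0 im≡0 = trans (sym (re+ωim κ)) (trans (cong₂ (λ x y → ι x + ω * ι y) re≡0 im≡0)
      (trans (cong₂ _+_ ι-0 (trans (cong (ω *_) ι-0) (zeroʳ ω))) (+-identityʳ 0#)))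

  private
    G : Fin (suc r) → Fin (suc r) → 𝔽.Carrier
    G i j = form (𝕍.basis i) (𝕍.basis j)

    ι-sum : ∀ {m} (t : Fin m → 𝔽.Carrier) → ι (𝔽.sum t) ≡ sum (ι ∘ t)
    ι-sum {zero}  t = ι-0
    ι-sum {suc m} t = trans (ι-+ _ _) (cong (λ z → ι (t zero) + z) (ι-sum (t ∘ suc)))

    form-expansion : ∀ x y → form x y ≡ 𝔽.sum (λ i → 𝔽.sum (λ j → Vec.lookup x i 𝔽.* G i j 𝔽.* Vec.lookup y j))
    form-expansion x y = trans
      (linear-expansion F (λ x → form x y) (λ x x′ → additiveˡ x x′ y) (λ c x → homogeneousˡ c x y) x)
      (SemiringSum.sum-cong-≗ 𝔽.semiring {suc r} λ i → trans
        (cong (Vec.lookup x i 𝔽.*_) (linear-expansion F (form (𝕍.basis i)) (additiveʳ _) (λ c → homogeneousʳ c _) y))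
        (trans (SemiringSum.*-distribˡ-sum 𝔽.semiring (Vec.lookup x i) (λ j → Vec.lookup y j 𝔽.* G i j))
          (SemiringSum.sum-cong-≗ 𝔽.semiring {suc r} λ j → trans (cong (Vec.lookup x i 𝔽.*_) (𝔽.*-comm (Vec.lookup y j) (G i j)))
            (sym (𝔽.*-assoc (Vec.lookup x i) (G i j) (Vec.lookup y j))))))

  B-ι : ∀ x y → B (ιᵛ x) (ιᵛ y) ≡ ι (form x y)
  B-ι x y = sym (begin
    ι (form x y)
      ≡⟨ cong ι (form-expansion x y) ⟩
    ι (𝔽.sum (λ i → 𝔽.sum (λ j → Vec.lookup x i 𝔽.* G i j 𝔽.* Vec.lookup y j)))
      ≡⟨ trans (ι-sum (λ i → 𝔽.sum (λ j → Vec.lookup x i 𝔽.* G i j 𝔽.* Vec.lookup y j)))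
           (Sum.sum-cong-≗ {suc r} λ i → ι-sum (λ j → Vec.lookup x i 𝔽.* G i j 𝔽.* Vec.lookup y j)) ⟩
    sum (λ i → sum (λ j → ι (Vec.lookup x i 𝔽.* G i j 𝔽.* Vec.lookup y j)))
      ≡⟨ (Sum.sum-cong-≗ {suc r} λ i → Sum.sum-cong-≗ {suc r} λ j → trans (ι-* (Vec.lookup x i 𝔽.* G i j) (Vec.lookup y j)) (cong₂ _*_
           (trans (ι-* (Vec.lookup x i) (G i j)) (cong (_* ι (G i j)) (sym (Vec.lookup-map i ι x)))) (sym (Vec.lookup-map j ι y)))) ⟩
    B (ιᵛ x) (ιᵛ y)  ∎)
    where open ≡-Reasoning

  B-linearˡ : ∀ z → Linear (λ x → B x z)
  B-linearˡ z = record
    { additive    = λ x y → trans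
        (Sum.sum-cong-≗ {suc r} λ i → trans
          (Sum.sum-cong-≗ {suc r} λ j → trans (cong (λ s → s * g i j * Vec.lookup z j) (Vec.lookup-zipWith _+_ i x y))
            (solve 4 (λ a b c d → (a :+ b) :* c :* d := a :* c :* d :+ b :* c :* d) refl
              (Vec.lookup x i) (Vec.lookup y i) (g i j) (Vec.lookup z j)))
          (Sum.∑-distrib-+ (term x i) (term y i)))
        (Sum.∑-distrib-+ (λ i → sum (term x i)) (λ i → sum (term y i)))
    ; homogeneous = λ c x → trans
        (Sum.sum-cong-≗ {suc r} λ i → trans
          (Sum.sum-cong-≗ {suc r} λ j → trans (cong (λ s → s * g i j * Vec.lookup z j) (Vec.lookup-map i (c *_) x))
            (solve 4 (λ a b c d → a :* b :* c :* d := a :* (b :* c :* d)) refl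
              c (Vec.lookup x i) (g i j) (Vec.lookup z j)))
          (sym (Sum.*-distribˡ-sum c (term x i))))
        (sym (Sum.*-distribˡ-sum c (λ i → sum (term x i))))
    }
    where
    g : Fin (suc r) → Fin (suc r) → Carrier
    g i j = ι (G i j)
    term : V → Fin (suc r) → Fin (suc r) → Carrier
    term x i j = Vec.lookup x i * g i j * Vec.lookup z j

  B-linearʳ : ∀ x → Linear (B x)
  B-linearʳ x = record
    { additive    = λ y z → trans
        (Sum.sum-cong-≗ {suc r} λ i → trans
          (Sum.sum-cong-≗ {suc r} λ j → trans (cong (c i j *_) (Vec.lookup-zipWith _+_ j y z)) (distribˡ (c i j) (Vec.lookup y j) (Vec.lookup z j)))
          (Sum.∑-distrib-+ (term y i) (term z i)))
        (Sum.∑-distrib-+ (λ i → sum (term y i)) (λ i → sum (term z i)))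
    ; homogeneous = λ d y → trans
        (Sum.sum-cong-≗ {suc r} λ i → trans
          (Sum.sum-cong-≗ {suc r} λ j → trans (cong (c i j *_) (Vec.lookup-map j (d *_) y))
            (solve 3 (λ a b c → a :* (b :* c) := b :* (a :* c)) refl (c i j) d (Vec.lookup y j)))
          (sym (Sum.*-distribˡ-sum d (term y i))))
        (sym (Sum.*-distribˡ-sum d (λ i → sum (term y i))))
    }
    where
    c : Fin (suc r) → Fin (suc r) → Carrier
    c i j = Vec.lookup x i * ι (G i j)
    term : V → Fin (suc r) → Fin (suc r) → Carrier
    term y i j = c i j * Vec.lookup y j

  -- The sesquilinear form of ℋ: linear on the left and, through `τ`, semilinear on the right. The
  -- vectors of x^⊥ʰ are the zeros of y ↦ ⟪ y , x ⟫.
  ⟪_,_⟫ : V → V → Carrier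
  ⟪ y , x ⟫ = B y (τ x)

  ⟪⟫-linear : ∀ x → Linear (λ y → ⟪ y , x ⟫)
  ⟪⟫-linear x = B-linearˡ (τ x)

  ⟪ι,+ω⟫ : ∀ a u v → ⟪ ιᵛ a , u +ω v ⟫ ≡ ι (form a u) + ω̄ * ι (form a v)
  ⟪ι,+ω⟫ a u v = begin
    B (ιᵛ a) (τ (u +ω v))                     ≡⟨ cong (B (ιᵛ a)) (τ-pair u v) ⟩
    B (ιᵛ a) (ιᵛ u +ᵛ ω̄ · ιᵛ v)               ≡⟨ Linear.additive (B-linearʳ (ιᵛ a)) (ιᵛ u) (ω̄ · ιᵛ v) ⟩
    B (ιᵛ a) (ιᵛ u) + B (ιᵛ a) (ω̄ · ιᵛ v)     ≡⟨ cong₂ _+_ (B-ι a u) (trans (Linear.homogeneous (B-linearʳ (ιᵛ a)) ω̄ (ιᵛ v)) (cong (ω̄ *_) (B-ι a v))) ⟩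
    ι (form a u) + ω̄ * ι (form a v)           ∎
    where open ≡-Reasoning

  ⟪+ω,+ω⟫ : ∀ a c u v → ⟪ a +ω c , u +ω v ⟫ ≡
            (ι (form a u) + ω̄ * ι (form a v)) + ω * (ι (form c u) + ω̄ * ι (form c v))
  ⟪+ω,+ω⟫ a c u v = trans (Linear.additive (⟪⟫-linear (u +ω v)) (ιᵛ a) (ω · ιᵛ c))
    (cong₂ _+_ (⟪ι,+ω⟫ a u v) (trans (Linear.homogeneous (⟪⟫-linear (u +ω v)) ω (ιᵛ c)) (cong (ω *_) (⟪ι,+ω⟫ c u v))))

  -- Antisymmetry of `form` makes the form skew-Hermitian. The factor -1 does not affect zeros, so
  -- perpendicularity is symmetric.
  ⟪⟫-hermitian : ∀ x y → ⟪ x , y ⟫ ≡ ι (𝔽.- 𝔽.1#) * conj ⟪ y , x ⟫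
  ⟪⟫-hermitian x y = subst₂ (λ x y → ⟪ x , y ⟫ ≡ m * conj ⟪ y , x ⟫) (+ω-surjective x) (+ω-surjective y)
    (begin
      ⟪ u +ω v , a +ω c ⟫
        ≡⟨ ⟪+ω,+ω⟫ u v a c ⟩
      (ι (form u a) + ω̄ * ι (form u c)) + ω * (ι (form v a) + ω̄ * ι (form v c))
        ≡⟨ cong₂ (λ s t → s + ω * t) (cong₂ (λ s t → s + ω̄ * t) (anti a u) (anti c u))
                                     (cong₂ (λ s t → s + ω̄ * t) (anti a v) (anti c v)) ⟩
      (m * ι (form a u) + ω̄ * (m * ι (form c u))) + ω * (m * ι (form a v) + ω̄ * (m * ι (form c v)))
        ≡⟨ solve 7 (λ m w w̄ p q s t → (m :* p :+ w̄ :* (m :* q)) :+ w :* (m :* s :+ w̄ :* (m :* t)) :=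
             m :* ((p :+ w :* s) :+ w̄ :* (q :+ w :* t))) refl
             m ω ω̄ (ι (form a u)) (ι (form c u)) (ι (form a v)) (ι (form c v)) ⟩
      m * ((ι (form a u) + ω * ι (form a v)) + ω̄ * (ι (form c u) + ω * ι (form c v)))
        ≡⟨ cong (m *_) (trans (conj-+ _ _) (cong₂ _+_ (conj-part (form a u) (form a v))
             (trans (conj-* ω _) (cong (ω̄ *_) (conj-part (form c u) (form c v)))))) ⟨
      m * conj ((ι (form a u) + ω̄ * ι (form a v)) + ω * (ι (form c u) + ω̄ * ι (form c v)))
        ≡⟨ cong (λ z → m * conj z) (⟪+ω,+ω⟫ a c u v) ⟨
      m * conj ⟪ a +ω c , u +ω v ⟫  ∎)
    where
    open ≡-Reasoning
    m = ι (𝔽.- 𝔽.1#)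
    u = reᵛ x
    v = imᵛ x
    a = reᵛ y
    c = imᵛ y
    anti : ∀ s t → ι (form t s) ≡ m * ι (form s t)
    anti s t = trans (cong ι (antisymmetric s t)) (ι-* _ _)
    conj-part : ∀ s t → conj (ι s + ω̄ * ι t) ≡ ι s + ω * ι t
    conj-part s t = trans (conj-+ _ _) (cong₂ _+_ (conj-ι s) (trans (conj-* ω̄ _) (cong₂ _*_ conj-ω̄ (conj-ι t))))

  ⟪⟫-symmetric-0 : ∀ x y → ⟪ x , y ⟫ ≡ 0# → ⟪ y , x ⟫ ≡ 0#
  ⟪⟫-symmetric-0 x y eq = trans (⟪⟫-hermitian y x)
    (trans (cong (ι (𝔽.- 𝔽.1#) *_) (trans (cong conj eq) conj-0)) (zeroʳ _))

  -- 1 and ω̄ are independent over F, so the single equation over K amounts to two over F. Thus x^⊥ʰ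
  -- meets PG(r,q) in ⟨u,v⟩^⊥ and contains the extension of a line exactly if ⟨u,v⟩^⊥ contains the
  -- line.
  ⟪ι,+ω⟫≡0 : ∀ a u v → ⟪ ιᵛ a , u +ω v ⟫ ≡ 0# → form a u ≡ 𝔽.0# × form a v ≡ 𝔽.0#
  ⟪ι,+ω⟫≡0 a u v eq = ι+ω̄ι≡0 (trans (sym (⟪ι,+ω⟫ a u v)) eq)

  ⟪ι,+ω⟫≡0′ : ∀ a u v → form a u ≡ 𝔽.0# → form a v ≡ 𝔽.0# → ⟪ ιᵛ a , u +ω v ⟫ ≡ 0#
  ⟪ι,+ω⟫≡0′ a u v au av = trans (⟪ι,+ω⟫ a u v)
    (trans (cong₂ (λ s t → s + ω̄ * t) (trans (cong ι au) ι-0) (trans (cong ι av) ι-0))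
           (trans (cong (λ z → 0# + z) (zeroʳ ω̄)) (+-identityʳ 0#)))

  ⟪⟫-nondegenerate : ∀ {x} → x ≢ 0ᵛ → ∃ λ y → ⟪ y , x ⟫ ≢ 0#
  ⟪⟫-nondegenerate {x} x≢0 with reᵛ x 𝕍.≟ᵛ 𝕍.0ᵛ | imᵛ x 𝕍.≟ᵛ 𝕍.0ᵛ
  ... | yes re≡0 | yes im≡0 = contradiction
    (trans (sym (+ω-surjective x)) (trans (cong₂ _+ω_ re≡0 im≡0) 0+ω0)) x≢0
  ... | no re≢0  | _        = let a , au≢0 = not-in-radical re≢0 in
    ιᵛ a , λ eq → au≢0 (proj₁ (⟪ι,+ω⟫≡0 a (reᵛ x) (imᵛ x) (trans (cong ⟪ ιᵛ a ,_⟫ (+ω-surjective x)) eq)))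
  ... | yes _    | no im≢0  = let a , av≢0 = not-in-radical im≢0 in
    ιᵛ a , λ eq → av≢0 (proj₂ (⟪ι,+ω⟫≡0 a (reᵛ x) (imᵛ x) (trans (cong ⟪ ιᵛ a ,_⟫ (+ω-surjective x)) eq)))

-- Lines of a cover

module Lines {q : ℕ} (F : FiniteField q) (r : ℕ) where
  open Projective F r
  open LinearAlgebra F r
  open Line using (u; v) renaming (independent to ind)

  infix 4 _≈ₗ_ _≈ₗ?_
  _≈ₗ_ : Line → Line → Set
  _≈ₗ_ = Setoid._≈_ lines

  On-line : Line → V → Set
  On-line ℓ = Span (u ℓ) (v ℓ)

  on-line? : ∀ ℓ w → Dec (On-line ℓ w)
  on-line? ℓ = span? (u ℓ) (v ℓ)

  ≈ₗ⇒⊆ : ∀ {ℓ ℓ′} → ℓ ≈ₗ ℓ′ → ∀ {w} → On-line ℓ w → On-line ℓ′ w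
  ≈ₗ⇒⊆ {ℓ} {ℓ′} ℓ≈ℓ′ {w} w∈ℓ with w ≟ᵛ 0ᵛ
  ... | yes refl = 0∈Span (u ℓ′) (v ℓ′)
  ... | no  w≢0  = Equivalence.to (ℓ≈ℓ′ (w , w≢0)) w∈ℓ

  meet-in-two⇒≈ₗ : ∀ {ℓ ℓ′ u v} → Independent u v → On-line ℓ u → On-line ℓ v →
                   On-line ℓ′ u → On-line ℓ′ v → ℓ ≈ₗ ℓ′
  meet-in-two⇒≈ₗ {ℓ} {ℓ′} uv-ind u∈ℓ v∈ℓ u∈ℓ′ v∈ℓ′ _ = mk⇔
    (λ P∈ℓ  → Span-⊆ u∈ℓ′ v∈ℓ′ (Span-⊇ (ind ℓ) uv-ind u∈ℓ v∈ℓ P∈ℓ))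
    (λ P∈ℓ′ → Span-⊆ u∈ℓ v∈ℓ (Span-⊇ (ind ℓ′) uv-ind u∈ℓ′ v∈ℓ′ P∈ℓ′))

  generators⇒≈ₗ : ∀ {ℓ ℓ′} → On-line ℓ′ (u ℓ) → On-line ℓ′ (v ℓ) → ℓ ≈ₗ ℓ′
  generators⇒≈ₗ {ℓ} {ℓ′} = meet-in-two⇒≈ₗ {ℓ} {ℓ′} (ind ℓ) (u∈Span (u ℓ) (v ℓ)) (v∈Span (u ℓ) (v ℓ))

  _≈ₗ?_ : ∀ ℓ ℓ′ → Dec (ℓ ≈ₗ ℓ′)
  ℓ ≈ₗ? ℓ′ = map′ (λ (u∈ , v∈) → generators⇒≈ₗ {ℓ} {ℓ′} u∈ v∈)
    (λ ℓ≈ℓ′ → ≈ₗ⇒⊆ {ℓ} {ℓ′} ℓ≈ℓ′ (u∈Span (u ℓ) (v ℓ)) , ≈ₗ⇒⊆ {ℓ} {ℓ′} ℓ≈ℓ′ (v∈Span (u ℓ) (v ℓ)))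
    (on-line? ℓ′ (u ℓ) ×-dec on-line? ℓ′ (v ℓ))

module Covers {q : ℕ} (F : FiniteField q) (r : ℕ) (b : SymplecticForm F r)
  {m : ℕ} {ℒ : Pred (Projective.Line F r) 0ℓ} (cover : Symplectic.IsCover F r b m ℒ) where
  open Projective F r
  open LinearAlgebra F r
  open Lines F r
  open Symplectic F r b
  open IsCover cover
  open Line using (u; v) renaming (independent to ind)

  ≈ₗ-sym : ∀ {ℓ ℓ′} → ℓ ≈ₗ ℓ′ → ℓ′ ≈ₗ ℓ
  ≈ₗ-sym {ℓ} {ℓ′} = Setoid.sym lines {ℓ} {ℓ′}

  -- The cover condition lists the m lines of ℒ through the first generator of ℓ, and ℓ belongs to ℒ
  -- exactly if it equals one of them.
  ∈ℒ? : ∀ ℓ → Dec (ℒ ℓ)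
  ∈ℒ? ℓ = map′
    (λ (i , ℓᵢ≈ℓ) → respects {proj₁ (from i)} {ℓ} ℓᵢ≈ℓ (proj₁ (proj₂ (from i))))
    (λ ℓ∈ℒ → let c = ℓ , ℓ∈ℒ , u∈Span (u ℓ) (v ℓ) in to c , strictlyInverseʳ c)
    (Enumeration.any? (Enum-Fin m) λ i → proj₁ (from i) ≈ₗ? ℓ)
    where
    open Inverse (covers (u ℓ , independent-≢0ˡ (ind ℓ))) using (to; from; strictlyInverseʳ)

  private
    ℒ-setoid : Setoid 0ℓ 0ℓ
    ℒ-setoid = On.setoid lines (proj₁ {B = ℒ})

    -- Lines of ℒ are represented by ordered pairs of generators. These pairs can be enumerated,
    -- which makes ℒ finite.
    Generates : V × V → Set
    Generates (u , v) = Σ (Independent u v) λ uv-ind → ℒ ⟨ u , v ⟩[ uv-ind ]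

    generates? : ∀ uv → Dec (Generates uv)
    generates? (u , v) with independent? u v
    ... | no ¬uv-ind = no (¬uv-ind ∘ proj₁)
    ... | yes uv-ind with ∈ℒ? ⟨ u , v ⟩[ uv-ind ]
    ...   | yes ℓ∈ℒ = yes (uv-ind , ℓ∈ℒ)
    -- Another proof of independence yields another `Line` with the same points, so `respects` has
    -- to carry membership across.
    ...   | no  ℓ∉ℒ = no λ (uv-ind′ , ℓ∈ℒ) → ℓ∉ℒ (respects {⟨ u , v ⟩[ uv-ind′ ]} {⟨ u , v ⟩[ uv-ind ]}
      (generators⇒≈ₗ {⟨ u , v ⟩[ uv-ind′ ]} {⟨ u , v ⟩[ uv-ind ]} (u∈Span u v) (v∈Span u v)) ℓ∈ℒ)

    _generates_ : V × V → Σ Line ℒ → Set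
    (u , v) generates (ℓ , _) = Independent u v × On-line ℓ u × On-line ℓ v

    generates⇒Generates : ∀ uv c → uv generates c → Generates uv
    generates⇒Generates (u , v) (ℓ , ℓ∈ℒ) (uv-ind , u∈ , v∈) = uv-ind , respects {ℓ} {⟨ u , v ⟩[ uv-ind ]}
      (≈ₗ-sym {⟨ u , v ⟩[ uv-ind ]} {ℓ} (generators⇒≈ₗ {⟨ u , v ⟩[ uv-ind ]} {ℓ} u∈ v∈)) ℓ∈ℒ

    generated : ∀ uv → Generates uv → Σ Line ℒ
    generated (u , v) (uv-ind , ℓ∈ℒ) = ⟨ u , v ⟩[ uv-ind ] , ℓ∈ℒ

    generates⇒≈ : ∀ uv c → uv generates c → ∀ p → proj₁ (generated uv p) ≈ₗ proj₁ c
    generates⇒≈ (u , v) (ℓ , _) (_ , u∈ , v∈) (uv-ind , _) = generators⇒≈ₗ {⟨ u , v ⟩[ uv-ind ]} {ℓ} u∈ v∈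

    ≈⇒generates : ∀ uv c p → proj₁ (generated uv p) ≈ₗ proj₁ c → uv generates c
    ≈⇒generates (u , v) (ℓ , _) (uv-ind , _) ≈ℓ = uv-ind
      , ≈ₗ⇒⊆ {⟨ u , v ⟩[ uv-ind ]} {ℓ} ≈ℓ (u∈Span u v) , ≈ₗ⇒⊆ {⟨ u , v ⟩[ uv-ind ]} {ℓ} ≈ℓ (v∈Span u v)

    generates-dec : ∀ uv c → Dec (uv generates c)
    generates-dec (u , v) (ℓ , _) = independent? u v ×-dec (on-line? ℓ u ×-dec on-line? ℓ v)

    module ByGenerators = Represented ℒ-setoid (Enum-× Eᵛ Eᵛ) Generates generates? generated
      _generates_ generates-dec generates⇒Generates
      generates⇒≈ ≈⇒generates

  abstract
    ℒ-finite : ∃ λ n → HasSize lines ℒ n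
    ℒ-finite = ByGenerators.finite λ (ℓ , _) →
      (u ℓ , v ℓ) , ind ℓ , u∈Span (u ℓ) (v ℓ) , v∈Span (u ℓ) (v ℓ)

  ∣ℒ∣ : ℕ
  ∣ℒ∣ = proj₁ ℒ-finite

  Eℒ : Enumeration (Fin ∣ℒ∣)
  Eℒ = Enum-Fin ∣ℒ∣

  line : Fin ∣ℒ∣ → Line
  line i = proj₁ (Inverse.from (proj₂ ℒ-finite) i)

  line∈ℒ : ∀ i → ℒ (line i)
  line∈ℒ i = proj₂ (Inverse.from (proj₂ ℒ-finite) i)

  index : ∀ ℓ → ℒ ℓ → Fin ∣ℒ∣
  index ℓ ℓ∈ℒ = Inverse.to (proj₂ ℒ-finite) (ℓ , ℓ∈ℒ)

  line-index : ∀ ℓ ℓ∈ℒ → line (index ℓ ℓ∈ℒ) ≈ₗ ℓ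
  line-index ℓ ℓ∈ℒ = Inverse.strictlyInverseʳ (proj₂ ℒ-finite) (ℓ , ℓ∈ℒ)

  index-unique : ∀ {ℓ} ℓ∈ℒ i → line i ≈ₗ ℓ → i ≡ index ℓ ℓ∈ℒ
  index-unique {ℓ} ℓ∈ℒ i ℓᵢ≈ℓ = trans (sym (Inverse.strictlyInverseˡ (proj₂ ℒ-finite) i))
    (Inverse.to-cong (proj₂ ℒ-finite) {line i , line∈ℒ i} {ℓ , ℓ∈ℒ} ℓᵢ≈ℓ)

  -- Turns sizes of parts of ℒ into sums over the index set of ℒ and back. It serves for the lines
  -- through a point and for the lines inside some ℓ^⊥.
  module SubsetOfℒ (Q : Line → Set) (Q-resp : ∀ ℓ ℓ′ → ℓ ≈ₗ ℓ′ → Q ℓ → Q ℓ′) (Q? : ∀ ℓ → Dec (Q ℓ)) where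
    private
      Member : Set
      Member = Σ Line λ ℓ → ℒ ℓ × Q ℓ

      member : ∀ i → Q (line i) → Member
      member i q = line i , line∈ℒ i , q

      _indexes_ : Fin ∣ℒ∣ → Member → Set
      i indexes (ℓ , _) = line i ≈ₗ ℓ

      indexes⇒Q : ∀ i c → i indexes c → Q (line i)
      indexes⇒Q i (ℓ , _ , q) ℓᵢ≈ℓ = Q-resp ℓ (line i) (≈ₗ-sym {line i} {ℓ} ℓᵢ≈ℓ) q

      module ByIndex = Represented (On.setoid lines (proj₁ {B = λ ℓ → ℒ ℓ × Q ℓ})) Eℒ (Q ∘ line) (Q? ∘ line)
        member _indexes_ (λ i c → line i ≈ₗ? proj₁ c) indexes⇒Q
        (λ _ _ ℓᵢ≈ℓ _ → ℓᵢ≈ℓ) (λ _ _ _ ℓᵢ≈ℓ → ℓᵢ≈ℓ)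

      one : (c : Member) → ∑ Eℒ (λ i → ⟦ line i ≈ₗ? proj₁ c ⟧) ≡ 1ℤ
      one (ℓ , ℓ∈ℒ , _) = ∑-unique Eℒ (λ i → line i ≈ₗ? ℓ) (index ℓ ℓ∈ℒ) (line-index ℓ ℓ∈ℒ) (index-unique ℓ∈ℒ)

    HasSize⇒∑ : ∀ {n} → HasSize lines (λ ℓ → ℒ ℓ × Q ℓ) n → ∑ Eℒ (λ i → ⟦ Q? (line i) ⟧) ≡ + n
    HasSize⇒∑ {n} size = trans (ByIndex.size⇒∑ one size) (ℤ.*-identityʳ (+ n))

    ∑⇒HasSize : ∀ {n} → ∑ Eℒ (λ i → ⟦ Q? (line i) ⟧) ≡ + n → HasSize lines (λ ℓ → ℒ ℓ × Q ℓ) n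
    ∑⇒HasSize {n} eq = ByIndex.∑⇒size one (trans eq (sym (ℤ.*-identityʳ (+ n))))

  ∑-lines-through : ∀ {w} → w ≢ 0ᵛ → ∑ Eℒ (λ i → ⟦ on-line? (line i) w ⟧) ≡ + m
  ∑-lines-through {w} w≢0 = SubsetOfℒ.HasSize⇒∑ (λ ℓ → On-line ℓ w)
    (λ ℓ ℓ′ ℓ≈ℓ′ → ≈ₗ⇒⊆ {ℓ} {ℓ′} ℓ≈ℓ′) (λ ℓ → on-line? ℓ w) (covers (w , w≢0))

  line-through : ∀ {w} → w ≢ 0ᵛ → ∃ λ i → On-line (line i) w
  line-through {w} w≢0 with Enumeration.any? Eℒ (λ i → on-line? (line i) w)
  ... | yes found = found
  ... | no  none  = contradiction
    (ℤ.+-injective (trans (sym (∑-lines-through w≢0)) (∑-none Eℒ (λ i → on-line? (line i) w) λ i w∈ → none (i , w∈))))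
    (ℕ.>⇒≢ positive)

-- Incidences with extended lines

module Counting {q : ℕ} (q-pp : IsPrimePower q)
  (F : FiniteField q) (K : FiniteField (q ℕ.^ 2)) (ext : Extension F K)
  (r : ℕ) (b : SymplecticForm F r)
  {m : ℕ} {ℒ : Pred (Projective.Line F r) 0ℓ} (cover : Symplectic.IsCover F r b m ℒ) where
  open HermitianLemmas q-pp F K ext r b
  open QuadraticExtension q-pp F K ext
  open Lines F r
  open Covers F r b cover
  open FiniteField K
  open Projective K r
  open LinearAlgebra K r
  open SymplecticLemmas F r b
  open 𝕍.Line using (u; v) renaming (independent to ind)

  uᵢ vᵢ : Fin ∣ℒ∣ → V
  uᵢ i = ιᵛ (u (line i))
  vᵢ i = ιᵛ (v (line i))

  on-extended? : ∀ i y → Dec (Span (uᵢ i) (vᵢ i) y)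
  on-extended? i = span? (uᵢ i) (vᵢ i)

  -- The cone of nonzero vectors over the point set ℒ̄.
  InX : V → Set
  InX y = y ≢ 0ᵛ × ∃ λ i → Span (uᵢ i) (vᵢ i) y

  inX? : ∀ y → Dec (InX y)
  inX? y = ¬? (y ≟ᵛ 0ᵛ) ×-dec Enumeration.any? Eℒ λ i → on-extended? i y

  𝟙ˣ : V → ℤ
  𝟙ˣ y = ⟦ inX? y ⟧

  InX-· : ∀ {c y} → c ≢ 0# → InX y → InX (c · y)
  InX-· {c} c≢0 (y≢0 , i , y∈) = ·-≢0 c≢0 y≢0 , i , Span-· c y∈

  -- The indicator of the nonzero multiples u + ω v of vectors of F-space.
  subgeometry : 𝕍.V → 𝕍.V → ℤ
  subgeometry u v = ⟦ ¬? (u 𝕍.≟ᵛ 𝕍.0ᵛ) ⟧ ℤ.* ∑ 𝔽.E (λ c → ⟦ v 𝕍.≟ᵛ c 𝕍.· u ⟧)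
                ℤ.+ ⟦ u 𝕍.≟ᵛ 𝕍.0ᵛ ⟧ ℤ.* ⟦ ¬? (v 𝕍.≟ᵛ 𝕍.0ᵛ) ⟧

  +ω≡0⇒ : ∀ {u v} → u +ω v ≡ 0ᵛ → u ≡ 𝕍.0ᵛ × v ≡ 𝕍.0ᵛ
  +ω≡0⇒ eq = +ω-injective (trans eq (sym 0+ω0))

  private
    inX : ∀ {u v} i → u ≢ 𝕍.0ᵛ ⊎ v ≢ 𝕍.0ᵛ → On-line (line i) u → On-line (line i) v → InX (u +ω v)
    inX i (inj₁ u≢0) u∈ v∈ = u≢0 ∘ proj₁ ∘ +ω≡0⇒ , i , Span-ι⇐ u∈ v∈
    inX i (inj₂ v≢0) u∈ v∈ = v≢0 ∘ proj₂ ∘ +ω≡0⇒ , i , Span-ι⇐ u∈ v∈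

    multiplicity : 𝕍.V → 𝕍.V → ℤ
    multiplicity u v = ∑ Eℒ (λ i → ⟦ on-extended? i (u +ω v) ⟧)

    -- Here w is a nonzero vector of the point spanned by u and v. An extended line contains u + ω v
    -- exactly if the line contains w, which holds for m lines; m > 0 then puts u + ω v into the
    -- cone.
    multiplicity-real : ∀ {u v} w → w ≢ 𝕍.0ᵛ → u ≢ 𝕍.0ᵛ ⊎ v ≢ 𝕍.0ᵛ →
      (∀ {ℓ} → On-line ℓ w → On-line ℓ u × On-line ℓ v) →
      (∀ {ℓ} → On-line ℓ u → On-line ℓ v → On-line ℓ w) →
      multiplicity u v ≡ + m × 𝟙ˣ (u +ω v) ≡ 1ℤ
    multiplicity-real {u} {v} w w≢0 uv≢0 w⇒uv uv⇒w =
      trans (∑-cong Eℒ λ i → ⟦⟧-cong (on-extended? i (u +ω v)) (on-line? (line i) w)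
          (λ y∈ → let u∈ , v∈ = Span-ι⇒ {u = u} {v} y∈ in uv⇒w {line i} u∈ v∈)
          (λ w∈ → let u∈ , v∈ = w⇒uv {line i} w∈ in Span-ι⇐ u∈ v∈))
        (∑-lines-through w≢0)
      , (let i , w∈ = line-through w≢0; u∈ , v∈ = w⇒uv {line i} w∈ in
         ⟦⟧-true (inX? (u +ω v)) (inX i uv≢0 u∈ v∈))

    -- A line whose extension contains u + ω v contains the independent vectors u and v, so there is
    -- at most one such line.
    multiplicity-imaginary : ∀ {u v} → 𝕍.Independent u v → multiplicity u v ≡ 𝟙ˣ (u +ω v)
    multiplicity-imaginary {u} {v} uv-ind = go (inX? (u +ω v))
      where
      go : (d : Dec (InX (u +ω v))) → multiplicity u v ≡ ⟦ d ⟧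
      go (no ∉X) = ∑-none Eℒ (λ i → on-extended? i (u +ω v)) λ i y∈ → ∉X
        (𝕍.independent-≢0ˡ uv-ind ∘ proj₁ ∘ +ω≡0⇒ , i , y∈)
      go (yes (_ , i , y∈)) = ∑-unique Eℒ (λ j → on-extended? j (u +ω v)) i y∈ λ j y∈′ →
        let u∈ , v∈ = Span-ι⇒ {u = u} {v} y∈; u∈′ , v∈′ = Span-ι⇒ {u = u} {v} y∈′ in
        trans (index-unique (line∈ℒ i) j (meet-in-two⇒≈ₗ {line j} {line i} uv-ind u∈′ v∈′ u∈ v∈))
              (sym (index-unique (line∈ℒ i) i (Setoid.refl 𝕍.lines {line i})))

    ∑-multiples : ∀ {u} c → u ≢ 𝕍.0ᵛ → ∑ 𝔽.E (λ c′ → ⟦ c 𝕍.· u 𝕍.≟ᵛ c′ 𝕍.· u ⟧) ≡ 1ℤ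
    ∑-multiples {u} c u≢0 = ∑-unique 𝔽.E (λ c′ → c 𝕍.· u 𝕍.≟ᵛ c′ 𝕍.· u) c refl
      λ c′ eq → 𝕍.·-cancelʳ u≢0 (sym eq)

    Decomposition : 𝕍.V → 𝕍.V → ℤ → ℤ → ℤ → ℤ → Set
    Decomposition u v μ s z z′ = μ ≡ 𝟙ˣ (u +ω v) ℤ.+ (+ m ℤ.- 1ℤ) ℤ.* s ℤ.+ + ∣ℒ∣ ℤ.* (z ℤ.* z′)

  -- The number of extended lines on a vector exceeds the indicator of the cone in two cases only:
  -- by m - 1 at the points of PG(r,q), and by |ℒ| at the zero vector, which lies on all lines.
  multiplicity-decomposition : ∀ u v →
    ∑ Eℒ (λ i → ⟦ on-extended? i (u +ω v) ⟧) ≡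
    𝟙ˣ (u +ω v) ℤ.+ (+ m ℤ.- 1ℤ) ℤ.* subgeometry u v ℤ.+ + ∣ℒ∣ ℤ.* (⟦ u 𝕍.≟ᵛ 𝕍.0ᵛ ⟧ ℤ.* ⟦ v 𝕍.≟ᵛ 𝕍.0ᵛ ⟧)
  multiplicity-decomposition u v = go (u 𝕍.≟ᵛ 𝕍.0ᵛ) (v 𝕍.≟ᵛ 𝕍.0ᵛ)
    where
    arith₁ : ∀ m l s → m ≡ 1ℤ ℤ.+ (m ℤ.- 1ℤ) ℤ.* (0ℤ ℤ.* s ℤ.+ 1ℤ ℤ.* 1ℤ) ℤ.+ l ℤ.* (1ℤ ℤ.* 0ℤ)
    arith₁ = ℤSolver.solve-∀
    arith₂ : ∀ m l z → m ≡ 1ℤ ℤ.+ (m ℤ.- 1ℤ) ℤ.* (1ℤ ℤ.* 1ℤ ℤ.+ 0ℤ ℤ.* (1ℤ ℤ.- z)) ℤ.+ l ℤ.* (0ℤ ℤ.* z)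
    arith₂ = ℤSolver.solve-∀
    arith₃ : ∀ m l z x → x ≡ x ℤ.+ (m ℤ.- 1ℤ) ℤ.* (1ℤ ℤ.* 0ℤ ℤ.+ 0ℤ ℤ.* (1ℤ ℤ.- z)) ℤ.+ l ℤ.* (0ℤ ℤ.* z)
    arith₃ = ℤSolver.solve-∀
    arith₄ : ∀ m l s → l ≡ 0ℤ ℤ.+ (m ℤ.- 1ℤ) ℤ.* (0ℤ ℤ.* s ℤ.+ 1ℤ ℤ.* 0ℤ) ℤ.+ l ℤ.* (1ℤ ℤ.* 1ℤ)
    arith₄ = ℤSolver.solve-∀

    go : (d : Dec (u ≡ 𝕍.0ᵛ)) (e : Dec (v ≡ 𝕍.0ᵛ)) →
      Decomposition u v (multiplicity u v)
        (⟦ ¬? d ⟧ ℤ.* ∑ 𝔽.E (λ c → ⟦ v 𝕍.≟ᵛ c 𝕍.· u ⟧) ℤ.+ ⟦ d ⟧ ℤ.* ⟦ ¬? e ⟧) ⟦ d ⟧ ⟦ e ⟧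
    go (yes refl) (yes refl) =
      trans (∑-cong Eℒ λ i → ⟦⟧-true (on-extended? i (u +ω v))
              (Span-ι⇐ (𝕍.0∈Span _ _) (𝕍.0∈Span _ _)))
        (trans (trans (∑-Fin ∣ℒ∣ 1ℤ) (ℤ.*-identityʳ (+ ∣ℒ∣)))
          (trans (arith₄ (+ m) (+ ∣ℒ∣) (∑ 𝔽.E (λ c → ⟦ v 𝕍.≟ᵛ c 𝕍.· u ⟧)))
            (cong (λ z → z ℤ.+ (+ m ℤ.- 1ℤ) ℤ.* (0ℤ ℤ.* ∑ 𝔽.E (λ c → ⟦ v 𝕍.≟ᵛ c 𝕍.· u ⟧) ℤ.+ 1ℤ ℤ.* 0ℤ)
                         ℤ.+ + ∣ℒ∣ ℤ.* (1ℤ ℤ.* 1ℤ))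
              (sym (⟦⟧-false (inX? (u +ω v)) λ (y≢0 , _) → y≢0 0+ω0)))))
    go (yes refl) (no v≢0) =
      let eq , 1X = multiplicity-real {u} {v} v v≢0 (inj₂ v≢0)
                      (λ v∈ → 𝕍.0∈Span _ _ , v∈) (λ _ v∈ → v∈) in
      trans eq (trans (arith₁ (+ m) (+ ∣ℒ∣) (∑ 𝔽.E (λ c → ⟦ v 𝕍.≟ᵛ c 𝕍.· u ⟧)))
        (cong (λ z → z ℤ.+ (+ m ℤ.- 1ℤ) ℤ.* (0ℤ ℤ.* ∑ 𝔽.E (λ c → ⟦ v 𝕍.≟ᵛ c 𝕍.· u ⟧) ℤ.+ 1ℤ ℤ.* 1ℤ)
                     ℤ.+ + ∣ℒ∣ ℤ.* (1ℤ ℤ.* 0ℤ)) (sym 1X)))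
    go (no u≢0) e with Enumeration.any? 𝔽.E (λ c → v 𝕍.≟ᵛ c 𝕍.· u)
    ... | yes (c , refl) =
      let eq , 1X = multiplicity-real {u} {v} u u≢0 (inj₁ u≢0)
                      (λ u∈ → u∈ , 𝕍.Span-· c u∈) (λ u∈ _ → u∈) in
      trans eq (trans (arith₂ (+ m) (+ ∣ℒ∣) ⟦ e ⟧)
        (cong₂ (λ x s → x ℤ.+ (+ m ℤ.- 1ℤ) ℤ.* s ℤ.+ + ∣ℒ∣ ℤ.* (0ℤ ℤ.* ⟦ e ⟧)) (sym 1X)
          (cong₂ (λ s n → 1ℤ ℤ.* s ℤ.+ 0ℤ ℤ.* n) (sym (∑-multiples c u≢0)) (sym (⟦⟧-¬ e)))))
    ... | no ∄c =
      let uv-ind = 𝕍.independent u≢0 λ c v≡cu → ∄c (c , v≡cu) in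
      trans (multiplicity-imaginary uv-ind) (trans (arith₃ (+ m) (+ ∣ℒ∣) ⟦ e ⟧ (𝟙ˣ (u +ω v)))
        (cong (λ s → 𝟙ˣ (u +ω v) ℤ.+ (+ m ℤ.- 1ℤ) ℤ.* s ℤ.+ + ∣ℒ∣ ℤ.* (0ℤ ℤ.* ⟦ e ⟧))
          (cong₂ (λ s n → 1ℤ ℤ.* s ℤ.+ 0ℤ ℤ.* n)
            (sym (∑-none 𝔽.E (λ c → v 𝕍.≟ᵛ c 𝕍.· u) λ c eq → ∄c (c , eq))) (sym (⟦⟧-¬ e)))))

module _ (E : Enumeration A) (E′ : Enumeration A′) where
  ∑∑-linear : ∀ c d (f g h : A → A′ → ℤ) →
    ∑ E (λ x → ∑ E′ (λ y → f x y ℤ.+ c ℤ.* g x y ℤ.+ d ℤ.* h x y)) ≡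
    ∑ E (λ x → ∑ E′ (f x)) ℤ.+ c ℤ.* ∑ E (λ x → ∑ E′ (g x)) ℤ.+ d ℤ.* ∑ E (λ x → ∑ E′ (h x))
  ∑∑-linear c d f g h = trans
    (∑-cong E λ x → linear E′ (f x) (g x) (h x))
    (linear E (λ x → ∑ E′ (f x)) (λ x → ∑ E′ (g x)) (λ x → ∑ E′ (h x)))
    where
    linear : ∀ {A} (E : Enumeration A) (f g h : A → ℤ) →
      ∑ E (λ x → f x ℤ.+ c ℤ.* g x ℤ.+ d ℤ.* h x) ≡ ∑ E f ℤ.+ c ℤ.* ∑ E g ℤ.+ d ℤ.* ∑ E h
    linear E f g h = trans (∑-+ E (λ x → f x ℤ.+ c ℤ.* g x) (λ x → d ℤ.* h x))
      (cong₂ ℤ._+_ (trans (∑-+ E f (λ x → c ℤ.* g x)) (cong (λ z → ∑ E f ℤ.+ z) (∑-*ˡ E c g))) (∑-*ˡ E d h))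

∑-≢ : (E : Enumeration A) → ∀ a f →
      ∑ E (λ x → ⟦ ¬? (Enumeration._≟_ E x a) ⟧ ℤ.* f x) ≡ ∑ E f ℤ.- f a
∑-≢ E a f = begin
  ∑ E (λ x → ⟦ ¬? (x ≟ a) ⟧ ℤ.* f x)
    ≡⟨ ∑-cong E (λ x → trans (cong (ℤ._* f x) (⟦⟧-¬ (x ≟ a))) (arith ⟦ x ≟ a ⟧ (f x))) ⟩
  ∑ E (λ x → f x ℤ.- ⟦ x ≟ a ⟧ ℤ.* f x)
    ≡⟨ ∑-minus E f (λ x → ⟦ x ≟ a ⟧ ℤ.* f x) ⟩
  ∑ E f ℤ.- ∑ E (λ x → ⟦ x ≟ a ⟧ ℤ.* f x)
    ≡⟨ cong (λ z → ∑ E f ℤ.- z) (∑-δ E a f) ⟩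
  ∑ E f ℤ.- f a  ∎
  where
  open ≡-Reasoning
  open Enumeration E using (_≟_)
  arith : ∀ d x → (1ℤ ℤ.- d) ℤ.* x ≡ x ℤ.- d ℤ.* x
  arith = ℤSolver.solve-∀

-- Points and lines in perpendicular spaces

module PerpCounts {q : ℕ} (q-pp : IsPrimePower q)
  (F : FiniteField q) (K : FiniteField (q ℕ.^ 2)) (ext : Extension F K)
  (r : ℕ) (b : SymplecticForm F r)
  {m : ℕ} {ℒ : Pred (Projective.Line F r) 0ℓ} (cover : Symplectic.IsCover F r b m ℒ) where
  open Counting q-pp F K ext r b cover
  open HermitianLemmas q-pp F K ext r b
  open QuadraticExtension q-pp F K ext
  open Lines F r
  open Covers F r b cover
  open FiniteField K
  open Field K
  open Extension ext
  open Projective K r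
  open LinearAlgebra K r
  open LinearCounts K r
  open SymplecticForm b
  open SymplecticLemmas F r b
  open 𝕍.Line using (u; v) renaming (independent to ind)
  private
    module 𝔽C = LinearCounts F r

    q′ Q′ L′ m′ : ℤ
    q′ = + q
    Q′ = + (q ℕ.^ 2)
    L′ = + ∣ℒ∣
    m′ = + m

  nonzero : 𝕍.V → ℤ
  nonzero w = ⟦ ¬? (w 𝕍.≟ᵛ 𝕍.0ᵛ) ⟧

  module _ (φ : V → ℤ) (φ-· : ∀ {κ} y → κ ≢ 0# → φ (κ · y) ≡ φ y) where
    private
      ιᵛ-· : ∀ c u → ιᵛ (c 𝕍.· u) ≡ ι c · ιᵛ u
      ιᵛ-· c u = trans (sym (Vec.map-∘ ι (c 𝔽.*_) u))
        (trans (Vec.map-cong (ι-* c) u) (Vec.map-∘ (ι c *_) ι u))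

      φ-multiple : ∀ u c → φ (u +ω (c 𝕍.· u)) ≡ φ (ιᵛ u)
      φ-multiple u c = trans (cong φ multiple) (φ-· (ιᵛ u) λ κ≡0 →
        𝔽.0≢1 (sym (proj₁ (ι+ωι≡0 (trans (cong (_+ ω * ι c) ι-1) κ≡0)))))
        where
        multiple : u +ω (c 𝕍.· u) ≡ (1# + ω * ι c) · ιᵛ u
        multiple = sym (trans (·-distribʳ 1# (ω * ι c) (ιᵛ u)) (cong₂ _+ᵛ_ (·-identity (ιᵛ u))
          (trans (sym (·-assoc ω (ι c) (ιᵛ u))) (cong (ω ·_) (sym (ιᵛ-· c u))))))

      φ-ω : ∀ v → φ (𝕍.0ᵛ +ω v) ≡ φ (ιᵛ v)
      φ-ω v = trans (cong φ (trans (cong (_+ᵛ ω · ιᵛ v) ιᵛ-0) (+ᵛ-identityˡ (ω · ιᵛ v))))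
        (φ-· (ιᵛ v) λ ω≡0 → 𝔽.0≢1 (sym (proj₂ (ι+ωι≡0
          (trans (cong₂ _+_ ι-0 (trans (cong (_* ι 𝔽.1#) ω≡0) (zeroˡ _))) (+-identityʳ 0#))))))
        where
        ιᵛ-0 : ιᵛ 𝕍.0ᵛ ≡ 0ᵛ
        ιᵛ-0 = trans (Vec.map-replicate ι 𝔽.0# (suc r)) (cong (Vec.replicate (suc r)) ι-0)

    -- As φ ignores nonzero scalars, only the q + 1 = (q² - 1)/(q - 1) classes of nonzero scalars of
    -- K modulo those of F matter. Their representatives are 1 + ω c with c in F, which give u + ω c
    -- u, and ω, which gives 0 + ω v.
    ∑-subgeometry : ∑ 𝕍.Eᵛ (λ u → ∑ 𝕍.Eᵛ (λ v → subgeometry u v ℤ.* φ (u +ω v))) ≡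
                    (q′ ℤ.+ 1ℤ) ℤ.* ∑ 𝕍.Eᵛ (λ w → nonzero w ℤ.* φ (ιᵛ w))
    ∑-subgeometry = begin
      ∑ 𝕍.Eᵛ (λ u → ∑ 𝕍.Eᵛ (λ v → subgeometry u v ℤ.* φ (u +ω v)))
        ≡⟨ ∑-cong 𝕍.Eᵛ split ⟩
      ∑ 𝕍.Eᵛ (λ u → nonzero u ℤ.* multiples u ℤ.+ ⟦ u 𝕍.≟ᵛ 𝕍.0ᵛ ⟧ ℤ.* rest u)
        ≡⟨ ∑-+ 𝕍.Eᵛ (λ u → nonzero u ℤ.* multiples u) (λ u → ⟦ u 𝕍.≟ᵛ 𝕍.0ᵛ ⟧ ℤ.* rest u) ⟩
      ∑ 𝕍.Eᵛ (λ u → nonzero u ℤ.* multiples u) ℤ.+ ∑ 𝕍.Eᵛ (λ u → ⟦ u 𝕍.≟ᵛ 𝕍.0ᵛ ⟧ ℤ.* rest u)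
        ≡⟨ cong₂ ℤ._+_
             (trans (∑-cong 𝕍.Eᵛ λ u → trans (cong (nonzero u ℤ.*_) (multiples-const u)) (arith₁ (nonzero u) q′ (φ (ιᵛ u))))
                    (∑-*ˡ 𝕍.Eᵛ q′ (λ w → nonzero w ℤ.* φ (ιᵛ w))))
             (trans (∑-δ 𝕍.Eᵛ 𝕍.0ᵛ rest) (∑-cong 𝕍.Eᵛ λ v → cong (nonzero v ℤ.*_) (φ-ω v))) ⟩
      q′ ℤ.* S ℤ.+ S
        ≡⟨ arith₂ q′ S ⟩
      (q′ ℤ.+ 1ℤ) ℤ.* S  ∎
      where
      open ≡-Reasoning
      S = ∑ 𝕍.Eᵛ (λ w → nonzero w ℤ.* φ (ιᵛ w))
      multiples rest : 𝕍.V → ℤ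
      multiples u = ∑ 𝕍.Eᵛ (λ v → ∑ 𝔽.E (λ c → ⟦ v 𝕍.≟ᵛ c 𝕍.· u ⟧) ℤ.* φ (u +ω v))
      rest u      = ∑ 𝕍.Eᵛ (λ v → nonzero v ℤ.* φ (u +ω v))
      arith₁ : ∀ a b c → a ℤ.* (b ℤ.* c) ≡ b ℤ.* (a ℤ.* c)
      arith₁ = ℤSolver.solve-∀
      arith₂ : ∀ q s → q ℤ.* s ℤ.+ s ≡ (q ℤ.+ 1ℤ) ℤ.* s
      arith₂ = ℤSolver.solve-∀
      arith₃ : ∀ a b c d e → (a ℤ.* b ℤ.+ c ℤ.* d) ℤ.* e ≡ a ℤ.* (b ℤ.* e) ℤ.+ c ℤ.* (d ℤ.* e)
      arith₃ = ℤSolver.solve-∀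
      multiples-const : ∀ u → multiples u ≡ q′ ℤ.* φ (ιᵛ u)
      multiples-const u = trans (sym (∑-fibre 𝔽.E 𝕍.Eᵛ (𝕍._· u) (λ v → φ (u +ω v))))
        (trans (∑-cong 𝔽.E (φ-multiple u)) (𝕍.∑E-const (φ (ιᵛ u))))
      split : ∀ u → ∑ 𝕍.Eᵛ (λ v → subgeometry u v ℤ.* φ (u +ω v)) ≡
                    nonzero u ℤ.* multiples u ℤ.+ ⟦ u 𝕍.≟ᵛ 𝕍.0ᵛ ⟧ ℤ.* rest u
      split u = trans (∑-cong 𝕍.Eᵛ λ v → arith₃ (nonzero u) (∑ 𝔽.E (λ c → ⟦ v 𝕍.≟ᵛ c 𝕍.· u ⟧)) ⟦ u 𝕍.≟ᵛ 𝕍.0ᵛ ⟧ (nonzero v) (φ (u +ω v)))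
        (trans (∑-+ 𝕍.Eᵛ (λ v → nonzero u ℤ.* (∑ 𝔽.E (λ c → ⟦ v 𝕍.≟ᵛ c 𝕍.· u ⟧) ℤ.* φ (u +ω v)))
                         (λ v → ⟦ u 𝕍.≟ᵛ 𝕍.0ᵛ ⟧ ℤ.* (nonzero v ℤ.* φ (u +ω v))))
          (cong₂ ℤ._+_ (∑-*ˡ 𝕍.Eᵛ (nonzero u) _) (∑-*ˡ 𝕍.Eᵛ ⟦ u 𝕍.≟ᵛ 𝕍.0ᵛ ⟧ _)))

    -- Sum φ over the incident pairs of an extended line and a vector, once by lines and once by
    -- vectors with their multiplicities. It is applied with φ = 1 and with the indicator of x^⊥ʰ.
    ∑-extended-lines :
      ∑ Eℒ (λ i → ∑ E (λ α → ∑ E (λ β → φ (α · uᵢ i +ᵛ β · vᵢ i)))) ≡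
      ∑ Eᵛ (λ y → 𝟙ˣ y ℤ.* φ y)
        ℤ.+ (m′ ℤ.- 1ℤ) ℤ.* ((q′ ℤ.+ 1ℤ) ℤ.* ∑ 𝕍.Eᵛ (λ w → nonzero w ℤ.* φ (ιᵛ w))) ℤ.+ L′ ℤ.* φ 0ᵛ
    ∑-extended-lines = begin
      ∑ Eℒ (λ i → ∑ E (λ α → ∑ E (λ β → φ (α · uᵢ i +ᵛ β · vᵢ i))))
        ≡⟨ ∑-cong Eℒ (λ i → ∑-span (independent-ι (ind (line i))) φ) ⟩
      ∑ Eℒ (λ i → ∑ Eᵛ (λ y → ⟦ on-extended? i y ⟧ ℤ.* φ y))
        ≡⟨ trans (∑-swap Eℒ Eᵛ _) (∑-cong Eᵛ λ y → ∑-*ʳ Eℒ (φ y) _) ⟩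
      ∑ Eᵛ (λ y → ∑ Eℒ (λ i → ⟦ on-extended? i y ⟧) ℤ.* φ y)
        ≡⟨ ∑-+ω (λ y → ∑ Eℒ (λ i → ⟦ on-extended? i y ⟧) ℤ.* φ y) ⟨
      ∑ 𝕍.Eᵛ (λ u → ∑ 𝕍.Eᵛ (λ v → ∑ Eℒ (λ i → ⟦ on-extended? i (u +ω v) ⟧) ℤ.* φ (u +ω v)))
        ≡⟨ (∑-cong 𝕍.Eᵛ λ u → ∑-cong 𝕍.Eᵛ λ v → trans (cong (ℤ._* φ (u +ω v)) (multiplicity-decomposition u v))
             (arith (𝟙ˣ (u +ω v)) (m′ ℤ.- 1ℤ) (subgeometry u v) L′ ⟦ u 𝕍.≟ᵛ 𝕍.0ᵛ ⟧ ⟦ v 𝕍.≟ᵛ 𝕍.0ᵛ ⟧ (φ (u +ω v)))) ⟩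
      ∑ 𝕍.Eᵛ (λ u → ∑ 𝕍.Eᵛ (λ v → 𝟙ˣ (u +ω v) ℤ.* φ (u +ω v) ℤ.+ (m′ ℤ.- 1ℤ) ℤ.* (subgeometry u v ℤ.* φ (u +ω v))
          ℤ.+ L′ ℤ.* (⟦ u 𝕍.≟ᵛ 𝕍.0ᵛ ⟧ ℤ.* (⟦ v 𝕍.≟ᵛ 𝕍.0ᵛ ⟧ ℤ.* φ (u +ω v)))))
        ≡⟨ ∑∑-linear 𝕍.Eᵛ 𝕍.Eᵛ (m′ ℤ.- 1ℤ) L′ (λ u v → 𝟙ˣ (u +ω v) ℤ.* φ (u +ω v))
             (λ u v → subgeometry u v ℤ.* φ (u +ω v)) (λ u v → ⟦ u 𝕍.≟ᵛ 𝕍.0ᵛ ⟧ ℤ.* (⟦ v 𝕍.≟ᵛ 𝕍.0ᵛ ⟧ ℤ.* φ (u +ω v))) ⟩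
      ∑ 𝕍.Eᵛ (λ u → ∑ 𝕍.Eᵛ (λ v → 𝟙ˣ (u +ω v) ℤ.* φ (u +ω v)))
        ℤ.+ (m′ ℤ.- 1ℤ) ℤ.* ∑ 𝕍.Eᵛ (λ u → ∑ 𝕍.Eᵛ (λ v → subgeometry u v ℤ.* φ (u +ω v)))
        ℤ.+ L′ ℤ.* ∑ 𝕍.Eᵛ (λ u → ∑ 𝕍.Eᵛ (λ v → ⟦ u 𝕍.≟ᵛ 𝕍.0ᵛ ⟧ ℤ.* (⟦ v 𝕍.≟ᵛ 𝕍.0ᵛ ⟧ ℤ.* φ (u +ω v))))
        ≡⟨ cong₂ (λ x z → x ℤ.+ (m′ ℤ.- 1ℤ) ℤ.* ∑ 𝕍.Eᵛ (λ u → ∑ 𝕍.Eᵛ (λ v → subgeometry u v ℤ.* φ (u +ω v))) ℤ.+ L′ ℤ.* z)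
             (∑-+ω (λ y → 𝟙ˣ y ℤ.* φ y)) at-zero ⟩
      ∑ Eᵛ (λ y → 𝟙ˣ y ℤ.* φ y)
        ℤ.+ (m′ ℤ.- 1ℤ) ℤ.* ∑ 𝕍.Eᵛ (λ u → ∑ 𝕍.Eᵛ (λ v → subgeometry u v ℤ.* φ (u +ω v))) ℤ.+ L′ ℤ.* φ 0ᵛ
        ≡⟨ cong (λ z → ∑ Eᵛ (λ y → 𝟙ˣ y ℤ.* φ y) ℤ.+ (m′ ℤ.- 1ℤ) ℤ.* z ℤ.+ L′ ℤ.* φ 0ᵛ) ∑-subgeometry ⟩
      ∑ Eᵛ (λ y → 𝟙ˣ y ℤ.* φ y)
        ℤ.+ (m′ ℤ.- 1ℤ) ℤ.* ((q′ ℤ.+ 1ℤ) ℤ.* ∑ 𝕍.Eᵛ (λ w → nonzero w ℤ.* φ (ιᵛ w))) ℤ.+ L′ ℤ.* φ 0ᵛ  ∎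
      where
      open ≡-Reasoning
      arith : ∀ x c s l z z′ p → (x ℤ.+ c ℤ.* s ℤ.+ l ℤ.* (z ℤ.* z′)) ℤ.* p ≡
              x ℤ.* p ℤ.+ c ℤ.* (s ℤ.* p) ℤ.+ l ℤ.* (z ℤ.* (z′ ℤ.* p))
      arith = ℤSolver.solve-∀
      at-zero : ∑ 𝕍.Eᵛ (λ u → ∑ 𝕍.Eᵛ (λ v → ⟦ u 𝕍.≟ᵛ 𝕍.0ᵛ ⟧ ℤ.* (⟦ v 𝕍.≟ᵛ 𝕍.0ᵛ ⟧ ℤ.* φ (u +ω v)))) ≡ φ 0ᵛ
      at-zero = trans (∑-cong 𝕍.Eᵛ λ u → trans (∑-*ˡ 𝕍.Eᵛ ⟦ u 𝕍.≟ᵛ 𝕍.0ᵛ ⟧ _)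
                        (cong (⟦ u 𝕍.≟ᵛ 𝕍.0ᵛ ⟧ ℤ.*_) (∑-δ 𝕍.Eᵛ 𝕍.0ᵛ (λ v → φ (u +ω v)))))
        (trans (∑-δ 𝕍.Eᵛ 𝕍.0ᵛ (λ u → φ (u +ω 𝕍.0ᵛ))) (cong φ 0+ω0))

  -- The same double count over F: a nonzero vector lies on m lines, the zero vector on all of them.
  ∑-lines : ∀ (ψ : 𝕍.V → ℤ) →
    ∑ Eℒ (λ i → ∑ 𝔽.E (λ a → ∑ 𝔽.E (λ c → ψ (a 𝕍.· u (line i) 𝕍.+ᵛ c 𝕍.· v (line i))))) ≡
    m′ ℤ.* ∑ 𝕍.Eᵛ (λ w → nonzero w ℤ.* ψ w) ℤ.+ L′ ℤ.* ψ 𝕍.0ᵛ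
  ∑-lines ψ = begin
    ∑ Eℒ (λ i → ∑ 𝔽.E (λ a → ∑ 𝔽.E (λ c → ψ (a 𝕍.· u (line i) 𝕍.+ᵛ c 𝕍.· v (line i)))))
      ≡⟨ ∑-cong Eℒ (λ i → 𝕍.∑-span (ind (line i)) ψ) ⟩
    ∑ Eℒ (λ i → ∑ 𝕍.Eᵛ (λ w → ⟦ on-line? (line i) w ⟧ ℤ.* ψ w))
      ≡⟨ trans (∑-swap Eℒ 𝕍.Eᵛ _) (∑-cong 𝕍.Eᵛ λ w → ∑-*ʳ Eℒ (ψ w) _) ⟩
    ∑ 𝕍.Eᵛ (λ w → ∑ Eℒ (λ i → ⟦ on-line? (line i) w ⟧) ℤ.* ψ w)
      ≡⟨ ∑-cong 𝕍.Eᵛ (λ w → trans (cong (ℤ._* ψ w) (through w (w 𝕍.≟ᵛ 𝕍.0ᵛ))) (arith m′ (nonzero w) L′ ⟦ w 𝕍.≟ᵛ 𝕍.0ᵛ ⟧ (ψ w))) ⟩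
    ∑ 𝕍.Eᵛ (λ w → m′ ℤ.* (nonzero w ℤ.* ψ w) ℤ.+ L′ ℤ.* (⟦ w 𝕍.≟ᵛ 𝕍.0ᵛ ⟧ ℤ.* ψ w))
      ≡⟨ ∑-+ 𝕍.Eᵛ (λ w → m′ ℤ.* (nonzero w ℤ.* ψ w)) (λ w → L′ ℤ.* (⟦ w 𝕍.≟ᵛ 𝕍.0ᵛ ⟧ ℤ.* ψ w)) ⟩
    ∑ 𝕍.Eᵛ (λ w → m′ ℤ.* (nonzero w ℤ.* ψ w)) ℤ.+ ∑ 𝕍.Eᵛ (λ w → L′ ℤ.* (⟦ w 𝕍.≟ᵛ 𝕍.0ᵛ ⟧ ℤ.* ψ w))
      ≡⟨ cong₂ ℤ._+_ (∑-*ˡ 𝕍.Eᵛ m′ (λ w → nonzero w ℤ.* ψ w)) (trans (∑-*ˡ 𝕍.Eᵛ L′ (λ w → ⟦ w 𝕍.≟ᵛ 𝕍.0ᵛ ⟧ ℤ.* ψ w))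
           (cong (L′ ℤ.*_) (∑-δ 𝕍.Eᵛ 𝕍.0ᵛ ψ))) ⟩
    m′ ℤ.* ∑ 𝕍.Eᵛ (λ w → nonzero w ℤ.* ψ w) ℤ.+ L′ ℤ.* ψ 𝕍.0ᵛ  ∎
    where
    open ≡-Reasoning
    arith : ∀ m n l z p → (m ℤ.* n ℤ.+ l ℤ.* z) ℤ.* p ≡ m ℤ.* (n ℤ.* p) ℤ.+ l ℤ.* (z ℤ.* p)
    arith = ℤSolver.solve-∀
    arith₀ : ∀ m l → l ≡ m ℤ.* 0ℤ ℤ.+ l ℤ.* 1ℤ
    arith₀ = ℤSolver.solve-∀
    arith₁ : ∀ m l → m ≡ m ℤ.* 1ℤ ℤ.+ l ℤ.* 0ℤ
    arith₁ = ℤSolver.solve-∀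
    through : ∀ w (d : Dec (w ≡ 𝕍.0ᵛ)) → ∑ Eℒ (λ i → ⟦ on-line? (line i) w ⟧) ≡ m′ ℤ.* ⟦ ¬? d ⟧ ℤ.+ L′ ℤ.* ⟦ d ⟧
    through w (yes refl) = trans (trans (∑-cong Eℒ λ i → ⟦⟧-true (on-line? (line i) 𝕍.0ᵛ) (𝕍.0∈Span _ _))
      (trans (∑-Fin ∣ℒ∣ 1ℤ) (ℤ.*-identityʳ L′))) (arith₀ m′ L′)
    through w (no w≢0) = trans (∑-lines-through w≢0) (arith₁ m′ L′)

  Perp : 𝕍.V → 𝕍.V → 𝕍.V → Set
  Perp u v w = form w u ≡ 𝔽.0# × form w v ≡ 𝔽.0#

  perp? : ∀ u v w → Dec (Perp u v w)
  perp? u v w = (form w u 𝔽.≟ 𝔽.0#) ×-dec (form w v 𝔽.≟ 𝔽.0#)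

  lines-in-perp points-in-perp : 𝕍.V → 𝕍.V → ℤ
  lines-in-perp s t  = ∑ Eℒ (λ i → ⟦ perp? s t (u (line i)) ×-dec perp? s t (v (line i)) ⟧)
  points-in-perp s t = ∑ 𝕍.Eᵛ (λ w → nonzero w ℤ.* ⟦ perp? s t w ⟧)

  -- For x ≠ 0 this is q² - 1 times |x^⊥ʰ ∩ ℒ̄|.
  perp-size : V → ℤ
  perp-size x = ∑ Eᵛ (λ y → 𝟙ˣ y ℤ.* ⟦ ⟪ y , x ⟫ ≟ 0# ⟧)

  -- Count the vectors of x^⊥ʰ on the extended lines for x = s + ω t. Such a line has Q² of them if
  -- it lies in x^⊥ʰ, that is, if its line lies in ⟨s,t⟩^⊥, and Q otherwise. The right-hand side is
  -- `∑-extended-lines` for the indicator of x^⊥ʰ.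
  perp-size-formula : ∀ s t → L′ ℤ.* Q′ ℤ.+ (Q′ ℤ.* Q′ ℤ.- Q′) ℤ.* lines-in-perp s t ≡
    perp-size (s +ω t) ℤ.+ (m′ ℤ.- 1ℤ) ℤ.* ((q′ ℤ.+ 1ℤ) ℤ.* points-in-perp s t) ℤ.+ L′
  perp-size-formula s t = begin
    L′ ℤ.* Q′ ℤ.+ (Q′ ℤ.* Q′ ℤ.- Q′) ℤ.* lines-in-perp s t
      ≡⟨ cong₂ ℤ._+_ (∑-Fin ∣ℒ∣ Q′) (∑-*ˡ Eℒ (Q′ ℤ.* Q′ ℤ.- Q′) _) ⟨
    ∑ Eℒ (λ i → Q′) ℤ.+ ∑ Eℒ (λ i → (Q′ ℤ.* Q′ ℤ.- Q′) ℤ.* ⟦ perp? s t (u (line i)) ×-dec perp? s t (v (line i)) ⟧)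
      ≡⟨ ∑-+ Eℒ (λ _ → Q′) (λ i → (Q′ ℤ.* Q′ ℤ.- Q′) ℤ.* ⟦ perp? s t (u (line i)) ×-dec perp? s t (v (line i)) ⟧) ⟨
    ∑ Eℒ (λ i → Q′ ℤ.+ (Q′ ℤ.* Q′ ℤ.- Q′) ℤ.* ⟦ perp? s t (u (line i)) ×-dec perp? s t (v (line i)) ⟧)
      ≡⟨ ∑-cong Eℒ line-count ⟨
    ∑ Eℒ (λ i → ∑ E (λ α → ∑ E (λ β → φ (α · uᵢ i +ᵛ β · vᵢ i))))
      ≡⟨ ∑-extended-lines φ φ-· ⟩
    perp-size x ℤ.+ (m′ ℤ.- 1ℤ) ℤ.* ((q′ ℤ.+ 1ℤ) ℤ.* ∑ 𝕍.Eᵛ (λ w → nonzero w ℤ.* φ (ιᵛ w))) ℤ.+ L′ ℤ.* φ 0ᵛ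
      ≡⟨ cong₂ (λ R z → perp-size x ℤ.+ (m′ ℤ.- 1ℤ) ℤ.* ((q′ ℤ.+ 1ℤ) ℤ.* R) ℤ.+ z)
           (∑-cong 𝕍.Eᵛ λ w → cong (nonzero w ℤ.*_) (⟦⟧-cong (⟪ ιᵛ w , x ⟫ ≟ 0#) (perp? s t w)
             (⟪ι,+ω⟫≡0 w s t) (λ (ws , wt) → ⟪ι,+ω⟫≡0′ w s t ws wt)))
           (trans (cong (L′ ℤ.*_) (⟦⟧-true (⟪ 0ᵛ , x ⟫ ≟ 0#) (Linear.φ[0]≡0 (⟪⟫-linear x)))) (ℤ.*-identityʳ L′)) ⟩
    perp-size x ℤ.+ (m′ ℤ.- 1ℤ) ℤ.* ((q′ ℤ.+ 1ℤ) ℤ.* points-in-perp s t) ℤ.+ L′  ∎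
    where
    open ≡-Reasoning
    x = s +ω t
    φ : V → ℤ
    φ y = ⟦ ⟪ y , x ⟫ ≟ 0# ⟧
    φ-· : ∀ {κ} y → κ ≢ 0# → φ (κ · y) ≡ φ y
    φ-· {κ} y κ≢0 = ⟦⟧-cong (⟪ κ · y , x ⟫ ≟ 0#) (⟪ y , x ⟫ ≟ 0#)
      (λ eq → x*y≡0⇒y≡0 κ≢0 (trans (sym (Linear.homogeneous (⟪⟫-linear x) κ y)) eq))
      (λ eq → trans (Linear.homogeneous (⟪⟫-linear x) κ y) (trans (cong (κ *_) eq) (zeroʳ κ)))
    line-count : ∀ i → ∑ E (λ α → ∑ E (λ β → φ (α · uᵢ i +ᵛ β · vᵢ i))) ≡
      Q′ ℤ.+ (Q′ ℤ.* Q′ ℤ.- Q′) ℤ.* ⟦ perp? s t (u (line i)) ×-dec perp? s t (v (line i)) ⟧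
    line-count i = trans
      (∑-cong E λ α → ∑-cong E λ β → cong (λ z → ⟦ z ≟ 0# ⟧) (Linear.combination (⟪⟫-linear x) α β (uᵢ i) (vᵢ i)))
      (trans (∑-equation ⟪ uᵢ i , x ⟫ ⟪ vᵢ i , x ⟫ ((⟪ uᵢ i , x ⟫ ≟ 0#) ×-dec (⟪ vᵢ i , x ⟫ ≟ 0#)))
        (cong (λ z → Q′ ℤ.+ (Q′ ℤ.* Q′ ℤ.- Q′) ℤ.* z)
          (⟦⟧-cong ((⟪ uᵢ i , x ⟫ ≟ 0#) ×-dec (⟪ vᵢ i , x ⟫ ≟ 0#)) (perp? s t (u (line i)) ×-dec perp? s t (v (line i)))
            (λ (ux , vx) → ⟪ι,+ω⟫≡0 (u (line i)) s t ux , ⟪ι,+ω⟫≡0 (v (line i)) s t vx)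
            (λ ((us , ut) , (vs , vt)) → ⟪ι,+ω⟫≡0′ (u (line i)) s t us ut , ⟪ι,+ω⟫≡0′ (v (line i)) s t vs vt))))

  ∣X∣ : ℤ
  ∣X∣ = ∑ Eᵛ 𝟙ˣ

  private
    qʳ⁺¹ : ℤ
    qʳ⁺¹ = + (q ℕ.^ suc r)

  ∑-nonzero-vectors : ∑ 𝕍.Eᵛ (λ w → nonzero w ℤ.* 1ℤ) ≡ qʳ⁺¹ ℤ.- 1ℤ
  ∑-nonzero-vectors = trans (∑-≢ 𝕍.Eᵛ 𝕍.0ᵛ (λ _ → 1ℤ))
    (cong (ℤ._- 1ℤ) (trans (𝕍.∑Eᵛ-const 1ℤ) (ℤ.*-identityʳ qʳ⁺¹)))

  ∣ℒ∣-formula : L′ ℤ.* (q′ ℤ.* q′) ≡ m′ ℤ.* (qʳ⁺¹ ℤ.- 1ℤ) ℤ.+ L′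
  ∣ℒ∣-formula = begin
    L′ ℤ.* (q′ ℤ.* q′)
      ≡⟨ ∑-Fin ∣ℒ∣ (q′ ℤ.* q′) ⟨
    ∑ Eℒ (λ i → q′ ℤ.* q′)
      ≡⟨ ∑-cong Eℒ (λ i → trans (𝕍.∑E-const _) (cong (q′ ℤ.*_) (trans (𝕍.∑E-const 1ℤ) (ℤ.*-identityʳ q′)))) ⟨
    ∑ Eℒ (λ i → ∑ 𝔽.E (λ a → ∑ 𝔽.E (λ c → 1ℤ)))
      ≡⟨ ∑-lines (λ _ → 1ℤ) ⟩
    m′ ℤ.* ∑ 𝕍.Eᵛ (λ w → nonzero w ℤ.* 1ℤ) ℤ.+ L′ ℤ.* 1ℤ
      ≡⟨ cong₂ (λ x y → m′ ℤ.* x ℤ.+ y) ∑-nonzero-vectors (ℤ.*-identityʳ L′) ⟩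
    m′ ℤ.* (qʳ⁺¹ ℤ.- 1ℤ) ℤ.+ L′  ∎
    where open ≡-Reasoning

  ∣X∣-formula : L′ ℤ.* (Q′ ℤ.* Q′) ≡ ∣X∣ ℤ.+ (m′ ℤ.- 1ℤ) ℤ.* ((q′ ℤ.+ 1ℤ) ℤ.* (qʳ⁺¹ ℤ.- 1ℤ)) ℤ.+ L′
  ∣X∣-formula = begin
    L′ ℤ.* (Q′ ℤ.* Q′)
      ≡⟨ ∑-Fin ∣ℒ∣ (Q′ ℤ.* Q′) ⟨
    ∑ Eℒ (λ i → Q′ ℤ.* Q′)
      ≡⟨ ∑-cong Eℒ (λ i → trans (∑E-const _) (cong (Q′ ℤ.*_) (trans (∑E-const 1ℤ) (ℤ.*-identityʳ Q′)))) ⟨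
    ∑ Eℒ (λ i → ∑ E (λ α → ∑ E (λ β → 1ℤ)))
      ≡⟨ ∑-extended-lines (λ _ → 1ℤ) (λ _ _ → refl) ⟩
    ∑ Eᵛ (λ y → 𝟙ˣ y ℤ.* 1ℤ) ℤ.+ (m′ ℤ.- 1ℤ) ℤ.* ((q′ ℤ.+ 1ℤ) ℤ.* ∑ 𝕍.Eᵛ (λ w → nonzero w ℤ.* 1ℤ)) ℤ.+ L′ ℤ.* 1ℤ
      ≡⟨ cong₂ (λ x y → x ℤ.+ y) (cong₂ (λ x y → x ℤ.+ (m′ ℤ.- 1ℤ) ℤ.* ((q′ ℤ.+ 1ℤ) ℤ.* y))
           (∑-cong Eᵛ λ y → ℤ.*-identityʳ (𝟙ˣ y)) ∑-nonzero-vectors) (ℤ.*-identityʳ L′) ⟩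
    ∣X∣ ℤ.+ (m′ ℤ.- 1ℤ) ℤ.* ((q′ ℤ.+ 1ℤ) ℤ.* (qʳ⁺¹ ℤ.- 1ℤ)) ℤ.+ L′  ∎
    where open ≡-Reasoning

  points-in-perp-∑ : ∀ s t → points-in-perp s t ℤ.+ 1ℤ ≡ ∑ 𝕍.Eᵛ (λ w → ⟦ perp? s t w ⟧)
  points-in-perp-∑ s t = trans (cong (ℤ._+ 1ℤ) (trans (∑-≢ 𝕍.Eᵛ 𝕍.0ᵛ (λ w → ⟦ perp? s t w ⟧))
      (cong (λ z → ∑ 𝕍.Eᵛ (λ w → ⟦ perp? s t w ⟧) ℤ.- z) (⟦⟧-true (perp? s t 𝕍.0ᵛ)
        (𝕍.Linear.φ[0]≡0 (linearˡ s) , 𝕍.Linear.φ[0]≡0 (linearˡ t))))))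
    (arith (∑ 𝕍.Eᵛ (λ w → ⟦ perp? s t w ⟧)))
    where
    arith : ∀ x → x ℤ.- 1ℤ ℤ.+ 1ℤ ≡ x
    arith = ℤSolver.solve-∀

  points-in-perp-line : ∀ {s t} → 𝕍.Independent s t → q′ ℤ.* (q′ ℤ.* (points-in-perp s t ℤ.+ 1ℤ)) ≡ qʳ⁺¹
  points-in-perp-line {s} {t} st-ind = trans
    (cong (λ z → q′ ℤ.* (q′ ℤ.* z)) (trans (points-in-perp-∑ s t)
      (∑-cong 𝕍.Eᵛ λ w → ⟦⟧-× (form w s 𝔽.≟ 𝔽.0#) (form w t 𝔽.≟ 𝔽.0#))))
    (𝔽C.∑-kernel₂ (linearˡ s) (linearˡ t) (not-in-radical (𝕍.independent-≢0ˡ st-ind)) λ c →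
      -- t - c s is nonzero by independence. A vector w that is not perpendicular to it separates
      -- `form w t` from c times `form w s`.
      let w , ≢0 = not-in-radical {t 𝕍.+ᵛ 𝔽.- 𝔽.1# 𝕍.· c 𝕍.· s} λ eq → 𝕍.independent-≢· st-ind c
                     (trans (sym (𝕍.x-y+y≡x t (c 𝕍.· s))) (trans (cong (𝕍._+ᵛ c 𝕍.· s) eq) (𝕍.+ᵛ-identityˡ _)))
      in w , λ wt≡cws → ≢0 (begin
        form w (t 𝕍.+ᵛ 𝔽.- 𝔽.1# 𝕍.· c 𝕍.· s)             ≡⟨ additiveʳ w t _ ⟩
        form w t 𝔽.+ form w (𝔽.- 𝔽.1# 𝕍.· c 𝕍.· s)       ≡⟨ cong₂ 𝔽._+_ (trans wt≡cws (sym (homogeneousʳ c w s))) (homogeneousʳ _ w _) ⟩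
        form w (c 𝕍.· s) 𝔽.+ 𝔽.- 𝔽.1# 𝔽.* form w (c 𝕍.· s) ≡⟨ cong (λ z → form w (c 𝕍.· s) 𝔽.+ z) (𝔽.-1*x≈-x _) ⟩
        form w (c 𝕍.· s) 𝔽.+ 𝔽.- form w (c 𝕍.· s)        ≡⟨ 𝔽.-‿inverseʳ _ ⟩
        𝔽.0#                                              ∎))
    where open ≡-Reasoning

  -- s and t span the point of p. Taking p to be s or t itself makes it immediate that what is
  -- perpendicular to both is perpendicular to p.
  Point-span : 𝕍.V → 𝕍.V → 𝕍.V → Set
  Point-span s t p = p ≢ 𝕍.0ᵛ × (∃ λ c → s ≡ c 𝕍.· p) × (∃ λ d → t ≡ d 𝕍.· p) × (p ≡ s ⊎ p ≡ t)

  module _ {s t p} (span : Point-span s t p) where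
    private
      p≢0 = proj₁ span

      to-perp : ∀ w → form w p ≡ 𝔽.0# → Perp s t w
      to-perp w wp = let _ , (c , s≡) , (d , t≡) , _ = span in multiple c s≡ , multiple d t≡
        where
        multiple : ∀ {x} c → x ≡ c 𝕍.· p → form w x ≡ 𝔽.0#
        multiple c refl = trans (homogeneousʳ c w p) (trans (cong (c 𝔽.*_) wp) (𝔽.zeroʳ c))

      from-perp : ∀ w → Perp s t w → form w p ≡ 𝔽.0#
      from-perp w (ws , wt) with proj₂ (proj₂ (proj₂ span))
      ... | inj₁ refl = ws
      ... | inj₂ refl = wt

    points-in-perp-point : q′ ℤ.* (points-in-perp s t ℤ.+ 1ℤ) ≡ qʳ⁺¹
    points-in-perp-point = trans
      (cong (q′ ℤ.*_) (trans (points-in-perp-∑ s t) (∑-cong 𝕍.Eᵛ λ w →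
        ⟦⟧-cong (perp? s t w) (form w p 𝔽.≟ 𝔽.0#) (from-perp w) (to-perp w))))
      (𝔽C.∑-kernel (linearˡ p) (not-in-radical p≢0))

    -- Count the vectors of the hyperplane p^⊥ on the lines of ℒ: q² on a line inside it, q on any
    -- other line. The m lines through each point give the right-hand side.
    lines-in-perp-point : L′ ℤ.* q′ ℤ.+ (q′ ℤ.* q′ ℤ.- q′) ℤ.* lines-in-perp s t ≡ m′ ℤ.* points-in-perp s t ℤ.+ L′
    lines-in-perp-point = begin
      L′ ℤ.* q′ ℤ.+ (q′ ℤ.* q′ ℤ.- q′) ℤ.* lines-in-perp s t
        ≡⟨ cong₂ ℤ._+_ (∑-Fin ∣ℒ∣ q′) (∑-*ˡ Eℒ (q′ ℤ.* q′ ℤ.- q′) _) ⟨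
      ∑ Eℒ (λ i → q′) ℤ.+ ∑ Eℒ (λ i → (q′ ℤ.* q′ ℤ.- q′) ℤ.* ⟦ perp? s t (u (line i)) ×-dec perp? s t (v (line i)) ⟧)
        ≡⟨ ∑-+ Eℒ (λ _ → q′) (λ i → (q′ ℤ.* q′ ℤ.- q′) ℤ.* ⟦ perp? s t (u (line i)) ×-dec perp? s t (v (line i)) ⟧) ⟨
      ∑ Eℒ (λ i → q′ ℤ.+ (q′ ℤ.* q′ ℤ.- q′) ℤ.* ⟦ perp? s t (u (line i)) ×-dec perp? s t (v (line i)) ⟧)
        ≡⟨ ∑-cong Eℒ line-count ⟨
      ∑ Eℒ (λ i → ∑ 𝔽.E (λ a → ∑ 𝔽.E (λ c → ψ (a 𝕍.· u (line i) 𝕍.+ᵛ c 𝕍.· v (line i)))))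
        ≡⟨ ∑-lines ψ ⟩
      m′ ℤ.* ∑ 𝕍.Eᵛ (λ w → nonzero w ℤ.* ψ w) ℤ.+ L′ ℤ.* ψ 𝕍.0ᵛ
        ≡⟨ cong₂ (λ x y → m′ ℤ.* x ℤ.+ y)
             (∑-cong 𝕍.Eᵛ λ w → cong (nonzero w ℤ.*_) (⟦⟧-cong (form w p 𝔽.≟ 𝔽.0#) (perp? s t w) (to-perp w) (from-perp w)))
             (trans (cong (L′ ℤ.*_) (⟦⟧-true (form 𝕍.0ᵛ p 𝔽.≟ 𝔽.0#) (𝕍.Linear.φ[0]≡0 (linearˡ p)))) (ℤ.*-identityʳ L′)) ⟩
      m′ ℤ.* points-in-perp s t ℤ.+ L′  ∎
      where
      open ≡-Reasoning
      ψ : 𝕍.V → ℤ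
      ψ w = ⟦ form w p 𝔽.≟ 𝔽.0# ⟧
      line-count : ∀ i → ∑ 𝔽.E (λ a → ∑ 𝔽.E (λ c → ψ (a 𝕍.· u (line i) 𝕍.+ᵛ c 𝕍.· v (line i)))) ≡
        q′ ℤ.+ (q′ ℤ.* q′ ℤ.- q′) ℤ.* ⟦ perp? s t (u (line i)) ×-dec perp? s t (v (line i)) ⟧
      line-count i = trans
        (∑-cong 𝔽.E λ a → ∑-cong 𝔽.E λ c → cong (λ z → ⟦ z 𝔽.≟ 𝔽.0# ⟧)
          (𝕍.Linear.combination (linearˡ p) a c (u (line i)) (v (line i))))
        (trans (𝔽C.∑-equation (form (u (line i)) p) (form (v (line i)) p) ((form (u (line i)) p 𝔽.≟ 𝔽.0#) ×-dec (form (v (line i)) p 𝔽.≟ 𝔽.0#)))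
          (cong (λ z → q′ ℤ.+ (q′ ℤ.* q′ ℤ.- q′) ℤ.* z)
            (⟦⟧-cong ((form (u (line i)) p 𝔽.≟ 𝔽.0#) ×-dec (form (v (line i)) p 𝔽.≟ 𝔽.0#)) (perp? s t (u (line i)) ×-dec perp? s t (v (line i)))
              (λ (up , vp) → to-perp _ up , to-perp _ vp) (λ (u⊥ , v⊥) → from-perp _ u⊥ , from-perp _ v⊥))))

-- The variance argument

-- S₁ and S₂ are known only multiplied by Q and Q². Multiplying the claim by Q² and inserting them
-- leaves a polynomial identity in Q, t and i. In the application t = q^(r-3), W is the number of
-- vectors, c and c + d are the values expected off and on the cone, and the right-hand side is the
-- squared deviation at the zero vector.
variance-identity : ∀ Q .{{_ : ℤ.NonZero Q}} t i X W S₁ S₂ →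
  let c = i ℤ.* (Q ℤ.* t ℤ.- 1ℤ); d = (Q ℤ.- 1ℤ) ℤ.* (Q ℤ.* t) in
  X ≡ i ℤ.* (Q ℤ.* Q ℤ.* t ℤ.- 1ℤ) → W ≡ Q ℤ.* Q ℤ.* t ℤ.* (Q ℤ.* Q ℤ.* t) →
  Q ℤ.* S₁ ≡ X ℤ.* W → Q ℤ.* (Q ℤ.* S₂) ≡ X ℤ.* (W ℤ.* (X ℤ.+ (Q ℤ.- 1ℤ) ℤ.* (Q ℤ.- 1ℤ))) →
  S₂ ℤ.- (c ℤ.+ c) ℤ.* S₁ ℤ.+ c ℤ.* c ℤ.* W ℤ.- d ℤ.* d ℤ.* X ≡ (X ℤ.- c) ℤ.* (X ℤ.- c)
variance-identity Q t i X W S₁ S₂ refl refl QS₁ Q²S₂ = ℤ.*-cancelˡ-≡ Q _ _ (ℤ.*-cancelˡ-≡ Q _ _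
  (trans (collect Q S₂ S₁ (i ℤ.* (Q ℤ.* t ℤ.- 1ℤ)) ((Q ℤ.- 1ℤ) ℤ.* (Q ℤ.* t)) W X)
    (trans (cong₂ (λ x y → x ℤ.- (i ℤ.* (Q ℤ.* t ℤ.- 1ℤ) ℤ.+ i ℤ.* (Q ℤ.* t ℤ.- 1ℤ)) ℤ.* Q ℤ.* y
        ℤ.+ Q ℤ.* Q ℤ.* (i ℤ.* (Q ℤ.* t ℤ.- 1ℤ) ℤ.* (i ℤ.* (Q ℤ.* t ℤ.- 1ℤ)) ℤ.* W ℤ.- (Q ℤ.- 1ℤ) ℤ.* (Q ℤ.* t) ℤ.* ((Q ℤ.- 1ℤ) ℤ.* (Q ℤ.* t)) ℤ.* X))
      Q²S₂ QS₁) (identity Q t i))))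
  where
  collect : ∀ Q S₂ S₁ c d W X → Q ℤ.* (Q ℤ.* (S₂ ℤ.- (c ℤ.+ c) ℤ.* S₁ ℤ.+ c ℤ.* c ℤ.* W ℤ.- d ℤ.* d ℤ.* X)) ≡
    Q ℤ.* (Q ℤ.* S₂) ℤ.- (c ℤ.+ c) ℤ.* Q ℤ.* (Q ℤ.* S₁) ℤ.+ Q ℤ.* Q ℤ.* (c ℤ.* c ℤ.* W ℤ.- d ℤ.* d ℤ.* X)
  collect = ℤSolver.solve-∀
  identity : ∀ Q t i →
    let A = Q ℤ.* Q ℤ.* t; X = i ℤ.* (A ℤ.- 1ℤ); W = A ℤ.* A; c = i ℤ.* (Q ℤ.* t ℤ.- 1ℤ); d = (Q ℤ.- 1ℤ) ℤ.* (Q ℤ.* t) in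
    X ℤ.* (W ℤ.* (X ℤ.+ (Q ℤ.- 1ℤ) ℤ.* (Q ℤ.- 1ℤ))) ℤ.- (c ℤ.+ c) ℤ.* Q ℤ.* (X ℤ.* W) ℤ.+ Q ℤ.* Q ℤ.* (c ℤ.* c ℤ.* W ℤ.- d ℤ.* d ℤ.* X)
      ≡ Q ℤ.* (Q ℤ.* ((X ℤ.- c) ℤ.* (X ℤ.- c)))
  identity = ℤSolver.solve-∀

module _ (E : Enumeration A) (a₀ : A) {P : A → Set} (P? : ∀ x → Dec (P x)) (T : A → ℤ) (c d : ℤ) where
  open Enumeration E using (_≟_)
  open import Data.Integer.Base using (_+_; _*_; _-_)
  private
    g : A → ℤ
    g x = T x - c - d * ⟦ P? x ⟧

    X W S₁ S₂ : ℤ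
    X  = ∑ E (λ x → ⟦ P? x ⟧)
    W  = ∑ E (λ _ → 1ℤ)
    S₁ = ∑ E T
    S₂ = ∑ E (λ x → T x * T x)

    -- On P the value T = c + d is known, so the cross terms with the indicator collapse: -2d(c + d)
    -- + 2cd + d² = -d². Hence ∑ g² needs only the two moments of T and the sizes of P and of the
    -- whole space.
    square : ∀ x → (P x → T x ≡ c + d) → g x * g x ≡
      T x * T x - (c + c) * T x + c * c * 1ℤ - d * d * ⟦ P? x ⟧
    square x tight with P? x
    ... | no _  = off (T x) c d
      where
      off : ∀ s c d → (s - c - d * 0ℤ) * (s - c - d * 0ℤ) ≡
        s * s - (c + c) * s + c * c * 1ℤ - d * d * 0ℤ
      off = ℤSolver.solve-∀
    ... | yes p = subst (λ s → (s - c - d * 1ℤ) * (s - c - d * 1ℤ) ≡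
        s * s - (c + c) * s + c * c * 1ℤ - d * d * 1ℤ) (sym (tight p)) (on c d)
      where
      on : ∀ c d → (c + d - c - d * 1ℤ) * (c + d - c - d * 1ℤ) ≡
        (c + d) * (c + d) - (c + c) * (c + d) + c * c * 1ℤ - d * d * 1ℤ
      on = ℤSolver.solve-∀

    ∑-g² : (∀ x → P x → T x ≡ c + d) →
      ∑ E (λ x → g x * g x) ≡ S₂ - (c + c) * S₁ + c * c * W - d * d * X
    ∑-g² tight = trans (∑-cong E λ x → square x (tight x))
      (trans (∑-minus E (λ x → T x * T x - (c + c) * T x + c * c * 1ℤ) (λ x → d * d * ⟦ P? x ⟧))
        (cong₂ ℤ._-_
          (trans (∑-+ E (λ x → T x * T x - (c + c) * T x) (λ _ → c * c * 1ℤ)) (cong₂ ℤ._+_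
            (trans (∑-minus E (λ x → T x * T x) (λ x → (c + c) * T x))
              (cong (λ z → S₂ - z) (∑-*ˡ E (c + c) T)))
            (∑-*ˡ E (c * c) (λ _ → 1ℤ))))
          (∑-*ˡ E (d * d) (λ x → ⟦ P? x ⟧))))

    square-≥0 : ∀ z → 0ℤ ℤ.≤ z * z
    square-≥0 (+ n)      = subst (0ℤ ℤ.≤_) (ℤ.pos-* n n) (+≤+ z≤n)
    square-≥0 ℤ.-[1+ n ] = +≤+ z≤n

  -- The hypothesis on the sums says that g = T - c - d [P] satisfies ∑ g² = g(a₀)², so that g vanishes off a₀.
  constant-off-P : ¬ P a₀ → (∀ x → P x → T x ≡ c + d) →
    S₂ - (c + c) * S₁ + c * c * W - d * d * X ≡ (T a₀ - c) * (T a₀ - c) →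
    ∀ {x} → x ≢ a₀ → ¬ P x → T x ≡ c
  constant-off-P a₀∉P tight balance {x} x≢a₀ x∉P = trans (sym (T-c≡g x∉P)) (trans (cong (_+ c) gx≡0) (ℤ.+-identityˡ c))
    where
    arith : ∀ t c d → t - c - d * 0ℤ ≡ t - c
    arith = ℤSolver.solve-∀
    arith′ : ∀ t c → t - c + c ≡ t
    arith′ = ℤSolver.solve-∀
    g≡ : ∀ {x} → ¬ P x → g x ≡ T x - c
    g≡ {x} x∉P = trans (cong (λ z → T x - c - d * z) (⟦⟧-false (P? x) x∉P)) (arith (T x) c d)
    T-c≡g : ∀ {x} → ¬ P x → g x + c ≡ T x
    T-c≡g {x} x∉P = trans (cong (_+ c) (g≡ x∉P)) (arith′ (T x) c)
    ∑≡0 : ∑ E (λ x → ⟦ ¬? (x ≟ a₀) ⟧ * (g x * g x)) ≡ 0ℤ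
    ∑≡0 = trans (∑-≢ E a₀ (λ x → g x * g x)) (trans
      (cong₂ (λ s t → s - t) (trans (∑-g² tight) balance) (cong₂ ℤ._*_ (g≡ a₀∉P) (g≡ a₀∉P)))
      (ℤ.+-inverseʳ ((T a₀ - c) * (T a₀ - c))))
    g²≡0 : g x * g x ≡ 0ℤ
    g²≡0 = trans (sym (trans (cong (_* (g x * g x)) (⟦⟧-true (¬? (x ≟ a₀)) x≢a₀)) (ℤ.*-identityˡ (g x * g x))))
      (∑-≡0 E {λ x → ⟦ ¬? (x ≟ a₀) ⟧ * (g x * g x)} (λ x → ⟦⟧-*-≥0 (¬? (x ≟ a₀)) (square-≥0 (g x))) ∑≡0 x)
    gx≡0 : g x ≡ 0ℤ
    gx≡0 = [ id , id ]′ (ℤ.i*j≡0⇒i≡0∨j≡0 (g x) g²≡0)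

module Variance {q : ℕ} (q-pp : IsPrimePower q)
  (F : FiniteField q) (K : FiniteField (q ℕ.^ 2)) (ext : Extension F K)
  (r : ℕ) (b : SymplecticForm F r)
  {m : ℕ} {ℒ : Pred (Projective.Line F r) 0ℓ} (cover : Symplectic.IsCover F r b m ℒ) where
  open Counting q-pp F K ext r b cover
  open PerpCounts q-pp F K ext r b cover
  open HermitianLemmas q-pp F K ext r b
  open QuadraticExtension q-pp F K ext
  open FiniteField K
  open Field K
  open Projective K r
  open LinearAlgebra K r
  open LinearCounts K r
  open Hermitian F K ext r b

  private
    Q ∣W∣ : ℤ
    Q = + (q ℕ.^ 2)
    ∣W∣ = + ((q ℕ.^ 2) ℕ.^ suc r)

    _⊥?_ : ∀ y x → Dec (⟪ y , x ⟫ ≡ 0#)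
    y ⊥? x = ⟪ y , x ⟫ ≟ 0#

    τ-+ : ∀ {n} (x y : Vec Carrier n) → Vec.map conj (Vec.zipWith _+_ x y) ≡ Vec.zipWith _+_ (Vec.map conj x) (Vec.map conj y)
    τ-+ []      []      = refl
    τ-+ (a ∷ x) (c ∷ y) = cong₂ _∷_ (conj-+ a c) (τ-+ x y)

    τ-· : ∀ {n} c (x : Vec Carrier n) → Vec.map conj (Vec.map (c *_) x) ≡ Vec.map (conj c *_) (Vec.map conj x)
    τ-· c []      = refl
    τ-· c (a ∷ x) = cong₂ _∷_ (conj-* c a) (τ-· c x)

    ⟪⟫-semilinear : ∀ w c x z → ⟪ w , z +ᵛ conj c · x ⟫ ≡ ⟪ w , z ⟫ + c * ⟪ w , x ⟫
    ⟪⟫-semilinear w c x z = trans (cong (B w) (trans (τ-+ z (conj c · x)) (cong (τ z +ᵛ_) (trans (τ-· (conj c) x) (cong (_· τ x) (conj-conj c))))))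
      (trans (Linear.additive (B-linearʳ w) (τ z) (c · τ x)) (cong (λ s → ⟪ w , z ⟫ + s) (Linear.homogeneous (B-linearʳ w) c (τ x))))

    swap-perp : ∀ x p → ⟦ x ⊥? p ⟧ ≡ ⟦ p ⊥? x ⟧
    swap-perp x p = ⟦⟧-cong (x ⊥? p) (p ⊥? x) (⟪⟫-symmetric-0 x p) (⟪⟫-symmetric-0 p x)

    common-perp : V → V → ℤ
    common-perp x y = ∑ Eᵛ (λ p → ⟦ x ⊥? p ⟧ ℤ.* ⟦ y ⊥? p ⟧)

    multiples : V → V → ℤ
    multiples x y = ∑ E (λ c → ⟦ y ≟ᵛ c · x ⟧)

  ∑-perp : ∀ {x} → x ≢ 0ᵛ → Q ℤ.* ∑ Eᵛ (λ p → ⟦ x ⊥? p ⟧) ≡ ∣W∣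
  ∑-perp {x} x≢0 = trans (cong (Q ℤ.*_) (∑-cong Eᵛ (swap-perp x)))
    (∑-kernel (⟪⟫-linear x) (⟪⟫-nondegenerate x≢0))

  -- A multiple of x imposes no condition beyond x^⊥ʰ unless it is independent of x: if y = c x, one
  -- equation remains, otherwise there are two independent ones. `multiples` x y is 1 or 0
  -- accordingly.
  ∑-common-perp : ∀ {x} y → x ≢ 0ᵛ → Q ℤ.* (Q ℤ.* common-perp x y) ≡ ∣W∣ ℤ.* (1ℤ ℤ.+ (Q ℤ.- 1ℤ) ℤ.* multiples x y)
  ∑-common-perp {x} y x≢0 with Enumeration.any? E (λ c → y ≟ᵛ c · x)
  ... | yes (c , refl) = begin
    Q ℤ.* (Q ℤ.* common-perp x (c · x))
      ≡⟨ cong (λ z → Q ℤ.* (Q ℤ.* z)) (∑-cong Eᵛ λ p → trans (⟦⟧-*-cong (x ⊥? p) (λ xp → ⟦⟧-true ((c · x) ⊥? p)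
           (trans (Linear.homogeneous (⟪⟫-linear p) c x) (trans (cong (c *_) xp) (zeroʳ c))))) (ℤ.*-identityʳ ⟦ x ⊥? p ⟧)) ⟩
    Q ℤ.* (Q ℤ.* ∑ Eᵛ (λ p → ⟦ x ⊥? p ⟧))
      ≡⟨ cong (Q ℤ.*_) (∑-perp x≢0) ⟩
    Q ℤ.* ∣W∣
      ≡⟨ arith Q ∣W∣ ⟩
    ∣W∣ ℤ.* (1ℤ ℤ.+ (Q ℤ.- 1ℤ) ℤ.* 1ℤ)
      ≡⟨ cong (λ z → ∣W∣ ℤ.* (1ℤ ℤ.+ (Q ℤ.- 1ℤ) ℤ.* z))
           (∑-unique E (λ c′ → c · x ≟ᵛ c′ · x) c refl λ c′ eq → ·-cancelʳ x≢0 (sym eq)) ⟨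
    ∣W∣ ℤ.* (1ℤ ℤ.+ (Q ℤ.- 1ℤ) ℤ.* multiples x (c · x))  ∎
    where
    open ≡-Reasoning
    arith : ∀ q w → q ℤ.* w ≡ w ℤ.* (1ℤ ℤ.+ (q ℤ.- 1ℤ) ℤ.* 1ℤ)
    arith = ℤSolver.solve-∀
  ... | no ∄c = begin
    Q ℤ.* (Q ℤ.* common-perp x y)
      ≡⟨ cong (λ z → Q ℤ.* (Q ℤ.* z)) (∑-cong Eᵛ λ p → cong₂ ℤ._*_ (swap-perp x p) (swap-perp y p)) ⟩
    Q ℤ.* (Q ℤ.* ∑ Eᵛ (λ p → ⟦ p ⊥? x ⟧ ℤ.* ⟦ p ⊥? y ⟧))
      ≡⟨ ∑-kernel₂ (⟪⟫-linear x) (⟪⟫-linear y) (⟪⟫-nondegenerate x≢0) not-multiple ⟩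
    ∣W∣
      ≡⟨ arith Q ∣W∣ ⟩
    ∣W∣ ℤ.* (1ℤ ℤ.+ (Q ℤ.- 1ℤ) ℤ.* 0ℤ)
      ≡⟨ cong (λ z → ∣W∣ ℤ.* (1ℤ ℤ.+ (Q ℤ.- 1ℤ) ℤ.* z)) (∑-none E (λ c → y ≟ᵛ c · x) λ c eq → ∄c (c , eq)) ⟨
    ∣W∣ ℤ.* (1ℤ ℤ.+ (Q ℤ.- 1ℤ) ℤ.* multiples x y)  ∎
    where
    open ≡-Reasoning
    arith : ∀ q w → w ≡ w ℤ.* (1ℤ ℤ.+ (q ℤ.- 1ℤ) ℤ.* 0ℤ)
    arith = ℤSolver.solve-∀
    not-multiple : ∀ c → ∃ λ w → ⟪ w , y ⟫ ≢ c * ⟪ w , x ⟫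
    not-multiple c =
      -- The conjugate is needed because the form is semilinear in its second argument: ⟪ w , z ⟫ is
      -- then ⟪ w , y ⟫ - c ⟪ w , x ⟫, and z ≠ 0 allows w to be chosen with this nonzero.
      let z = y +ᵛ (- 1#) · conj c · x
          z+cx≡y = x-y+y≡x y (conj c · x)
          w , wz≢0 = ⟪⟫-nondegenerate {z} λ z≡0 → ∄c (conj c ,
            trans (sym z+cx≡y) (trans (cong (_+ᵛ conj c · x) z≡0) (+ᵛ-identityˡ (conj c · x))))
      in w , λ eq → wz≢0 (+-cancelʳ-0 (trans (sym (⟪⟫-semilinear w c x z)) (trans (cong ⟪ w ,_⟫ z+cx≡y) eq)))

  ∑-perp-size : Q ℤ.* ∑ Eᵛ perp-size ≡ ∣X∣ ℤ.* ∣W∣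
  ∑-perp-size = begin
    Q ℤ.* ∑ Eᵛ (λ p → ∑ Eᵛ (λ y → 𝟙ˣ y ℤ.* ⟦ y ⊥? p ⟧))
      ≡⟨ cong (Q ℤ.*_) (trans (∑-swap Eᵛ Eᵛ _) (∑-cong Eᵛ λ y → ∑-*ˡ Eᵛ (𝟙ˣ y) _)) ⟩
    Q ℤ.* ∑ Eᵛ (λ y → 𝟙ˣ y ℤ.* ∑ Eᵛ (λ p → ⟦ y ⊥? p ⟧))
      ≡⟨ ∑-*ˡ Eᵛ Q (λ y → 𝟙ˣ y ℤ.* ∑ Eᵛ (λ p → ⟦ y ⊥? p ⟧)) ⟨
    ∑ Eᵛ (λ y → Q ℤ.* (𝟙ˣ y ℤ.* ∑ Eᵛ (λ p → ⟦ y ⊥? p ⟧)))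
      ≡⟨ ∑-cong Eᵛ (λ y → trans (arith Q (𝟙ˣ y) _) (⟦⟧-*-cong (inX? y) λ y∈X → ∑-perp (proj₁ y∈X))) ⟩
    ∑ Eᵛ (λ y → 𝟙ˣ y ℤ.* ∣W∣)
      ≡⟨ ∑-*ʳ Eᵛ ∣W∣ 𝟙ˣ ⟩
    ∣X∣ ℤ.* ∣W∣  ∎
    where
    open ≡-Reasoning
    arith : ∀ a b c → a ℤ.* (b ℤ.* c) ≡ b ℤ.* (a ℤ.* c)
    arith = ℤSolver.solve-∀

  private
    ∑-multiples-in-X : ∀ {x} → InX x → ∑ Eᵛ (λ y → 𝟙ˣ y ℤ.* multiples x y) ≡ Q ℤ.- 1ℤ
    ∑-multiples-in-X {x} x∈X = begin
      ∑ Eᵛ (λ y → 𝟙ˣ y ℤ.* multiples x y)    ≡⟨ ∑-cong Eᵛ (λ y → ℤ.*-comm (𝟙ˣ y) (multiples x y)) ⟩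
      ∑ Eᵛ (λ y → multiples x y ℤ.* 𝟙ˣ y)    ≡⟨ ∑-fibre E Eᵛ (_· x) 𝟙ˣ ⟨
      ∑ E (λ c → 𝟙ˣ (c · x))                 ≡⟨ ∑-cong E (λ c → ⟦⟧-cong (inX? (c · x)) (¬? (c ≟ 0#))
                                                  (λ { (cx≢0 , _) refl → cx≢0 (·-zeroˡ x) }) (λ c≢0 → InX-· c≢0 x∈X)) ⟩
      ∑ E (λ c → ⟦ ¬? (c ≟ 0#) ⟧)            ≡⟨ ∑-nonzero ⟩
      Q ℤ.- 1ℤ                               ∎
      where open ≡-Reasoning

  -- Count the triples (p, x, y) with x and y in the cone and both perpendicular to p. A pair of
  -- dependent x, y has Q times as many p as an independent one, and each x has Q - 1 multiples in
  -- the cone; this excess is the term (Q - 1)².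
  ∑-perp-size² : Q ℤ.* (Q ℤ.* ∑ Eᵛ (λ p → perp-size p ℤ.* perp-size p)) ≡
                 ∣X∣ ℤ.* (∣W∣ ℤ.* (∣X∣ ℤ.+ (Q ℤ.- 1ℤ) ℤ.* (Q ℤ.- 1ℤ)))
  ∑-perp-size² = begin
    Q ℤ.* (Q ℤ.* ∑ Eᵛ (λ p → perp-size p ℤ.* perp-size p))
      ≡⟨ cong (λ z → Q ℤ.* (Q ℤ.* z)) expand ⟩
    Q ℤ.* (Q ℤ.* ∑ Eᵛ (λ x → 𝟙ˣ x ℤ.* ∑ Eᵛ (λ y → 𝟙ˣ y ℤ.* common-perp x y)))
      ≡⟨ trans (∑-*ˡ Eᵛ Q _) (cong (Q ℤ.*_) (∑-*ˡ Eᵛ Q _)) ⟨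
    ∑ Eᵛ (λ x → Q ℤ.* (Q ℤ.* (𝟙ˣ x ℤ.* ∑ Eᵛ (λ y → 𝟙ˣ y ℤ.* common-perp x y))))
      ≡⟨ ∑-cong Eᵛ (λ x → trans (arith₁ Q (𝟙ˣ x) _) (⟦⟧-*-cong (inX? x) row)) ⟩
    ∑ Eᵛ (λ x → 𝟙ˣ x ℤ.* (∣W∣ ℤ.* (∣X∣ ℤ.+ (Q ℤ.- 1ℤ) ℤ.* (Q ℤ.- 1ℤ))))
      ≡⟨ ∑-*ʳ Eᵛ _ 𝟙ˣ ⟩
    ∣X∣ ℤ.* (∣W∣ ℤ.* (∣X∣ ℤ.+ (Q ℤ.- 1ℤ) ℤ.* (Q ℤ.- 1ℤ)))  ∎
    where
    open ≡-Reasoning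
    arith₁ : ∀ q f z → q ℤ.* (q ℤ.* (f ℤ.* z)) ≡ f ℤ.* (q ℤ.* (q ℤ.* z))
    arith₁ = ℤSolver.solve-∀
    arith₂ : ∀ f w c k → f ℤ.* (w ℤ.* (1ℤ ℤ.+ c ℤ.* k)) ≡ w ℤ.* (f ℤ.+ c ℤ.* (f ℤ.* k))
    arith₂ = ℤSolver.solve-∀
    arith₃ : ∀ a b c d → (a ℤ.* b) ℤ.* (c ℤ.* d) ≡ a ℤ.* (c ℤ.* (b ℤ.* d))
    arith₃ = ℤSolver.solve-∀
    expand : ∑ Eᵛ (λ p → perp-size p ℤ.* perp-size p) ≡ ∑ Eᵛ (λ x → 𝟙ˣ x ℤ.* ∑ Eᵛ (λ y → 𝟙ˣ y ℤ.* common-perp x y))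
    expand = begin
      ∑ Eᵛ (λ p → perp-size p ℤ.* perp-size p)
        ≡⟨ ∑-cong Eᵛ (λ p → trans (sym (∑-*ʳ Eᵛ (perp-size p) (λ x → 𝟙ˣ x ℤ.* ⟦ x ⊥? p ⟧)))
             (∑-cong Eᵛ λ x → sym (∑-*ˡ Eᵛ (𝟙ˣ x ℤ.* ⟦ x ⊥? p ⟧) (λ y → 𝟙ˣ y ℤ.* ⟦ y ⊥? p ⟧)))) ⟩
      ∑ Eᵛ (λ p → ∑ Eᵛ (λ x → ∑ Eᵛ (λ y → (𝟙ˣ x ℤ.* ⟦ x ⊥? p ⟧) ℤ.* (𝟙ˣ y ℤ.* ⟦ y ⊥? p ⟧))))
        ≡⟨ ∑-swap Eᵛ Eᵛ _ ⟩
      ∑ Eᵛ (λ x → ∑ Eᵛ (λ p → ∑ Eᵛ (λ y → (𝟙ˣ x ℤ.* ⟦ x ⊥? p ⟧) ℤ.* (𝟙ˣ y ℤ.* ⟦ y ⊥? p ⟧))))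
        ≡⟨ ∑-cong Eᵛ (λ x → ∑-swap Eᵛ Eᵛ _) ⟩
      ∑ Eᵛ (λ x → ∑ Eᵛ (λ y → ∑ Eᵛ (λ p → (𝟙ˣ x ℤ.* ⟦ x ⊥? p ⟧) ℤ.* (𝟙ˣ y ℤ.* ⟦ y ⊥? p ⟧))))
        ≡⟨ (∑-cong Eᵛ λ x → ∑-cong Eᵛ λ y → trans (∑-cong Eᵛ λ p → arith₃ (𝟙ˣ x) ⟦ x ⊥? p ⟧ (𝟙ˣ y) ⟦ y ⊥? p ⟧)
             (trans (∑-*ˡ Eᵛ (𝟙ˣ x) _) (cong (𝟙ˣ x ℤ.*_) (∑-*ˡ Eᵛ (𝟙ˣ y) _)))) ⟩
      ∑ Eᵛ (λ x → ∑ Eᵛ (λ y → 𝟙ˣ x ℤ.* (𝟙ˣ y ℤ.* common-perp x y)))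
        ≡⟨ ∑-cong Eᵛ (λ x → ∑-*ˡ Eᵛ (𝟙ˣ x) _) ⟩
      ∑ Eᵛ (λ x → 𝟙ˣ x ℤ.* ∑ Eᵛ (λ y → 𝟙ˣ y ℤ.* common-perp x y))  ∎
    row : ∀ {x} → InX x → Q ℤ.* (Q ℤ.* ∑ Eᵛ (λ y → 𝟙ˣ y ℤ.* common-perp x y)) ≡
                          ∣W∣ ℤ.* (∣X∣ ℤ.+ (Q ℤ.- 1ℤ) ℤ.* (Q ℤ.- 1ℤ))
    row {x} x∈X = begin
      Q ℤ.* (Q ℤ.* ∑ Eᵛ (λ y → 𝟙ˣ y ℤ.* common-perp x y))
        ≡⟨ trans (∑-*ˡ Eᵛ Q _) (cong (Q ℤ.*_) (∑-*ˡ Eᵛ Q _)) ⟨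
      ∑ Eᵛ (λ y → Q ℤ.* (Q ℤ.* (𝟙ˣ y ℤ.* common-perp x y)))
        ≡⟨ ∑-cong Eᵛ (λ y → trans (arith₁ Q (𝟙ˣ y) (common-perp x y)) (trans (cong (𝟙ˣ y ℤ.*_) (∑-common-perp y (proj₁ x∈X)))
             (arith₂ (𝟙ˣ y) ∣W∣ (Q ℤ.- 1ℤ) (multiples x y)))) ⟩
      ∑ Eᵛ (λ y → ∣W∣ ℤ.* (𝟙ˣ y ℤ.+ (Q ℤ.- 1ℤ) ℤ.* (𝟙ˣ y ℤ.* multiples x y)))
        ≡⟨ ∑-*ˡ Eᵛ ∣W∣ _ ⟩
      ∣W∣ ℤ.* ∑ Eᵛ (λ y → 𝟙ˣ y ℤ.+ (Q ℤ.- 1ℤ) ℤ.* (𝟙ˣ y ℤ.* multiples x y))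
        ≡⟨ cong (∣W∣ ℤ.*_) (trans (∑-+ Eᵛ 𝟙ˣ (λ y → (Q ℤ.- 1ℤ) ℤ.* (𝟙ˣ y ℤ.* multiples x y)))
             (cong (λ z → ∣X∣ ℤ.+ z) (trans (∑-*ˡ Eᵛ (Q ℤ.- 1ℤ) _) (cong ((Q ℤ.- 1ℤ) ℤ.*_) (∑-multiples-in-X x∈X))))) ⟩
      ∣W∣ ℤ.* (∣X∣ ℤ.+ (Q ℤ.- 1ℤ) ℤ.* (Q ℤ.- 1ℤ))  ∎

  perp-size-0 : perp-size 0ᵛ ≡ ∣X∣
  perp-size-0 = ∑-cong Eᵛ λ y → trans (cong (𝟙ˣ y ℤ.*_) (trans (swap-perp y 0ᵛ)
    (⟦⟧-true (0ᵛ ⊥? y) (Linear.φ[0]≡0 (⟪⟫-linear y))))) (ℤ.*-identityʳ (𝟙ˣ y))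

  -- The zero vector is the exceptional argument: it is not in the cone, and by `perp-size-0` its
  -- value is |X|, so the balance of squares is used up by it.
  tight-off-X : ∀ t i →
    ∣W∣ ≡ Q ℤ.* Q ℤ.* t ℤ.* (Q ℤ.* Q ℤ.* t) → ∣X∣ ≡ i ℤ.* (Q ℤ.* Q ℤ.* t ℤ.- 1ℤ) →
    (∀ y → InX y → perp-size y ≡ i ℤ.* (Q ℤ.* t ℤ.- 1ℤ) ℤ.+ (Q ℤ.- 1ℤ) ℤ.* (Q ℤ.* t)) →
    ∀ {p} → p ≢ 0ᵛ → ¬ InX p → perp-size p ≡ i ℤ.* (Q ℤ.* t ℤ.- 1ℤ)
  tight-off-X t i ∣W∣≡ ∣X∣≡ tight = constant-off-P Eᵛ 0ᵛ inX? perp-size _ _ (λ (0≢0 , _) → 0≢0 refl) tight balance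
    where
    W = ∑ Eᵛ (λ _ → 1ℤ)
    W≡∣W∣ : W ≡ ∣W∣
    W≡∣W∣ = trans (∑Eᵛ-const 1ℤ) (ℤ.*-identityʳ ∣W∣)
    balance = trans
      (variance-identity Q {{ℕ.>-nonZero (ℕ.<-trans ℕ.z<s 1<q)}} t i ∣X∣ W (∑ Eᵛ perp-size) (∑ Eᵛ (λ p → perp-size p ℤ.* perp-size p))
        ∣X∣≡ (trans W≡∣W∣ ∣W∣≡) (trans ∑-perp-size (cong (∣X∣ ℤ.*_) (sym W≡∣W∣)))
        (trans ∑-perp-size² (cong (λ W → ∣X∣ ℤ.* (W ℤ.* (∣X∣ ℤ.+ (Q ℤ.- 1ℤ) ℤ.* (Q ℤ.- 1ℤ)))) (sym W≡∣W∣))))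
      (cong (λ x → (x ℤ.- i ℤ.* (Q ℤ.* t ℤ.- 1ℤ)) ℤ.* (x ℤ.- i ℤ.* (Q ℤ.* t ℤ.- 1ℤ))) (sym perp-size-0))

-- Arithmetic

odd≥3 : ∀ {r} → 3 ℕ.≤ r → 2 ∤ r → ∃ λ s → r ≡ 3 ℕ.+ 2 ℕ.* s
odd≥3 {suc (suc (suc r))} (ℕ.s≤s (ℕ.s≤s (ℕ.s≤s _))) 2∤r with r ℕ.% 2 in r%2 | m%n<n r 2
... | 0 | _ = r ℕ./ 2 , cong (3 ℕ.+_) (trans (m≡m%n+[m/n]*n r 2)
  (trans (cong (ℕ._+ r ℕ./ 2 ℕ.* 2) r%2) (ℕ.*-comm (r ℕ./ 2) 2)))
... | 1 | _ = contradiction (divides (2 ℕ.+ r ℕ./ 2) (cong (3 ℕ.+_)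
  (trans (m≡m%n+[m/n]*n r 2) (cong (ℕ._+ r ℕ./ 2 ℕ.* 2) r%2)))) 2∤r
... | suc (suc _) | ℕ.s≤s (ℕ.s≤s ())

θ-geometric : ∀ n q → (+ q ℤ.- 1ℤ) ℤ.* + θ (+ n) q ≡ + (q ℕ.^ suc n) ℤ.- 1ℤ
θ-geometric zero q = trans (ℤ.*-identityʳ (+ q ℤ.- 1ℤ)) (cong (λ z → + z ℤ.- 1ℤ) (sym (ℕ.*-identityʳ q)))
θ-geometric (suc n) q = begin
  (+ q ℤ.- 1ℤ) ℤ.* (+ (q ℕ.^ suc n) ℤ.+ + θ (+ n) q)
    ≡⟨ ℤ.*-distribˡ-+ (+ q ℤ.- 1ℤ) (+ (q ℕ.^ suc n)) (+ θ (+ n) q) ⟩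
  (+ q ℤ.- 1ℤ) ℤ.* + (q ℕ.^ suc n) ℤ.+ (+ q ℤ.- 1ℤ) ℤ.* + θ (+ n) q
    ≡⟨ cong (λ z → (+ q ℤ.- 1ℤ) ℤ.* + (q ℕ.^ suc n) ℤ.+ z) (θ-geometric n q) ⟩
  (+ q ℤ.- 1ℤ) ℤ.* + (q ℕ.^ suc n) ℤ.+ (+ (q ℕ.^ suc n) ℤ.- 1ℤ)
    ≡⟨ arith (+ q) (+ (q ℕ.^ suc n)) ⟩
  + q ℤ.* + (q ℕ.^ suc n) ℤ.- 1ℤ
    ≡⟨ cong (ℤ._- 1ℤ) (ℤ.pos-* q (q ℕ.^ suc n)) ⟨
  + (q ℕ.^ suc (suc n)) ℤ.- 1ℤ ∎
  where
  open ≡-Reasoning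
  arith : ∀ q x → (q ℤ.- 1ℤ) ℤ.* x ℤ.+ (x ℤ.- 1ℤ) ≡ q ℤ.* x ℤ.- 1ℤ
  arith = ℤSolver.solve-∀

-- θ_{2s-1,q} = (q+1) θ_{s-1,q²}, with the convention θ_{-1} = 0.
θ-odd : ∀ s q → ∃ λ T → θ (+ (3 ℕ.+ 2 ℕ.* s) ℤ.- + 4) q ≡ T ℕ.* suc q ×
                        (+ (q ℕ.^ 2) ℤ.- 1ℤ) ℤ.* + T ≡ + ((q ℕ.^ 2) ℕ.^ s) ℤ.- 1ℤ
θ-odd zero    q = 0 , refl , ℤ.*-zeroʳ (+ (q ℕ.^ 2) ℤ.- 1ℤ)
θ-odd (suc s) q = θ (+ s) (q ℕ.^ 2)
  , trans (cong (λ n → θ (+ (3 ℕ.+ n) ℤ.- + 4) q) (double s)) (split s)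
  , θ-geometric s (q ℕ.^ 2)
  where
  double : ∀ s → 2 ℕ.* suc s ≡ 2 ℕ.+ 2 ℕ.* s
  double = ℕSolver.solve-∀
  split : ∀ s → θ (+ suc (2 ℕ.* s)) q ≡ θ (+ s) (q ℕ.^ 2) ℕ.* suc q
  split zero    = base q
    where
    base : ∀ q → q ℕ.* 1 ℕ.+ 1 ≡ 1 ℕ.* suc q
    base = ℕSolver.solve-∀
  split (suc s) = begin
    θ (+ suc (2 ℕ.* suc s)) q
      ≡⟨ cong (λ n → θ (+ suc n) q) (double s) ⟩
    q ℕ.^ (3 ℕ.+ 2 ℕ.* s) ℕ.+ (q ℕ.^ (2 ℕ.+ 2 ℕ.* s) ℕ.+ θ (+ suc (2 ℕ.* s)) q)
      ≡⟨ cong (λ n → q ℕ.^ (3 ℕ.+ 2 ℕ.* s) ℕ.+ (q ℕ.^ (2 ℕ.+ 2 ℕ.* s) ℕ.+ n)) (split s) ⟩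
    q ℕ.* (q ℕ.* (q ℕ.* q ℕ.^ (2 ℕ.* s))) ℕ.+ (q ℕ.* (q ℕ.* q ℕ.^ (2 ℕ.* s)) ℕ.+ θ (+ s) (q ℕ.^ 2) ℕ.* suc q)
      ≡⟨ cong (λ x → q ℕ.* (q ℕ.* (q ℕ.* x)) ℕ.+ (q ℕ.* (q ℕ.* x) ℕ.+ θ (+ s) (q ℕ.^ 2) ℕ.* suc q)) (ℕ.^-*-assoc q 2 s) ⟨
    q ℕ.* (q ℕ.* (q ℕ.* (q ℕ.^ 2) ℕ.^ s)) ℕ.+ (q ℕ.* (q ℕ.* (q ℕ.^ 2) ℕ.^ s) ℕ.+ θ (+ s) (q ℕ.^ 2) ℕ.* suc q)
      ≡⟨ step q ((q ℕ.^ 2) ℕ.^ s) (θ (+ s) (q ℕ.^ 2)) ⟩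
    ((q ℕ.^ 2) ℕ.^ suc s ℕ.+ θ (+ s) (q ℕ.^ 2)) ℕ.* suc q  ∎
    where
    open ≡-Reasoning
    step : ∀ q x y → q ℕ.* (q ℕ.* (q ℕ.* x)) ℕ.+ (q ℕ.* (q ℕ.* x) ℕ.+ y ℕ.* suc q) ≡
                     (q ℕ.* (q ℕ.* 1) ℕ.* x ℕ.+ y) ℕ.* suc q
    step = ℕSolver.solve-∀

private module ℤRing = RingProperties ℤ.+-*-ring

-- In the application t = q^(r-3), hence M = q^(r+1), and L = |ℒ|. Below, N is `lines-in-perp`, R is
-- `points-in-perp`, counted in nonzero vectors, and h is `perp-size`.
module Arithmetic (q t m L : ℤ) .{{_ : ℤ.NonZero q}}
  (L-eq : L ℤ.* (q ℤ.* q) ≡ m ℤ.* (q ℤ.* q ℤ.* (q ℤ.* q) ℤ.* t ℤ.- 1ℤ) ℤ.+ L) where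
  open import Data.Integer.Base using (_+_; _*_; _-_)
  private
    Q M i : ℤ
    Q = q * q
    M = Q * Q * t
    i = m * (Q - q) + q + 1ℤ

    isolate : ∀ h x l → h ≡ (h + x + l) - x - l
    isolate = ℤSolver.solve-∀

    shift : ∀ R x → R + 1ℤ ≡ x → R ≡ x - 1ℤ
    shift R _ refl = sym (arith R)
      where
      arith : ∀ R → R + 1ℤ - 1ℤ ≡ R
      arith = ℤSolver.solve-∀

  -- L Q² - L = (Q + 1)(L Q - L), and `L-eq` gives L Q - L = m(M - 1). This is where i arises.
  X-size : ∀ {X} → L * (Q * Q) ≡ X + (m - 1ℤ) * ((q + 1ℤ) * (M - 1ℤ)) + L →
           X ≡ i * (M - 1ℤ)
  X-size {X} eq = begin
    X
      ≡⟨ isolate X x L ⟩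
    (X + x + L) - x - L
      ≡⟨ cong (λ z → z - x - L) eq ⟨
    L * (Q * Q) - x - L
      ≡⟨ factor L Q x ⟩
    (Q + 1ℤ) * (L * Q - L) - x
      ≡⟨ cong (λ z → (Q + 1ℤ) * (z - L) - x) L-eq ⟩
    (Q + 1ℤ) * (m * (M - 1ℤ) + L - L) - x
      ≡⟨ simplify q m L (M - 1ℤ) ⟩
    i * (M - 1ℤ)  ∎
    where
    open ≡-Reasoning
    x = (m - 1ℤ) * ((q + 1ℤ) * (M - 1ℤ))
    factor : ∀ L Q x → L * (Q * Q) - x - L ≡ (Q + 1ℤ) * (L * Q - L) - x
    factor = ℤSolver.solve-∀
    simplify : ∀ q m L a → (q * q + 1ℤ) * (m * a + L - L) - (m - 1ℤ) * ((q + 1ℤ) * a) ≡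
      (m * (q * q - q) + q + 1ℤ) * a
    simplify = ℤSolver.solve-∀

  module _ {N R h : ℤ}
    (h-eq : L * Q + (Q * Q - Q) * N ≡ h + (m - 1ℤ) * ((q + 1ℤ) * R) + L) where

    point-perp : q * (R + 1ℤ) ≡ M → L * q + (q * q - q) * N ≡ m * R + L →
                 h ≡ i * (Q * t - 1ℤ) + (Q - 1ℤ) * (Q * t)
    point-perp R-eq N-eq = begin
      h
        ≡⟨ isolate h x L ⟩
      (h + x + L) - x - L
        ≡⟨ cong (λ z → z - x - L) h-eq ⟨
      (L * Q + (Q * Q - Q) * N) - x - L
        ≡⟨ combine q L N x ⟩
      -- The multiplier q(q + 1) turns q² - q into Q² - Q and so matches the coefficient of N; the
      -- multiplier 1 - q corrects that of L.
      (1ℤ - q) * (L * Q - L) + q * (q + 1ℤ) * (L * q + (q * q - q) * N - L) - x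
        ≡⟨ cong₂ (λ y z → (1ℤ - q) * (y - L) + q * (q + 1ℤ) * (z - L) - x) L-eq N-eq ⟩
      (1ℤ - q) * (m * (M - 1ℤ) + L - L) + q * (q + 1ℤ) * (m * R + L - L) - (m - 1ℤ) * ((q + 1ℤ) * R)
        ≡⟨ cong (λ R → (1ℤ - q) * (m * (M - 1ℤ) + L - L) + q * (q + 1ℤ) * (m * R + L - L) - (m - 1ℤ) * ((q + 1ℤ) * R)) R≡ ⟩
      _ ≡⟨ simplify q t m L ⟩
      i * (Q * t - 1ℤ) + (Q - 1ℤ) * (Q * t)  ∎
      where
      open ≡-Reasoning
      x = (m - 1ℤ) * ((q + 1ℤ) * R)
      regroup : ∀ q t → q * q * (q * q) * t ≡ q * (q * (q * q) * t)
      regroup = ℤSolver.solve-∀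
      R≡ : R ≡ q * Q * t - 1ℤ
      R≡ = shift R _ (ℤ.*-cancelˡ-≡ q _ _ (trans R-eq (regroup q t)))
      combine : ∀ q L N x → (L * (q * q) + (q * q * (q * q) - q * q) * N) - x - L ≡
        (1ℤ - q) * (L * (q * q) - L) + q * (q + 1ℤ) * (L * q + (q * q - q) * N - L) - x
      combine = ℤSolver.solve-∀
      simplify : ∀ q t m L → let Q = q * q; R = q * Q * t - 1ℤ in
        (1ℤ - q) * (m * (Q * Q * t - 1ℤ) + L - L) + q * (q + 1ℤ) * (m * R + L - L) - (m - 1ℤ) * ((q + 1ℤ) * R)
        ≡ (m * (Q - q) + q + 1ℤ) * (Q * t - 1ℤ) + (Q - 1ℤ) * (Q * t)
      simplify = ℤSolver.solve-∀

    -- Here R = Q t - 1. The deviation of h from i(Q t - 1) is Q(Q - 1) times the deviation of N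
    -- from m(t - 1)/(Q - 1), which is the constant of the dual condition.
    line-perp : q * (q * (R + 1ℤ)) ≡ M →
                h ≡ i * (Q * t - 1ℤ) + Q * ((Q - 1ℤ) * N - m * (t - 1ℤ))
    line-perp R-eq = begin
      h
        ≡⟨ isolate h x L ⟩
      (h + x + L) - x - L
        ≡⟨ cong (λ z → z - x - L) h-eq ⟨
      (L * Q + (Q * Q - Q) * N) - x - L
        ≡⟨ cong₂ (λ y R → (y + (Q * Q - Q) * N) - (m - 1ℤ) * ((q + 1ℤ) * R) - L) L-eq R≡ ⟩
      _ ≡⟨ simplify q t m L N ⟩
      i * (Q * t - 1ℤ) + Q * ((Q - 1ℤ) * N - m * (t - 1ℤ))  ∎
      where
      open ≡-Reasoning
      x = (m - 1ℤ) * ((q + 1ℤ) * R)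
      regroup : ∀ q t → q * q * (q * q) * t ≡ q * (q * (q * q * t))
      regroup = ℤSolver.solve-∀
      R≡ : R ≡ Q * t - 1ℤ
      R≡ = shift R _ (ℤ.*-cancelˡ-≡ q _ _ (ℤ.*-cancelˡ-≡ q _ _ (trans R-eq (regroup q t))))
      simplify : ∀ q t m L N → let Q = q * q; R = Q * t - 1ℤ in
        (m * (Q * Q * t - 1ℤ) + L + (Q * Q - Q) * N) - (m - 1ℤ) * ((q + 1ℤ) * R) - L
        ≡ (m * (Q - q) + q + 1ℤ) * (Q * t - 1ℤ) + Q * ((Q - 1ℤ) * N - m * (t - 1ℤ))
      simplify = ℤSolver.solve-∀

    -- δ is t for a line of ℒ and 0 for any other line, so that one argument serves both clauses of
    -- both conditions.
    module _ {k δ : ℤ} (R-eq : q * (q * (R + 1ℤ)) ≡ M) (k-eq : (Q - 1ℤ) * k ≡ m * (t - 1ℤ)) where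
      private
        expand : ∀ Q k δ → Q * ((Q - 1ℤ) * (k + δ) - (Q - 1ℤ) * k) ≡ (Q - 1ℤ) * (Q * δ)
        expand = ℤSolver.solve-∀

        h≡ : h ≡ i * (Q * t - 1ℤ) + Q * ((Q - 1ℤ) * N - (Q - 1ℤ) * k)
        h≡ = trans (line-perp R-eq) (cong (λ z → i * (Q * t - 1ℤ) + Q * ((Q - 1ℤ) * N - z)) (sym k-eq))

      lines⇒points : N ≡ k + δ → h ≡ i * (Q * t - 1ℤ) + (Q - 1ℤ) * (Q * δ)
      lines⇒points refl = trans h≡ (cong (λ z → i * (Q * t - 1ℤ) + z) (expand Q k δ))

      points⇒lines : .{{_ : ℤ.NonZero (Q - 1ℤ)}} → h ≡ i * (Q * t - 1ℤ) + (Q - 1ℤ) * (Q * δ) → N ≡ k + δ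
      points⇒lines eq = ℤRing.+-cancelʳ (ℤ.- k) _ _ (ℤ.*-cancelˡ-≡ q _ _ (ℤ.*-cancelˡ-≡ q _ _ (ℤ.*-cancelˡ-≡ (Q - 1ℤ) _ _ (begin
        (Q - 1ℤ) * (q * (q * (N - k)))              ≡⟨ regroup q N k ⟩
        Q * ((Q - 1ℤ) * N - (Q - 1ℤ) * k)          ≡⟨ ℤRing.+-cancelˡ (i * (Q * t - 1ℤ)) _ _ (trans (sym h≡) eq) ⟩
        (Q - 1ℤ) * (Q * δ)                              ≡⟨ regroup′ q k δ ⟩
        (Q - 1ℤ) * (q * (q * (k + δ - k)))        ∎))))
        where
        open ≡-Reasoning
        regroup : ∀ q N k → (q * q - 1ℤ) * (q * (q * (N - k))) ≡
                            q * q * ((q * q - 1ℤ) * N - (q * q - 1ℤ) * k)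
        regroup = ℤSolver.solve-∀
        regroup′ : ∀ q k δ → (q * q - 1ℤ) * (q * q * δ) ≡ (q * q - 1ℤ) * (q * (q * (k + δ - k)))
        regroup′ = ℤSolver.solve-∀

-- Points and lines as vectors

module Dictionary {q : ℕ} (q-pp : IsPrimePower q)
  (F : FiniteField q) (K : FiniteField (q ℕ.^ 2)) (ext : Extension F K)
  (r : ℕ) (b : SymplecticForm F r)
  {m : ℕ} {ℒ : Pred (Projective.Line F r) 0ℓ} (cover : Symplectic.IsCover F r b m ℒ) where
  open Counting q-pp F K ext r b cover
  open PerpCounts q-pp F K ext r b cover
  open HermitianLemmas q-pp F K ext r b
  open QuadraticExtension q-pp F K ext
  open Lines F r
  open Covers F r b cover
  open Symplectic F r b
  open IsCover cover
  open FiniteField K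
  open Field K
  open Projective K r
  open LinearAlgebra K r
  open LinearCounts K r
  open Hermitian F K ext r b
  open SymplecticForm b
  open SymplecticLemmas F r b
  open 𝕍.Line using (u; v) renaming (independent to ind)

  private
    orthogonal : ∀ {ℓ} → ℒ ℓ → ∀ {w w′} → On-line ℓ w → On-line ℓ w′ → form w w′ ≡ 𝔽.0#
    orthogonal ℓ∈ℒ {w} {w′} w∈ w′∈ with w 𝕍.≟ᵛ 𝕍.0ᵛ | w′ 𝕍.≟ᵛ 𝕍.0ᵛ
    ... | yes refl | _        = 𝕍.Linear.φ[0]≡0 (linearˡ w′)
    ... | no _     | yes refl = 𝕍.Linear.φ[0]≡0 (linearʳ w)
    ... | no w≢0   | no w′≢0  = isotropic ℓ∈ℒ {w , w≢0} w∈ (w′ , w′≢0) w′∈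

    parts-on-line : ∀ {ℓ y} → Span (ιᵛ (u ℓ)) (ιᵛ (v ℓ)) y → On-line ℓ (reᵛ y) × On-line ℓ (imᵛ y)
    parts-on-line {ℓ} {y} y∈ = Span-ι⇒ {u = reᵛ y} {imᵛ y} (subst (Span (ιᵛ (u ℓ)) (ιᵛ (v ℓ))) (sym (+ω-surjective y)) y∈)

  -- Both parts of y lie on a totally isotropic line, so every value of `form` that occurs in ⟪ y ,
  -- y ⟫ vanishes and y lies on ℋ.
  InX⇒extended : ∀ {y} (y≢0 : y ≢ 0ᵛ) → InX y → extendedPoints ℒ (y , y≢0)
  InX⇒extended {y} y≢0 (_ , i , y∈) =
    y∈ℋ , line i , ⟨ uᵢ i , vᵢ i ⟩[ independent-ι (ind (line i)) ] , line∈ℒ i , (λ _ → Span-ι) , y∈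
    where
    a = reᵛ y
    c = imᵛ y
    a∈ = proj₁ (parts-on-line {line i} y∈)
    c∈ = proj₂ (parts-on-line {line i} y∈)
    y∈ℋ : ⟪ y , y ⟫ ≡ 0#
    y∈ℋ = subst (λ y → ⟪ y , y ⟫ ≡ 0#) (+ω-surjective y) (begin
      ⟪ a +ω c , a +ω c ⟫
        ≡⟨ Linear.additive (⟪⟫-linear (a +ω c)) (ιᵛ a) (ω · ιᵛ c) ⟩
      ⟪ ιᵛ a , a +ω c ⟫ + ⟪ ω · ιᵛ c , a +ω c ⟫
        ≡⟨ cong (λ z → ⟪ ιᵛ a , a +ω c ⟫ + z) (Linear.homogeneous (⟪⟫-linear (a +ω c)) ω (ιᵛ c)) ⟩
      ⟪ ιᵛ a , a +ω c ⟫ + ω * ⟪ ιᵛ c , a +ω c ⟫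
        ≡⟨ cong₂ (λ x z → x + ω * z)
             (⟪ι,+ω⟫≡0′ a a c (alternating a) (orthogonal (line∈ℒ i) a∈ c∈))
             (⟪ι,+ω⟫≡0′ c a c (orthogonal (line∈ℒ i) c∈ a∈) (alternating c)) ⟩
      0# + ω * 0#
        ≡⟨ trans (cong (λ z → 0# + z) (zeroʳ ω)) (+-identityʳ 0#) ⟩
      0#  ∎)
      where open ≡-Reasoning

  on-line-of-ℒ : ∀ {ℓ y} → ℒ ℓ → On-line ℓ (reᵛ y) → On-line ℓ (imᵛ y) → ∃ λ i → Span (uᵢ i) (vᵢ i) y
  on-line-of-ℒ {ℓ} {y} ℓ∈ℒ re∈ im∈ = i , subst (Span (uᵢ i) (vᵢ i)) (+ω-surjective y)
    (Span-ι⇐ (ℓ⊆ℓᵢ re∈) (ℓ⊆ℓᵢ im∈))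
    where
    i = index ℓ ℓ∈ℒ
    ℓ⊆ℓᵢ : ∀ {w} → On-line ℓ w → On-line (line i) w
    ℓ⊆ℓᵢ = ≈ₗ⇒⊆ {ℓ} {line i} (≈ₗ-sym {line i} {ℓ} (line-index ℓ ℓ∈ℒ))

  -- M is only known to contain the embedded points of ℓ. It contains the two independent embedded
  -- generators, so it is their span over K.
  extended⇒InX : ∀ {y} {y≢0 : y ≢ 0ᵛ} → extendedPoints ℒ (y , y≢0) → InX y
  extended⇒InX {y} {y≢0} (_ , ℓ , M , ℓ∈ℒ , ℓ⊆M , y∈M) =
    y≢0 , (let re∈ , im∈ = parts-on-line {ℓ} y∈ in on-line-of-ℒ {ℓ} ℓ∈ℒ re∈ im∈)
    where
    u≢0 = 𝕍.independent-≢0ˡ (ind ℓ)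
    v≢0 : v ℓ ≢ 𝕍.0ᵛ
    v≢0 v≡0 = 𝕍.independent-≢· (ind ℓ) 𝔽.0# (trans v≡0 (sym (𝕍.·-zeroˡ (u ℓ))))
    y∈ : Span (ιᵛ (u ℓ)) (ιᵛ (v ℓ)) y
    y∈ = Span-⊇ (Line.independent M) (independent-ι (ind ℓ))
      (ℓ⊆M (u ℓ , u≢0) (𝕍.u∈Span (u ℓ) (v ℓ))) (ℓ⊆M (v ℓ , v≢0) (𝕍.v∈Span (u ℓ) (v ℓ))) y∈M

  InX⇒∈ℒ : ∀ {s t} (st-ind : 𝕍.Independent s t) → InX (s +ω t) → ℒ 𝕍.⟨ s , t ⟩[ st-ind ]
  InX⇒∈ℒ {s} {t} st-ind (_ , i , y∈) = let s∈ , t∈ = Span-ι⇒ {u = s} {t} y∈ in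
    respects {line i} {𝕍.⟨ s , t ⟩[ st-ind ]}
      (≈ₗ-sym {𝕍.⟨ s , t ⟩[ st-ind ]} {line i} (generators⇒≈ₗ {𝕍.⟨ s , t ⟩[ st-ind ]} {line i} s∈ t∈)) (line∈ℒ i)

  ∈ℒ⇒InX : ∀ ℓ → ℒ ℓ → InX (u ℓ +ω v ℓ)
  ∈ℒ⇒InX ℓ ℓ∈ℒ = let i = index ℓ ℓ∈ℒ; ℓ≈ = ≈ₗ-sym {line i} {ℓ} (line-index ℓ ℓ∈ℒ) in
    𝕍.independent-≢0ˡ (ind ℓ) ∘ proj₁ ∘ +ω≡0⇒ , i ,
    Span-ι⇐ (≈ₗ⇒⊆ {ℓ} {line i} ℓ≈ (𝕍.u∈Span (u ℓ) (v ℓ))) (≈ₗ⇒⊆ {ℓ} {line i} ℓ≈ (𝕍.v∈Span (u ℓ) (v ℓ)))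

  X-respects : extendedPoints ℒ Respects Setoid._≈_ points
  X-respects {x , x≢0} {y , y≢0} (c , c≢0 , cx≡y) x∈X =
    InX⇒extended y≢0 (subst InX cx≡y (InX-· c≢0 (extended⇒InX {y≢0 = x≢0} x∈X)))

  module _ (x : V) (x≢0 : x ≢ 0ᵛ) where
    private
      S : Pred Point 0ℓ
      S = ((x , x≢0) ^⊥ʰ) ∩ extendedPoints ℒ

      rep? : ∀ y → Dec (InX y × ⟪ y , x ⟫ ≡ 0#)
      rep? y = inX? y ×-dec (⟪ y , x ⟫ ≟ 0#)

      scaled : ∀ {y z} → y ∼ᵥ z → InX z × ⟪ z , x ⟫ ≡ 0# → InX y × ⟪ y , x ⟫ ≡ 0#
      scaled {y} (c , c≢0 , refl) (z∈X , z⊥x) = subst InX (⁻¹-·-cancel c≢0 y) (InX-· (⁻¹-≢0 c≢0) z∈X)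
        , x*y≡0⇒y≡0 c≢0 (trans (sym (Linear.homogeneous (⟪⟫-linear x) c y)) z⊥x)

      _represents_ : V → Σ Point S → Set
      y represents ((z , _) , _) = y ∼ᵥ z

      represents⇒ : ∀ y z → y represents z → InX y × ⟪ y , x ⟫ ≡ 0#
      represents⇒ y ((_ , z≢0) , z⊥x , z∈X) y∼z = scaled y∼z (extended⇒InX {y≢0 = z≢0} z∈X , z⊥x)

      point : ∀ y → InX y × ⟪ y , x ⟫ ≡ 0# → Σ Point S
      point y (y∈X , y⊥x) = (y , proj₁ y∈X) , y⊥x , InX⇒extended (proj₁ y∈X) y∈X

      module ByVectors = Represented (On.setoid points (proj₁ {B = S})) Eᵛ (λ y → InX y × ⟪ y , x ⟫ ≡ 0#) rep?
        point _represents_ (λ y z → y ∼ᵥ? proj₁ (proj₁ z)) represents⇒ (λ _ _ y∼z _ → y∼z) (λ _ _ _ y∼z → y∼z)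

      class : (z : Σ Point S) → ∑ Eᵛ (λ y → ⟦ y ∼ᵥ? proj₁ (proj₁ z) ⟧) ≡ + (q ℕ.^ 2) ℤ.- 1ℤ
      class ((z , z≢0) , _) = ∑-class z≢0

      ∑rep : ∑ Eᵛ (λ y → ⟦ rep? y ⟧) ≡ perp-size x
      ∑rep = ∑-cong Eᵛ λ y → ⟦⟧-× (inX? y) (⟪ y , x ⟫ ≟ 0#)

    HasSize⇒perp-size : ∀ {n} → HasSize points S n → perp-size x ≡ + n ℤ.* (+ (q ℕ.^ 2) ℤ.- 1ℤ)
    HasSize⇒perp-size size = trans (sym ∑rep) (ByVectors.size⇒∑ class size)

    perp-size⇒HasSize : .{{_ : ℤ.NonZero (+ (q ℕ.^ 2) ℤ.- 1ℤ)}} → ∀ {n} →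
                        perp-size x ≡ + n ℤ.* (+ (q ℕ.^ 2) ℤ.- 1ℤ) → HasSize points S n
    perp-size⇒HasSize eq = ByVectors.∑⇒size class (trans ∑rep eq)

  module _ (ℓ : 𝕍.Line) where
    private
      InPerp : Pred 𝕍.Line 0ℓ
      InPerp ℓ′ = 𝕍.pointsOf ℓ′ ⊆ ℓ ^⊥

      PerpGenerators : Pred 𝕍.Line 0ℓ
      PerpGenerators ℓ′ = Perp (u ℓ) (v ℓ) (u ℓ′) × Perp (u ℓ) (v ℓ) (v ℓ′)

      perp-generators? : ∀ ℓ′ → Dec (PerpGenerators ℓ′)
      perp-generators? ℓ′ = perp? (u ℓ) (v ℓ) (u ℓ′) ×-dec perp? (u ℓ) (v ℓ) (v ℓ′)

      generators-≢0 : ∀ ℓ → u ℓ ≢ 𝕍.0ᵛ × v ℓ ≢ 𝕍.0ᵛ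
      generators-≢0 ℓ = 𝕍.independent-≢0ˡ (ind ℓ)
        , λ v≡0 → 𝕍.independent-≢· (ind ℓ) 𝔽.0# (trans v≡0 (sym (𝕍.·-zeroˡ (u ℓ))))

      to : ∀ ℓ′ → PerpGenerators ℓ′ → InPerp ℓ′
      to ℓ′ ((uu , uv) , (vu , vv)) {w , _} w∈ (z , _) z∈ = form-symmetric-0
        (perp-Span z (form-symmetric-0 (perp-Span (u ℓ′) uu uv z∈)) (form-symmetric-0 (perp-Span (v ℓ′) vu vv z∈)) w∈)

      from : ∀ ℓ′ → InPerp ℓ′ → PerpGenerators ℓ′
      from ℓ′ ⊆⊥ =
        let u≢0 , v≢0 = generators-≢0 ℓ; u′≢0 , v′≢0 = generators-≢0 ℓ′
            pair : ∀ w (w≢0 : w ≢ 𝕍.0ᵛ) → On-line ℓ′ w → Perp (u ℓ) (v ℓ) w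
            pair w w≢0 w∈ = ⊆⊥ {w , w≢0} w∈ (u ℓ , u≢0) (𝕍.u∈Span (u ℓ) (v ℓ))
                          , ⊆⊥ {w , w≢0} w∈ (v ℓ , v≢0) (𝕍.v∈Span (u ℓ) (v ℓ))
        in pair (u ℓ′) u′≢0 (𝕍.u∈Span (u ℓ′) (v ℓ′)) , pair (v ℓ′) v′≢0 (𝕍.v∈Span (u ℓ′) (v ℓ′))

      InPerp-resp : ∀ ℓ′ ℓ″ → ℓ′ ≈ₗ ℓ″ → InPerp ℓ′ → InPerp ℓ″
      InPerp-resp ℓ′ ℓ″ ℓ′≈ℓ″ ⊆⊥ {P} P∈ = ⊆⊥ {P} (Equivalence.from (ℓ′≈ℓ″ P) P∈)

      in-perp? : ∀ ℓ′ → Dec (InPerp ℓ′)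
      in-perp? ℓ′ = map′ (to ℓ′) (from ℓ′) (perp-generators? ℓ′)

      module InPerp = SubsetOfℒ InPerp InPerp-resp in-perp?

      ∑in-perp : ∑ Eℒ (λ i → ⟦ in-perp? (line i) ⟧) ≡
                 lines-in-perp (u ℓ) (v ℓ)
      ∑in-perp = ∑-cong Eℒ λ i → ⟦⟧-cong (in-perp? (line i))
        (perp-generators? (line i)) (from (line i)) (to (line i))

    HasSize⇒lines-in-perp : ∀ {n} → HasSize 𝕍.lines (λ ℓ′ → ℒ ℓ′ × 𝕍.pointsOf ℓ′ ⊆ ℓ ^⊥) n →
                            lines-in-perp (u ℓ) (v ℓ) ≡ + n
    HasSize⇒lines-in-perp size = trans (sym ∑in-perp) (InPerp.HasSize⇒∑ size)

    lines-in-perp⇒HasSize : ∀ {n} → lines-in-perp (u ℓ) (v ℓ) ≡ + n →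
                            HasSize 𝕍.lines (λ ℓ′ → ℒ ℓ′ × 𝕍.pointsOf ℓ′ ⊆ ℓ ^⊥) n
    lines-in-perp⇒HasSize eq = InPerp.∑⇒HasSize (trans ∑in-perp eq)

  point-or-line : ∀ {s t} → s +ω t ≢ 0ᵛ → 𝕍.Independent s t ⊎ ∃ (Point-span s t)
  point-or-line {s} {t} x≢0 with s 𝕍.≟ᵛ 𝕍.0ᵛ
  ... | yes refl = inj₂ (t , (λ t≡0 → x≢0 (trans (cong (𝕍.0ᵛ +ω_) t≡0) 0+ω0))
      , (𝔽.0# , sym (𝕍.·-zeroˡ t)) , (𝔽.1# , sym (𝕍.·-identity t)) , inj₂ refl)
  ... | no s≢0 with Enumeration.any? 𝔽.E (λ c → t 𝕍.≟ᵛ c 𝕍.· s)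
  ...   | yes t≡cs = inj₂ (s , s≢0 , (𝔽.1# , sym (𝕍.·-identity s)) , t≡cs , inj₁ refl)
  ...   | no ∄c    = inj₁ (𝕍.independent s≢0 λ c t≡cs → ∄c (c , t≡cs))

  point⇒InX : ∀ {s t p} → s +ω t ≢ 0ᵛ → Point-span s t p → InX (s +ω t)
  point⇒InX {s} {t} {p} x≢0 (p≢0 , (c , refl) , (d , refl) , _) = let i , p∈ = line-through p≢0 in
    x≢0 , i , Span-ι⇐ (𝕍.Span-· c p∈) (𝕍.Span-· d p∈)

-- The two implications for r = 3 + 2s

module TightDual {q : ℕ} (q-pp : IsPrimePower q)
  (F : FiniteField q) (K : FiniteField (q ℕ.^ 2)) (ext : Extension F K)
  (s : ℕ) (b : SymplecticForm F (3 ℕ.+ 2 ℕ.* s))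
  {m : ℕ} {ℒ : Pred (Projective.Line F (3 ℕ.+ 2 ℕ.* s)) 0ℓ}
  (cover : Symplectic.IsCover F (3 ℕ.+ 2 ℕ.* s) b m ℒ) where
  private
    r : ℕ
    r = 3 ℕ.+ 2 ℕ.* s
  open Counting q-pp F K ext r b cover
  open PerpCounts q-pp F K ext r b cover
  open Variance q-pp F K ext r b cover
  open Dictionary q-pp F K ext r b cover
  open HermitianLemmas q-pp F K ext r b
  open Covers F r b cover
  open Symplectic F r b
  open Projective K r using (0ᵛ)
  open Hermitian F K ext r b
  open 𝕍.Line using (u; v) renaming (independent to ind)

  private
    q′ Q t m′ L i′ k′ : ℤ
    q′ = + q
    Q  = + (q ℕ.^ 2)
    t  = + ((q ℕ.^ 2) ℕ.^ s)
    m′ = + m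
    L  = + ∣ℒ∣
    i′ = m′ ℤ.* (q′ ℤ.* q′ ℤ.- q′) ℤ.+ q′ ℤ.+ 1ℤ

    i k : ℕ
    i = m ℕ.* (q ℕ.^ 2 ℕ.∸ q) ℕ.+ q ℕ.+ 1
    k = (m ℕ.* θ (+ r ℤ.- + 4) q) ℕ./ suc q
    k′ = + k

    instance
      q≢0 : ℤ.NonZero q′
      q≢0 = ℕ.>-nonZero (ℕ.<-trans ℕ.z<s (Field.1<q F))

    Q≡ : Q ≡ q′ ℤ.* q′
    Q≡ = trans (cong (λ z → + (q ℕ.* z)) (ℕ.*-identityʳ q)) (ℤ.pos-* q q)

    NonZero[Q-1] : ℤ.NonZero (Q ℤ.- 1ℤ)
    NonZero[Q-1] = subst (λ n → ℤ.NonZero (+ n ℤ.- 1ℤ)) (ℕ.m+[n∸m]≡n (Field.1<q K))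
      (ℕ.>-nonZero ℕ.z<s)

    qʳ⁺¹≡ : + (q ℕ.^ suc r) ≡ q′ ℤ.* q′ ℤ.* (q′ ℤ.* q′) ℤ.* t
    qʳ⁺¹≡ = begin
      + (q ℕ.^ (4 ℕ.+ 2 ℕ.* s))
        ≡⟨ cong +_ (ℕ.^-distribˡ-+-* q 4 (2 ℕ.* s)) ⟩
      + (q ℕ.^ 4 ℕ.* q ℕ.^ (2 ℕ.* s))
        ≡⟨ cong (λ z → + (q ℕ.^ 4 ℕ.* z)) (ℕ.^-*-assoc q 2 s) ⟨
      + (q ℕ.^ 4 ℕ.* (q ℕ.^ 2) ℕ.^ s)
        ≡⟨ cong (λ z → + (z ℕ.* (q ℕ.^ 2) ℕ.^ s)) (fourth q) ⟩
      + (q ℕ.* q ℕ.* (q ℕ.* q) ℕ.* (q ℕ.^ 2) ℕ.^ s)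
        ≡⟨ trans (ℤ.pos-* (q ℕ.* q ℕ.* (q ℕ.* q)) ((q ℕ.^ 2) ℕ.^ s)) (cong (ℤ._* t)
             (trans (ℤ.pos-* (q ℕ.* q) (q ℕ.* q)) (cong₂ ℤ._*_ (ℤ.pos-* q q) (ℤ.pos-* q q)))) ⟩
      q′ ℤ.* q′ ℤ.* (q′ ℤ.* q′) ℤ.* t  ∎
      where
      open ≡-Reasoning
      fourth : ∀ q → q ℕ.* (q ℕ.* (q ℕ.* (q ℕ.* 1))) ≡ q ℕ.* q ℕ.* (q ℕ.* q)
      fourth = ℕSolver.solve-∀

    W≡ : + ((q ℕ.^ 2) ℕ.^ suc r) ≡ Q ℤ.* Q ℤ.* t ℤ.* (Q ℤ.* Q ℤ.* t)
    W≡ = begin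
      + ((q ℕ.^ 2) ℕ.^ suc r)
        ≡⟨ cong +_ (trans (ℕ.^-*-assoc q 2 (suc r)) (trans (cong (q ℕ.^_) (ℕ.*-comm 2 (suc r))) (sym (ℕ.^-*-assoc q (suc r) 2)))) ⟩
      + (q ℕ.^ suc r ℕ.* (q ℕ.^ suc r ℕ.* 1))
        ≡⟨ cong (λ z → + (q ℕ.^ suc r ℕ.* z)) (ℕ.*-identityʳ (q ℕ.^ suc r)) ⟩
      + (q ℕ.^ suc r ℕ.* q ℕ.^ suc r)
        ≡⟨ ℤ.pos-* (q ℕ.^ suc r) (q ℕ.^ suc r) ⟩
      + (q ℕ.^ suc r) ℤ.* + (q ℕ.^ suc r)
        ≡⟨ cong (λ z → z ℤ.* z) (trans qʳ⁺¹≡ (cong (λ z → z ℤ.* z ℤ.* t) (sym Q≡))) ⟩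
      Q ℤ.* Q ℤ.* t ℤ.* (Q ℤ.* Q ℤ.* t)  ∎
      where open ≡-Reasoning

    qʳ⁻¹≡ : + (q ℕ.^ (r ℕ.∸ 1)) ≡ Q ℤ.* t
    qʳ⁻¹≡ = trans (cong +_ (trans (ℕ.^-distribˡ-+-* q 2 (2 ℕ.* s)) (cong (q ℕ.^ 2 ℕ.*_) (sym (ℕ.^-*-assoc q 2 s)))))
      (ℤ.pos-* (q ℕ.^ 2) ((q ℕ.^ 2) ℕ.^ s))

    qʳ⁻³≡ : + (q ℕ.^ (r ℕ.∸ 3)) ≡ t
    qʳ⁻³≡ = cong +_ (sym (ℕ.^-*-assoc q 2 s))

    -- The truncated difference is the true one, as q ≤ q².
    i≡ : + i ≡ i′
    i≡ = cong (λ z → z ℤ.+ q′ ℤ.+ 1ℤ) (trans (ℤ.pos-* m (q ℕ.^ 2 ℕ.∸ q)) (cong (m′ ℤ.*_)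
      (trans (sym (ℤ.⊖-≥ q≤q²)) (trans (sym (ℤ.m-n≡m⊖n (q ℕ.^ 2) q)) (cong (ℤ._- q′) Q≡)))))
      where
      q≤q² : q ℕ.≤ q ℕ.^ 2
      q≤q² = ℕ.m≤m*n q (q ℕ.* 1) {{subst ℕ.NonZero (sym (ℕ.*-identityʳ q)) q≢0}}

    T-eq : (Q ℤ.- 1ℤ) ℤ.* + θ (+ ((r ℕ.∸ 3) ℕ./ 2)) (q ℕ.^ 2) ≡ Q ℤ.* t ℤ.- 1ℤ
    T-eq = trans (cong (λ n → (Q ℤ.- 1ℤ) ℤ.* + θ (+ n) (q ℕ.^ 2)) (trans (cong (ℕ._/ 2) (ℕ.*-comm 2 s)) (m*n/n≡m s 2)))
      (trans (θ-geometric s (q ℕ.^ 2)) (cong (ℤ._- 1ℤ) (ℤ.pos-* (q ℕ.^ 2) ((q ℕ.^ 2) ℕ.^ s))))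

    -- By `θ-odd`, q + 1 divides θ_{r-4,q}, so the division in k is exact and k = m(q^(r-3) - 1)/(q²
    -- - 1).
    k-eq : (Q ℤ.- 1ℤ) ℤ.* k′ ≡ m′ ℤ.* (t ℤ.- 1ℤ)
    k-eq = let T , θ≡ , T≡ = θ-odd s q in begin
      (Q ℤ.- 1ℤ) ℤ.* k′
        ≡⟨ cong (λ n → (Q ℤ.- 1ℤ) ℤ.* + (n ℕ./ suc q)) (trans (cong (m ℕ.*_) θ≡) (sym (ℕ.*-assoc m T (suc q)))) ⟩
      (Q ℤ.- 1ℤ) ℤ.* + ((m ℕ.* T ℕ.* suc q) ℕ./ suc q)
        ≡⟨ cong (λ n → (Q ℤ.- 1ℤ) ℤ.* + n) (m*n/n≡m (m ℕ.* T) (suc q)) ⟩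
      (Q ℤ.- 1ℤ) ℤ.* + (m ℕ.* T)
        ≡⟨ cong ((Q ℤ.- 1ℤ) ℤ.*_) (ℤ.pos-* m T) ⟩
      (Q ℤ.- 1ℤ) ℤ.* (m′ ℤ.* + T)
        ≡⟨ swap (Q ℤ.- 1ℤ) m′ (+ T) ⟩
      m′ ℤ.* ((Q ℤ.- 1ℤ) ℤ.* + T)
        ≡⟨ cong (m′ ℤ.*_) T≡ ⟩
      m′ ℤ.* (t ℤ.- 1ℤ)  ∎
      where
      open ≡-Reasoning
      swap : ∀ a b c → a ℤ.* (b ℤ.* c) ≡ b ℤ.* (a ℤ.* c)
      swap = ℤSolver.solve-∀

    L-eq : L ℤ.* (q′ ℤ.* q′) ≡ m′ ℤ.* (q′ ℤ.* q′ ℤ.* (q′ ℤ.* q′) ℤ.* t ℤ.- 1ℤ) ℤ.+ L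
    L-eq = trans ∣ℒ∣-formula (cong (λ z → m′ ℤ.* (z ℤ.- 1ℤ) ℤ.+ L) qʳ⁺¹≡)

    open Arithmetic q′ t m′ L L-eq

    h-eq : ∀ x y → L ℤ.* (q′ ℤ.* q′) ℤ.+ (q′ ℤ.* q′ ℤ.* (q′ ℤ.* q′) ℤ.- q′ ℤ.* q′) ℤ.* lines-in-perp x y ≡
      perp-size (x +ω y) ℤ.+ (m′ ℤ.- 1ℤ) ℤ.* ((q′ ℤ.+ 1ℤ) ℤ.* points-in-perp x y) ℤ.+ L
    h-eq x y = subst (λ Q → L ℤ.* Q ℤ.+ (Q ℤ.* Q ℤ.- Q) ℤ.* lines-in-perp x y ≡
      perp-size (x +ω y) ℤ.+ (m′ ℤ.- 1ℤ) ℤ.* ((q′ ℤ.+ 1ℤ) ℤ.* points-in-perp x y) ℤ.+ L) Q≡ (perp-size-formula x y)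

    X-eq : ∣X∣ ≡ i′ ℤ.* (Q ℤ.* Q ℤ.* t ℤ.- 1ℤ)
    X-eq = trans (X-size (trans (cong (λ Q → L ℤ.* (Q ℤ.* Q)) (sym Q≡)) (trans ∣X∣-formula
        (cong (λ z → ∣X∣ ℤ.+ (m′ ℤ.- 1ℤ) ℤ.* ((q′ ℤ.+ 1ℤ) ℤ.* (z ℤ.- 1ℤ)) ℤ.+ L) qʳ⁺¹≡))))
      (cong (λ Q → i′ ℤ.* (Q ℤ.* Q ℤ.* t ℤ.- 1ℤ)) (sym Q≡))

    -- The two sizes in `IsTight`, counted in vectors: they are multiplied by q² - 1, and (q² - 1)
    -- θ_{(r-3)/2,q²} = q^(r-1) - 1.
    inside outside : ℤ
    outside = i′ ℤ.* (Q ℤ.* t ℤ.- 1ℤ)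
    inside  = outside ℤ.+ (Q ℤ.- 1ℤ) ℤ.* (Q ℤ.* t)

    T : ℕ
    T = θ (+ ((r ℕ.∸ 3) ℕ./ 2)) (q ℕ.^ 2)

    outside≡ : + (i ℕ.* T) ℤ.* (Q ℤ.- 1ℤ) ≡ outside
    outside≡ = trans (cong (ℤ._* (Q ℤ.- 1ℤ)) (trans (ℤ.pos-* i T) (cong (ℤ._* + T) i≡)))
      (trans (regroup i′ (+ T) (Q ℤ.- 1ℤ)) (cong (i′ ℤ.*_) T-eq))
      where
      regroup : ∀ a b c → a ℤ.* b ℤ.* c ≡ a ℤ.* (c ℤ.* b)
      regroup = ℤSolver.solve-∀

    inside≡ : + (i ℕ.* T ℕ.+ q ℕ.^ (r ℕ.∸ 1)) ℤ.* (Q ℤ.- 1ℤ) ≡ inside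
    inside≡ = trans (ℤ.*-distribʳ-+ (Q ℤ.- 1ℤ) (+ (i ℕ.* T)) (+ (q ℕ.^ (r ℕ.∸ 1))))
      (cong₂ ℤ._+_ outside≡ (trans (cong (ℤ._* (Q ℤ.- 1ℤ)) qʳ⁻¹≡) (ℤ.*-comm (Q ℤ.* t) (Q ℤ.- 1ℤ))))

    -- At the points of PG(r,q) the tight condition holds for every m-cover, so only the points off
    -- PG(r,q) distinguish covers.
    perp-size-point : ∀ {x y p} → Point-span x y p → perp-size (x +ω y) ≡ inside
    perp-size-point {x} {y} span = subst (λ Q → perp-size (x +ω y) ≡ i′ ℤ.* (Q ℤ.* t ℤ.- 1ℤ) ℤ.+ (Q ℤ.- 1ℤ) ℤ.* (Q ℤ.* t)) (sym Q≡)
      (point-perp (h-eq x y) (trans (points-in-perp-point span) qʳ⁺¹≡) (lines-in-perp-point span))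

    module _ {x y} (xy-ind : 𝕍.Independent x y) (δ : ℤ) where
      private
        R-eq = trans (points-in-perp-line xy-ind) qʳ⁺¹≡
        k-eq′ : (q′ ℤ.* q′ ℤ.- 1ℤ) ℤ.* k′ ≡ m′ ℤ.* (t ℤ.- 1ℤ)
        k-eq′ = subst (λ Q → (Q ℤ.- 1ℤ) ℤ.* k′ ≡ m′ ℤ.* (t ℤ.- 1ℤ)) Q≡ k-eq
        Size : ℤ → Set
        Size Q = perp-size (x +ω y) ≡ i′ ℤ.* (Q ℤ.* t ℤ.- 1ℤ) ℤ.+ (Q ℤ.- 1ℤ) ℤ.* (Q ℤ.* δ)

      lines⇒size : lines-in-perp x y ≡ k′ ℤ.+ δ → Size Q
      lines⇒size eq = subst Size (sym Q≡) (lines⇒points (h-eq x y) {δ = δ} R-eq k-eq′ eq)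

      size⇒lines : Size Q → lines-in-perp x y ≡ k′ ℤ.+ δ
      size⇒lines eq = points⇒lines (h-eq x y) {δ = δ} R-eq k-eq′
        {{subst (λ Q → ℤ.NonZero (Q ℤ.- 1ℤ)) Q≡ NonZero[Q-1]}} (subst Size Q≡ eq)

    no-extra : ∀ o Q → o ≡ o ℤ.+ (Q ℤ.- 1ℤ) ℤ.* (Q ℤ.* 0ℤ)
    no-extra = ℤSolver.solve-∀

  tight⇒dual : IsTight i (extendedPoints ℒ) → IsDualOfSymplecticType m ℒ
  tight⇒dual tight ℓ = on , off
    where
    open IsTight tight using (⊆ℋ) renaming (inside to tight-inside)
    x = u ℓ +ω v ℓ
    x≢0 : x ≢ 0ᵛ
    x≢0 = 𝕍.independent-≢0ˡ (ind ℓ) ∘ proj₁ ∘ +ω≡0⇒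

    size-on-X : ∀ y → InX y → perp-size y ≡ inside
    size-on-X y y∈X = let y≢0 = proj₁ y∈X; Y∈X = InX⇒extended y≢0 y∈X in
      trans (HasSize⇒perp-size y y≢0 (tight-inside (y , y≢0) (⊆ℋ {y , y≢0} Y∈X) Y∈X)) inside≡

    on : ℒ ℓ → _
    on ℓ∈ℒ = lines-in-perp⇒HasSize ℓ (trans (size⇒lines (ind ℓ) t (size-on-X x (∈ℒ⇒InX ℓ ℓ∈ℒ)))
      (cong (λ z → k′ ℤ.+ z) (sym qʳ⁻³≡)))

    off : ¬ ℒ ℓ → _
    off ℓ∉ℒ = lines-in-perp⇒HasSize ℓ (trans (size⇒lines (ind ℓ) 0ℤ (trans
        (tight-off-X t i′ W≡ X-eq size-on-X x≢0 (ℓ∉ℒ ∘ InX⇒∈ℒ (ind ℓ))) (no-extra outside Q)))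
      (ℤ.+-identityʳ k′))

  dual⇒tight : IsDualOfSymplecticType m ℒ → IsTight i (extendedPoints ℒ)
  dual⇒tight dual = record
    { respects = λ {P} {P′} → X-respects {P} {P′}
    ; ⊆ℋ       = proj₁
    ; inside   = λ (y , y≢0) _ Y∈X → perp-size⇒HasSize y y≢0 {{NonZero[Q-1]}}
        (trans (size-on-X y≢0 (extended⇒InX {y≢0 = y≢0} Y∈X)) (sym inside≡))
    ; outside  = λ (y , y≢0) _ Y∉X → perp-size⇒HasSize y y≢0 {{NonZero[Q-1]}}
        (trans (size-off-X y≢0 (Y∉X ∘ InX⇒extended y≢0)) (sym outside≡))
    }
    where
    split : ∀ {y} → y ≢ 0ᵛ → 𝕍.Independent (reᵛ y) (imᵛ y) ⊎ ∃ (Point-span (reᵛ y) (imᵛ y))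
    split {y} y≢0 = point-or-line (subst (_≢ 0ᵛ) (sym (+ω-surjective y)) y≢0)

    size-on-X : ∀ {y} → y ≢ 0ᵛ → InX y → perp-size y ≡ inside
    size-on-X {y} y≢0 y∈X = subst (λ y → perp-size y ≡ inside) (+ω-surjective y) (size (split y≢0))
      where
      size : 𝕍.Independent (reᵛ y) (imᵛ y) ⊎ ∃ (Point-span (reᵛ y) (imᵛ y)) → perp-size (reᵛ y +ω imᵛ y) ≡ inside
      size (inj₂ (_ , span)) = perp-size-point span
      size (inj₁ ab-ind) = lines⇒size ab-ind t (trans
        (HasSize⇒lines-in-perp ℓ (proj₁ (dual ℓ) (InX⇒∈ℒ ab-ind (subst InX (sym (+ω-surjective y)) y∈X))))
        (cong (λ z → k′ ℤ.+ z) qʳ⁻³≡))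
        where ℓ = 𝕍.⟨ reᵛ y , imᵛ y ⟩[ ab-ind ]

    size-off-X : ∀ {y} → y ≢ 0ᵛ → ¬ InX y → perp-size y ≡ outside
    size-off-X {y} y≢0 y∉X = subst (λ y → perp-size y ≡ outside) (+ω-surjective y) (size (split y≢0))
      where
      size : 𝕍.Independent (reᵛ y) (imᵛ y) ⊎ ∃ (Point-span (reᵛ y) (imᵛ y)) → perp-size (reᵛ y +ω imᵛ y) ≡ outside
      -- A point of PG(r,q) lies on some line of the cover and thus cannot be off the cone.
      size (inj₂ (_ , span)) = contradiction
        (subst InX (+ω-surjective y) (point⇒InX (subst (_≢ 0ᵛ) (sym (+ω-surjective y)) y≢0) span)) y∉X
      size (inj₁ ab-ind) = trans (lines⇒size ab-ind 0ℤ (trans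
        (HasSize⇒lines-in-perp ℓ (proj₂ (dual ℓ) λ ℓ∈ℒ → y∉X (subst InX (+ω-surjective y) (∈ℒ⇒InX ℓ ℓ∈ℒ))))
        (sym (ℤ.+-identityʳ k′)))) (sym (no-extra outside Q))
        where ℓ = 𝕍.⟨ reᵛ y , imᵛ y ⟩[ ab-ind ]

open import Data.Nat.Base using (_+_; _*_; _∸_; _^_; _≤_)

theorem3p2 :
    (r : ℕ) → 3 ≤ r → 2 ∤ r →
    (q : ℕ) → IsPrimePower q →
    (F : FiniteField q) (K : FiniteField (q ^ 2)) (E : Extension F K) →
    (b : SymplecticForm F r) →
    let open Symplectic F r b
        open Hermitian F K E r b
    in
    (m : ℕ) (ℒ : Pred (Projective.Line F r) 0ℓ) → IsCover m ℒ →
    IsTight (m * (q ^ 2 ∸ q) + q + 1) (extendedPoints ℒ) ⇔ IsDualOfSymplecticType m ℒ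
theorem3p2 r 3≤r 2∤r q q-pp F K E b m ℒ cover with odd≥3 3≤r 2∤r
... | s , refl = mk⇔ (tight⇒dual q-pp F K E s b cover) (dual⇒tight q-pp F K E s b cover)
  where open TightDual
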